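{- Fix $n \geq 0$ and let $B \subseteq \omega$ be a set which is not $\Sigma^0_{n+1}$. Then for every set $A \subseteq \omega$ there is an infinite set $G$ with $G \subseteq A$ or $G \subseteq \overline{A}$ such that $B$ is not $\Sigma^0_{n+1}(G)$.
   Context: A set is $\Sigma^0_{n+1}(G)$ if it is definable by a $\Sigma^0_{n+1}$ formula of arithmetic with $G$ as a set parameter (equivalently, it is c.e. in $G^{(n)}$). $\overline{A} = \omega \setminus A$. -}

module Defs where

open import Data.Nat using (ℕ; zero; suc; _+_; _*_; _<_)
open import Data.Fin using (Fin; zero; suc)
open import Data.Bool using (Bool; true; false)
open import Data.Product using (Σ; _×_; _,_)
open import Data.Sum using (_⊎_)
open import Relation.Nullary using (¬_)
open import Relation.Binary.PropositionalEquality using (_≡_)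

SubsetOfω : Set
SubsetOfω = ℕ → Bool

_∈_ : ℕ → SubsetOfω → Set
x ∈ X = X x ≡ true

∁ : SubsetOfω → SubsetOfω
∁ X x with X x
... | true  = false
... | false = true

_⊆_ : SubsetOfω → SubsetOfω → Set
X ⊆ Y = ∀ x → x ∈ X → x ∈ Y

Infinite : SubsetOfω → Set
Infinite X = ∀ m → Σ ℕ (λ x → (m < x) × (x ∈ X))

∅ : SubsetOfω
∅ _ = false

data Term (k : ℕ) : Set where
  var  : Fin k → Term k
  zer  : Term k
  succ : Term k → Term k
  _⊕_  : Term k → Term k → Term k
  _⊗_  : Term k → Term k → Term k

data Δ₀ (k : ℕ) : Set where
  _≐_    : Term k → Term k → Δ₀ k
  _≺_    : Term k → Term k → Δ₀ k
  inX    : Term k → Δ₀ k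
  neg    : Δ₀ k → Δ₀ k
  _∧'_   : Δ₀ k → Δ₀ k → Δ₀ k
  _∨'_   : Δ₀ k → Δ₀ k → Δ₀ k
  ∀<     : Term k → Δ₀ (suc k) → Δ₀ k
  ∃<     : Term k → Δ₀ (suc k) → Δ₀ k

-- Σ⁰ₙ and Π⁰ₙ formulas: Σ⁰₀ = Π⁰₀ = Δ₀,
-- Σ⁰ₙ₊₁ = ∃x̄ Π⁰ₙ, Π⁰ₙ₊₁ = ∀x̄ Σ⁰ₙ (blocks of like quantifiers).
data SigmaF : ℕ → ℕ → Set
data PiF : ℕ → ℕ → Set

data SigmaF where
  bnd  : ∀ {k} → Δ₀ k → SigmaF zero k
  base : ∀ {n k} → PiF n k → SigmaF (suc n) k
  ex   : ∀ {n k} → SigmaF (suc n) (suc k) → SigmaF (suc n) k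

data PiF where
  bnd  : ∀ {k} → Δ₀ k → PiF zero k
  base : ∀ {n k} → SigmaF n k → PiF (suc n) k
  all  : ∀ {n k} → PiF (suc n) (suc k) → PiF (suc n) k

Env : ℕ → Set
Env k = Fin k → ℕ

extend : ∀ {k} → ℕ → Env k → Env (suc k)
extend x ρ zero    = x
extend x ρ (suc i) = ρ i

evalT : ∀ {k} → Env k → Term k → ℕ
evalT ρ (var i)  = ρ i
evalT ρ zer      = zero
evalT ρ (succ t) = suc (evalT ρ t)
evalT ρ (s ⊕ t)  = evalT ρ s + evalT ρ t
evalT ρ (s ⊗ t)  = evalT ρ s * evalT ρ t

satΔ : ∀ {k} → SubsetOfω → Env k → Δ₀ k → Set
satΔ G ρ (s ≐ t)   = evalT ρ s ≡ evalT ρ t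
satΔ G ρ (s ≺ t)   = evalT ρ s < evalT ρ t
satΔ G ρ (inX t)   = evalT ρ t ∈ G
satΔ G ρ (neg φ)   = ¬ satΔ G ρ φ
satΔ G ρ (φ ∧' ψ)  = satΔ G ρ φ × satΔ G ρ ψ
satΔ G ρ (φ ∨' ψ)  = satΔ G ρ φ ⊎ satΔ G ρ ψ
satΔ G ρ (∀< t φ)  = ∀ y → y < evalT ρ t → satΔ G (extend y ρ) φ
satΔ G ρ (∃< t φ)  = Σ ℕ (λ y → (y < evalT ρ t) × satΔ G (extend y ρ) φ)

satΣ : ∀ {n k} → SubsetOfω → Env k → SigmaF n k → Set
satΠ : ∀ {n k} → SubsetOfω → Env k → PiF n k → Set
satΣ G ρ (bnd φ)  = satΔ G ρ φ
satΣ G ρ (base φ) = satΠ G ρ φ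
satΣ G ρ (ex φ)   = Σ ℕ (λ y → satΣ G (extend y ρ) φ)
satΠ G ρ (bnd φ)  = satΔ G ρ φ
satΠ G ρ (base φ) = satΣ G ρ φ
satΠ G ρ (all φ)  = ∀ y → satΠ G (extend y ρ) φ

single : ℕ → Env 1
single x = extend x (λ ())

IsSigma⁰ : ℕ → SubsetOfω → SubsetOfω → Set
IsSigma⁰ m G B = Σ (SigmaF m 1) (λ φ →
  ∀ x → (x ∈ B → satΣ G (single x) φ) × (satΣ G (single x) φ → x ∈ B))

IsSigma⁰-plain : ℕ → SubsetOfω → Set
IsSigma⁰-plain m B = IsSigma⁰ m ∅ B

{-# OPTIONS --safe #-}
-- Following Monin and Patey, G is built by Mathias forcing with conditions (σ, X), where the
-- reservoirs X are taken from a partition regular class 𝒱, so that one of X ∩ A and X ∖ A always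
-- remains available.
--
-- Strata. Start with 𝒱 = the infinite sets and p = ∅. Given (p, 𝒱), choose r low over p whose
-- columns contain, for any two Σ₁(p) open classes and any Boolean combination of earlier columns,
-- a partition of the latter into a part outside the first class and a part outside the second one,
-- if there is one; then choose an ultrafilter u on the algebra of the columns, with all its elements
-- in 𝒱. Let p⁺ = (what the jump of p ⊕ r decides about the columns) ⊕ u and let 𝒱⁺ consist of the Z
-- such that Z ∩ X lies in every Σ₁(p) open class containing all of u, for each X in u. Then 𝒱⁺ is
-- again partition regular, and "σ can be extended inside the reservoir so as to make a given Σ₁(p)
-- property true" has a Π₁(p⁺) answer which is the same for all reservoirs in 𝒱⁺. So a Σ₍ₘ₊₂₎ formula
-- over p becomes a Σ₍ₘ₊₁₎ formula over p⁺. If B is not Σ₍ₘ₊₂₎(p), low and preserving basis theorems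
-- allow r and u to be chosen such that B is not Σ₍ₘ₊₁₎(p⁺). After n steps only Σ₁(p) formulas are
-- left, and B is not Σ₁(p).
--
-- Last step. Given conditions for A and for its complement, one Σ₁ formula for each side and a common
-- reservoir X, the set of x such that every partition X = Z₀ ⊔ Z₁ lets the first formula be made true
-- at x inside Z₀ or the second one inside Z₁ is Σ₁(p ⊕ X) by compactness, hence differs from B. A
-- difference yields an extension on one of the sides on which its formula does not define B.
module Submission where

open import Defs
open import Data.Bool using (Bool; true; false; not; _∧_; _∨_; if_then_else_)
open import Data.Nat
open import Data.Nat.Properties
open import Data.Nat.Divisibility
open import Data.Nat.Coprimality using (Coprime; coprime-divisor) renaming (sym to coprime-sym)
open import Data.Fin using (Fin; zero; suc; toℕ)
open import Data.List using (List; []; _∷_; _++_)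
open import Data.List.Membership.DecPropositional _≟_ using (_∈?_)
open import Data.List.Membership.Propositional using () renaming (_∈_ to _∈ₗ_)
open import Data.List.Membership.Propositional.Properties using (∈-++⁺ˡ; ∈-++⁺ʳ; ∈-++⁻)
open import Data.List.Relation.Unary.Any using (here; there)
open import Data.Maybe using (Maybe; just; nothing)
open import Data.Maybe.Properties using (just-injective)
open import Data.Product
open import Data.Sum as Sum using (_⊎_; inj₁; inj₂)
open import Data.Unit using (⊤; tt)
open import Data.Vec using (Vec; []; _∷_; lookup)
open import Data.Empty using (⊥; ⊥-elim)
open import Relation.Nullary using (¬_; Dec; yes; no; does; contradiction)
open import Relation.Nullary.Decidable using (dec-true; dec-false)
open import Relation.Binary.PropositionalEquality
open import Relation.Binary.Definitions using (tri<; tri≈; tri>)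
open import Axiom.ExcludedMiddle using (ExcludedMiddle)
open import Level using (0ℓ)

-- The main obstacle is that A is arbitrary and may even compute B, so no complexity bound may
-- involve A. It enters only through the demands that stems lie in A and that X ∩ A lie in 𝒱.
-- Questions are asked about X alone, and are turned into information about A by partition
-- regularity or by evaluating a statement about all partitions at the one given by A. The second
-- obstacle is that beyond Σ₁ the existence of a suitable extension depends on the reservoir, and
-- quantifying over reservoirs would be far too complex; restricting them to 𝒱 removes this
-- dependence. Each stratum costs exactly one level of the hypothesis on B, because the decisions
-- about the columns are computable from the jump of p. Complexity is measured without machines: Σ⁰₁
-- means one unbounded existential quantifier over a Δ₀ formula, and every bound is obtained by
-- assembling the predicate from the closure operations on `S1`.

pattern #0 = zero
pattern #1 = suc zero
pattern #2 = suc (suc zero)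
pattern #3 = suc (suc (suc zero))
pattern #4 = suc (suc (suc (suc zero)))

infix 1 _iff_
_iff_ : Set → Set → Set
A iff B = (A → B) × (B → A)

iff-trans : {A B C : Set} → A iff B → B iff C → A iff C
iff-trans (f , g) (f' , g') = (λ a → f' (f a)) , (λ c → g (g' c))

iff-sym : {A B : Set} → A iff B → B iff A
iff-sym (f , g) = g , f

≢true : ∀ {b : Bool} → b ≢ true iff b ≡ false
≢true {true}  = (λ n → ⊥-elim (n refl)) , λ ()
≢true {false} = (λ _ → refl) , λ _ ()

-- Substitution in terms and Δ₀ formulas

subT : ∀ {k j} → (Fin k → Term j) → Term k → Term j
subT θ (var i)  = θ i
subT θ zer      = zer
subT θ (succ t) = succ (subT θ t)
subT θ (s ⊕ t)  = subT θ s ⊕ subT θ t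
subT θ (s ⊗ t)  = subT θ s ⊗ subT θ t

wkT : ∀ {k} → Term k → Term (suc k)
wkT = subT (λ i → var (suc i))

lift : ∀ {k j} → (Fin k → Term j) → Fin (suc k) → Term (suc j)
lift θ zero    = var zero
lift θ (suc i) = wkT (θ i)

subΔ : ∀ {k j} → (Fin k → Term j) → Δ₀ k → Δ₀ j
subΔ θ (s ≐ t)  = subT θ s ≐ subT θ t
subΔ θ (s ≺ t)  = subT θ s ≺ subT θ t
subΔ θ (inX t)  = inX (subT θ t)
subΔ θ (neg φ)  = neg (subΔ θ φ)
subΔ θ (φ ∧' ψ) = subΔ θ φ ∧' subΔ θ ψ
subΔ θ (φ ∨' ψ) = subΔ θ φ ∨' subΔ θ ψ
subΔ θ (∀< t φ) = ∀< (subT θ t) (subΔ (lift θ) φ)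
subΔ θ (∃< t φ) = ∃< (subT θ t) (subΔ (lift θ) φ)

Realises : ∀ {k j} → (Fin k → Term j) → Env j → Env k → Set
Realises θ ρ ρ' = ∀ i → evalT ρ (θ i) ≡ ρ' i

eval-sub : ∀ {k j} {θ : Fin k → Term j} {ρ ρ'} →
  Realises θ ρ ρ' → ∀ t → evalT ρ (subT θ t) ≡ evalT ρ' t
eval-sub h (var i)  = h i
eval-sub h zer      = refl
eval-sub {θ = θ} {ρ} {ρ'} h (succ t) = cong suc (eval-sub {θ = θ} {ρ} {ρ'} h t)
eval-sub {θ = θ} {ρ} {ρ'} h (s ⊕ t)  = cong₂ _+_ (eval-sub {θ = θ} {ρ} {ρ'} h s) (eval-sub {θ = θ} {ρ} {ρ'} h t)
eval-sub {θ = θ} {ρ} {ρ'} h (s ⊗ t)  = cong₂ _*_ (eval-sub {θ = θ} {ρ} {ρ'} h s) (eval-sub {θ = θ} {ρ} {ρ'} h t)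

eval-wk : ∀ {k} (ρ : Env k) y t → evalT (extend y ρ) (wkT t) ≡ evalT ρ t
eval-wk ρ y t = eval-sub {θ = λ i → var (suc i)} {extend y ρ} {ρ} (λ _ → refl) t

eval-lift : ∀ {k j} {θ : Fin k → Term j} {ρ ρ'} y → Realises θ ρ ρ' →
  Realises (lift θ) (extend y ρ) (extend y ρ')
eval-lift y h zero    = refl
eval-lift {θ = θ} {ρ} y h (suc i) = trans (eval-wk ρ y (θ i)) (h i)

sat-sub : ∀ {G k j} (θ : Fin k → Term j) ρ ρ' → Realises θ ρ ρ' →
  ∀ φ → satΔ G ρ' φ iff satΔ G ρ (subΔ θ φ)
sat-sub θ ρ ρ' h (s ≐ t) rewrite eval-sub {θ = θ} {ρ} {ρ'} h s | eval-sub {θ = θ} {ρ} {ρ'} h t = (λ z → z) , (λ z → z)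
sat-sub θ ρ ρ' h (s ≺ t) rewrite eval-sub {θ = θ} {ρ} {ρ'} h s | eval-sub {θ = θ} {ρ} {ρ'} h t = (λ z → z) , (λ z → z)
sat-sub θ ρ ρ' h (inX t) rewrite eval-sub {θ = θ} {ρ} {ρ'} h t = (λ z → z) , (λ z → z)
sat-sub θ ρ ρ' h (neg φ) = let (f , g) = sat-sub θ ρ ρ' h φ in (λ n x → n (g x)) , (λ n x → n (f x))
sat-sub θ ρ ρ' h (φ ∧' ψ) = let (f , g) = sat-sub θ ρ ρ' h φ ; (f' , g') = sat-sub θ ρ ρ' h ψ in
  map f f' , map g g'
sat-sub θ ρ ρ' h (φ ∨' ψ) = let (f , g) = sat-sub θ ρ ρ' h φ ; (f' , g') = sat-sub θ ρ ρ' h ψ in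
  Sum.map f f' , Sum.map g g'
sat-sub θ ρ ρ' h (∀< t φ) rewrite eval-sub {θ = θ} {ρ} {ρ'} h t =
    (λ f y l → proj₁ (sat-sub _ _ (extend y ρ') (eval-lift {θ = θ} {ρ} y h) φ) (f y l))
  , (λ f y l → proj₂ (sat-sub _ _ (extend y ρ') (eval-lift {θ = θ} {ρ} y h) φ) (f y l))
sat-sub θ ρ ρ' h (∃< t φ) rewrite eval-sub {θ = θ} {ρ} {ρ'} h t =
    (λ (y , l , x) → y , l , proj₁ (sat-sub _ _ (extend y ρ') (eval-lift {θ = θ} {ρ} y h) φ) x)
  , (λ (y , l , x) → y , l , proj₂ (sat-sub _ _ (extend y ρ') (eval-lift {θ = θ} {ρ} y h) φ) x)

-- Closure properties of Σ⁰₁ predicates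

-- S1 G P: the predicate P is Σ⁰₁ relative to G. A primed name such as len' or Cov' is the
-- Σ⁰₁-definition of the unprimed predicate, with terms in the variables v0, v1, … as arguments.
S1 : SubsetOfω → ∀ {k} → (Env k → Set) → Set
S1 G {k} P = Σ (Δ₀ (suc k)) λ δ → ∀ ρ → P ρ iff ∃ λ t → satΔ G (extend t ρ) δ

module _ {G : SubsetOfω} where

  S1-iff : ∀ {k} {P Q : Env k → Set} → (∀ ρ → P ρ iff Q ρ) → S1 G P → S1 G Q
  S1-iff h (δ , d) = δ , λ ρ → iff-trans (iff-sym (h ρ)) (d ρ)

  at : ∀ {k} (δ : Δ₀ k) → S1 G (λ ρ → satΔ G ρ δ)
  at δ = subΔ (λ i → var (suc i)) δ , λ ρ →
      (λ x → 0 , proj₁ (sat-sub _ _ ρ (λ _ → refl) δ) x)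
    , (λ (t , x) → proj₂ (sat-sub _ (extend t ρ) ρ (λ _ → refl) δ) x)

  -- Pointwise equal environments need not be equal as functions; the identity substitution `var`
  -- gives a formula whose truth is compared with both.
  S1-ext : ∀ {k} {P : Env k → Set} → S1 G P → ∀ {ρ ρ'} → (∀ i → ρ i ≡ ρ' i) → P ρ → P ρ'
  S1-ext {k} (δ , d) {ρ} {ρ'} h p = let (t , x) = proj₁ (d ρ) p in
    proj₂ (d ρ') (t , proj₁ (iff-trans (sat-sub var _ _ (λ _ → refl) δ) (iff-sym (sat-sub var _ _ (eq t) δ))) x)
    where
    eq : ∀ t i → extend t ρ i ≡ extend t ρ' i
    eq t zero    = refl
    eq t (suc i) = h i

  renf : ∀ {k j} {P : Env k → Set} → S1 G P → (θ : Fin k → Term j) →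
    S1 G (λ ρ → P (λ i → evalT ρ (θ i)))
  renf {k} {j} (δ , d) θ = subΔ θ' δ , λ ρ → iff-trans (d _)
      ( (λ (t , x) → t , proj₁ (sat-sub θ' _ (extend t _) (eq ρ t) δ) x)
      , (λ (t , x) → t , proj₂ (sat-sub θ' _ (extend t _) (eq ρ t) δ) x))
    where
    θ' : Fin (suc k) → Term (suc j)
    θ' zero    = var zero
    θ' (suc i) = wkT (θ i)
    eq : ∀ ρ t i → evalT (extend t ρ) (θ' i) ≡ extend t (λ i → evalT ρ (θ i)) i
    eq ρ t zero    = refl
    eq ρ t (suc i) = eval-wk ρ t (θ i)

  ren : ∀ {k j} {P : Env k → Set} → S1 G P → (θ : Vec (Term j) k) →
    S1 G (λ ρ → P (λ i → evalT ρ (lookup θ i)))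
  ren p θ = renf p (lookup θ)

  infixr 6 _&_
  infixr 5 _∣∣_

  _∣∣_ : ∀ {k} {P Q : Env k → Set} → S1 G P → S1 G Q → S1 G (λ ρ → P ρ ⊎ Q ρ)
  (δ , d) ∣∣ (ε , e) = (δ ∨' ε) , λ ρ →
      (λ { (inj₁ p) → let (t , x) = proj₁ (d ρ) p in t , inj₁ x
         ; (inj₂ q) → let (t , x) = proj₁ (e ρ) q in t , inj₂ x })
    , (λ { (t , inj₁ x) → inj₁ (proj₂ (d ρ) (t , x))
         ; (t , inj₂ x) → inj₂ (proj₂ (e ρ) (t , x)) })

  -- The bound variable t of the normal form becomes a bound on the witness of δ.
  below : ∀ {k} → Δ₀ (suc k) → Δ₀ (suc k)
  below δ = ∃< (succ (var zero)) (subΔ θ δ)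
    where
    θ : ∀ {k} → Fin (suc k) → Term (suc (suc k))
    θ zero    = var zero
    θ (suc i) = var (suc (suc i))

  below-sat : ∀ {k} (δ : Δ₀ (suc k)) ρ T →
    satΔ G (extend T ρ) (below δ) iff ∃ λ t → t ≤ T × satΔ G (extend t ρ) δ
  below-sat δ ρ T =
      (λ (t , l , x) → t , ≤-pred l , proj₂ (sat-sub _ (extend t (extend T ρ)) (extend t ρ) (λ { zero → refl ; (suc i) → refl }) δ) x)
    , (λ (t , l , x) → t , s≤s l , proj₁ (sat-sub _ (extend t (extend T ρ)) (extend t ρ) (λ { zero → refl ; (suc i) → refl }) δ) x)

  _&_ : ∀ {k} {P Q : Env k → Set} → S1 G P → S1 G Q → S1 G (λ ρ → P ρ × Q ρ)
  (δ , d) & (ε , e) = (below δ ∧' below ε) , λ ρ →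
      (λ (p , q) → let (t , x) = proj₁ (d ρ) p ; (u , y) = proj₁ (e ρ) q in
         t ⊔ u , proj₂ (below-sat δ ρ (t ⊔ u)) (t , m≤m⊔n t u , x)
               , proj₂ (below-sat ε ρ (t ⊔ u)) (u , m≤n⊔m t u , y))
    , (λ (T , x , y) → let (t , _ , x') = proj₁ (below-sat δ ρ T) x
                           (u , _ , y') = proj₁ (below-sat ε ρ T) y in
         proj₂ (d ρ) (t , x') , proj₂ (e ρ) (u , y'))

  -- One unbounded number bounds both the new variable and the old witness, so two existential
  -- quantifiers contract without any pairing.
  ∃' : ∀ {k} {P : Env (suc k) → Set} → S1 G P → S1 G (λ ρ → ∃ λ y → P (extend y ρ))
  ∃' {k} (δ , d) = ∃< (succ (var zero)) (subΔ θ (below δ)) , λ ρ →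
      (λ (y , p) → let (t , x) = proj₁ (d (extend y ρ)) p in
         t ⊔ y , y , s≤s (m≤n⊔m t y)
         , proj₁ (sat-sub θ _ _ (h ρ y (t ⊔ y)) (below δ)) (proj₂ (below-sat δ _ (t ⊔ y)) (t , m≤m⊔n t y , x)))
    , (λ (T , y , _ , x) → y ,
         let (t , _ , x') = proj₁ (below-sat δ _ T) (proj₂ (sat-sub θ _ (extend T (extend y ρ)) (h ρ y T) (below δ)) x)
         in proj₂ (d (extend y ρ)) (t , x'))
    where
    θ : Fin (suc (suc k)) → Term (suc (suc k))
    θ zero          = var (suc zero)
    θ (suc zero)    = var zero
    θ (suc (suc i)) = var (suc (suc i))
    h : ∀ ρ y T i → evalT (extend y (extend T ρ)) (θ i) ≡ extend T (extend y ρ) i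
    h ρ y T zero          = refl
    h ρ y T (suc zero)    = refl
    h ρ y T (suc (suc i)) = refl

  -- Bounded collection; it lets a bounded universal quantifier move inside the single unbounded
  -- existential one.
  collect : {P : ℕ → ℕ → Set} → ∀ n → (∀ y → y < n → ∃ λ t → P y t) →
    ∃ λ T → ∀ y → y < n → ∃ λ t → t ≤ T × P y t
  collect zero    f = 0 , λ _ ()
  collect (suc n) f = let (T , g) = collect n (λ y l → f y (m<n⇒m<1+n l)) ; (t , x) = f n ≤-refl in
    T ⊔ t , λ y l → Sum.[ (λ l' → let (t' , l'' , x') = g y l' in t' , ≤-trans l'' (m≤m⊔n T t) , x')
                             , (λ { refl → t , m≤n⊔m T t , x }) ] (m≤n⇒m<n∨m≡n (≤-pred l))

  ∀' : ∀ {k} {P : Env (suc k) → Set} → (b : Term k) → S1 G P →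
    S1 G (λ ρ → ∀ y → y < evalT ρ b → P (extend y ρ))
  ∀' {k} b (δ , d) = ∀< (wkT b) (subΔ θ (below δ)) , λ ρ →
      (λ f → let (T , g) = collect (evalT ρ b) (λ y l → proj₁ (d (extend y ρ)) (f y l)) in
         T , λ y l → proj₁ (sat-sub θ _ (extend T (extend y ρ)) (h ρ y T) (below δ))
               (proj₂ (below-sat δ _ T) (g y (subst (y <_) (eval-wk ρ T b) l))))
    , (λ (T , f) y l → let (t , _ , x') = proj₁ (below-sat δ _ T) (proj₂ (sat-sub θ _ (extend T (extend y ρ)) (h ρ y T) (below δ))
                                           (f y (subst (y <_) (sym (eval-wk ρ T b)) l)))
         in proj₂ (d (extend y ρ)) (t , x'))
    where
    θ : Fin (suc (suc k)) → Term (suc (suc k))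
    θ zero          = var (suc zero)
    θ (suc zero)    = var zero
    θ (suc (suc i)) = var (suc (suc i))
    h : ∀ ρ y T i → evalT (extend y (extend T ρ)) (θ i) ≡ extend T (extend y ρ) i
    h ρ y T zero          = refl
    h ρ y T (suc zero)    = refl
    h ρ y T (suc (suc i)) = refl

-- Variables, numerals and a pairing function

v0 : ∀ {k} → Term (1 + k)
v0 = var #0
v1 : ∀ {k} → Term (2 + k)
v1 = var #1
v2 : ∀ {k} → Term (3 + k)
v2 = var #2
v3 : ∀ {k} → Term (4 + k)
v3 = var #3
v4 : ∀ {k} → Term (5 + k)
v4 = var #4
v5 : ∀ {k} → Term (6 + k)
v5 = var (suc (suc (suc (suc (suc zero)))))
v6 : ∀ {k} → Term (7 + k)
v6 = var (suc (suc (suc (suc (suc (suc zero))))))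
v7 : ∀ {k} → Term (8 + k)
v7 = var (suc (suc (suc (suc (suc (suc (suc zero)))))))

num : ∀ {k} → ℕ → Term k
num zero    = zer
num (suc n) = succ (num n)

eval-num : ∀ {k} (ρ : Env k) n → evalT ρ (num n) ≡ n
eval-num ρ #0    = refl
eval-num ρ (suc n) = cong suc (eval-num ρ n)

-- A polynomial, hence expressible by a term. It is injective because a is smaller than the gap
-- between the squares of a + b and a + b + 1; it is not surjective, so some numbers code no pair.
pr : ℕ → ℕ → ℕ
pr a b = (a + b) * (a + b) + a

prT : ∀ {k} → Term k → Term k → Term k
prT s t = ((s ⊕ t) ⊗ (s ⊕ t)) ⊕ s

sq-mono-< : ∀ {m n} → m < n → m * m + m < n * n
sq-mono-< {m} {n} l = begin-strict
    m * m + m       ≡⟨ +-comm (m * m) m ⟩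
    suc m * m       <⟨ *-monoʳ-< (suc m) (n<1+n m) ⟩
    suc m * suc m   ≤⟨ *-mono-≤ l l ⟩
    n * n           ∎
  where open ≤-Reasoning

pr-sum-≤ : ∀ a b c d → pr a b ≡ pr c d → a + b ≤ c + d
pr-sum-≤ a b c d e = ≮⇒≥ λ l → <-irrefl (sym e) (begin-strict
    pr c d                        ≤⟨ +-monoʳ-≤ ((c + d) * (c + d)) (m≤m+n c d) ⟩
    (c + d) * (c + d) + (c + d)   <⟨ sq-mono-< l ⟩
    (a + b) * (a + b)             ≤⟨ m≤m+n _ a ⟩
    pr a b                        ∎)
  where open ≤-Reasoning

pr-inj : ∀ {a b c d} → pr a b ≡ pr c d → a ≡ c × b ≡ d
pr-inj {a} {b} {c} {d} e = a≡c , b≡d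
  where
  sum : a + b ≡ c + d
  sum = ≤-antisym (pr-sum-≤ a b c d e) (pr-sum-≤ c d a b (sym e))
  a≡c : a ≡ c
  a≡c = +-cancelˡ-≡ ((a + b) * (a + b)) a c
    (trans e (cong (λ s → s * s + c) (sym sum)))
  b≡d : b ≡ d
  b≡d = +-cancelˡ-≡ c b d (trans (cong (_+ b) (sym a≡c)) sum)

m≤m*m : ∀ m → m ≤ m * m
m≤m*m zero    = z≤n
m≤m*m (suc m) = m≤m+n (suc m) _

pr-≥₁ : ∀ a b → a ≤ pr a b
pr-≥₁ a b = m≤n+m a _

pr-≥₂ : ∀ a b → b ≤ pr a b
pr-≥₂ a b = ≤-trans (m≤n+m b a) (≤-trans (m≤m*m (a + b)) (m≤m+n _ a))

-- Binary strings coded with Gödel's β function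

module Strings (em : ExcludedMiddle 0ℓ) where

  β : ℕ → ℕ → ℕ
  β b i = suc (suc i * b)

  -- Gödel's condition: when 1, ..., ℓ all divide b, the numbers `β b i` with i < ℓ are pairwise
  -- coprime, so a set of them can be recovered from its product. Positivity excludes `β b i` = 1,
  -- which would divide everything.
  record Modulus (ℓ b : ℕ) : Set where
    constructor modulus
    field
      positive : 0 < b
      multiple : ∀ k → k < ℓ → suc k ∣ b
  open Modulus

  β-coprime-b : ∀ b i {d} → d ∣ β b i → Coprime d b
  β-coprime-b b i d∣ {e} (e∣d , e∣b) = ∣1⇒≡1
    (∣m+n∣m⇒∣n {e} {suc i * b} (subst (e ∣_) (+-comm 1 (suc i * b)) (∣-trans e∣d d∣)) (∣-trans e∣b (n∣m*n (suc i))))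

  β-step : ∀ b i k → β b (suc (i + k)) ≡ β b i + suc k * b
  β-step b i k = cong suc (trans (cong (_* b) (sym (+-suc (suc i) k))) (*-distribʳ-+ b (suc i) (suc k)))

  -- A common divisor d is coprime to b and divides the difference (k+1)b, hence k+1, which divides
  -- b.
  β-coprime-< : ∀ {ℓ b} → Modulus ℓ b → ∀ i k → suc (i + k) < ℓ → Coprime (β b i) (β b (suc (i + k)))
  β-coprime-< {ℓ} {b} M i k l {d} (d∣i , d∣j) = cop (∣-refl , ∣-trans d∣k (multiple M k (≤-<-trans (m≤n+m k (suc i)) l)))
    where
    cop : Coprime d b
    cop = β-coprime-b b i d∣i
    d∣k : d ∣ suc k
    d∣k = coprime-divisor cop (subst (d ∣_) (*-comm (suc k) b)
      (∣m+n∣m⇒∣n (subst (d ∣_) (β-step b i k) d∣j) d∣i))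

  β-coprime : ∀ {ℓ b} → Modulus ℓ b → ∀ i j → i < ℓ → j < ℓ → i ≢ j → Coprime (β b i) (β b j)
  β-coprime M i j li lj ne with <-cmp i j
  ... | tri< l _ _ = subst (λ z → Coprime (β _ i) (β _ z)) (m+[n∸m]≡n l)
                       (β-coprime-< M i (j ∸ suc i) (subst (_< _) (sym (m+[n∸m]≡n l)) lj))
  ... | tri≈ _ e _ = ⊥-elim (ne e)
  ... | tri> _ _ l = coprime-sym (subst (λ z → Coprime (β _ j) (β _ z)) (m+[n∸m]≡n l)
                       (β-coprime-< M j (i ∸ suc j) (subst (_< _) (sym (m+[n∸m]≡n l)) li)))

  coprime-* : ∀ {x y z} → Coprime x y → Coprime x z → Coprime x (y * z)
  coprime-* xy xz (d∣x , d∣yz) =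
    xz (d∣x , coprime-divisor (λ (e∣d , e∣y) → xy (∣-trans e∣d d∣x , e∣y)) d∣yz)

  coprime-∣* : ∀ {x y A} → Coprime x y → x ∣ A → y ∣ A → x * y ∣ A
  coprime-∣* {x} {y} c x∣A (divides k refl) =
    *-monoˡ-∣ y (coprime-divisor c (subst (x ∣_) (*-comm k y) x∣A))

  βprod : (ℕ → Bool) → ℕ → ℕ → ℕ
  βprod f b zero    = 1
  βprod f b (suc n) = if f n then β b n * βprod f b n else βprod f b n

  βprod-coprime : ∀ {ℓ b} → Modulus ℓ b → ∀ f n i → n ≤ ℓ → i < ℓ → (i < n → f i ≡ false) →
    Coprime (β b i) (βprod f b n)
  βprod-coprime M f zero i _ _ _ (_ , d∣1) = ∣1⇒≡1 d∣1
  βprod-coprime {b = b} M f (suc n) i n≤ i< h with f n in eq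
  ... | false = βprod-coprime M f n i (<⇒≤ n≤) i< (λ l → h (m<n⇒m<1+n l))
  ... | true  = coprime-* {β b i} {β b n} (β-coprime M i n i< n≤ ne)
                  (βprod-coprime M f n i (<⇒≤ n≤) i< (λ l → h (m<n⇒m<1+n l)))
    where
    ne : i ≢ n
    ne refl = contradiction (trans (sym eq) (h ≤-refl)) λ ()

  βprod-∣ : ∀ f b n i → i < n → f i ≡ true → β b i ∣ βprod f b n
  βprod-∣ f b (suc n) i l e with m≤n⇒m<n∨m≡n (≤-pred l)
  ... | inj₂ refl rewrite e = m∣m*n _
  ... | inj₁ l' with f n
  ...   | false = βprod-∣ f b n i l' e
  ...   | true  = ∣-trans (βprod-∣ f b n i l' e) (n∣m*n (β b n))

  -- Supplies the bound in `allS`: pairwise coprime divisors of A have a product dividing A,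
  -- whichever of them are selected.
  βprod-divides : ∀ {ℓ b} → Modulus ℓ b → ∀ f n A → n ≤ ℓ → (∀ i → i < n → β b i ∣ A) → βprod f b n ∣ A
  βprod-divides M f zero A _ _ = 1∣ A
  βprod-divides M f (suc n) A n≤ h with f n
  ... | false = βprod-divides M f n A (<⇒≤ n≤) (λ i l → h i (m<n⇒m<1+n l))
  ... | true  = coprime-∣* (βprod-coprime M f n n (<⇒≤ n≤) n≤ (λ l → ⊥-elim (<-irrefl refl l)))
                  (h n ≤-refl) (βprod-divides M f n A (<⇒≤ n≤) (λ i l → h i (m<n⇒m<1+n l)))

  βprod-correct : ∀ {ℓ b} → Modulus ℓ b → ∀ f i → i < ℓ → does (β b i ∣? βprod f b ℓ) ≡ f i
  βprod-correct {ℓ} {b} M f i l with f i in eq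
  ... | true  = dec-true (β b i ∣? βprod f b ℓ) (βprod-∣ f b ℓ i l eq)
  ... | false = dec-false (β b i ∣? βprod f b ℓ) λ d →
    contradiction (βprod-coprime M f ℓ i ≤-refl l (λ _ → eq) (∣-refl , d))
      (λ e → <-irrefl (sym (suc-injective e)) (≤-trans (positive M) (m≤m+n b (i * b))))

  modulus-exists : ∀ ℓ → Modulus ℓ (ℓ !)
  modulus-exists ℓ = modulus (1≤n! ℓ) λ k l → ∣-trans (m∣m*n (k !)) (m≤n⇒m!∣n! l)

  β-common-multiple : ∀ ℓ b → ∃ λ A → 0 < A × (∀ i → i < ℓ → β b i ∣ A)
  β-common-multiple ℓ b = βprod (λ _ → true) b ℓ , pos ℓ , λ i l → βprod-∣ (λ _ → true) b ℓ i l refl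
    where
    pos : ∀ n → 0 < βprod (λ _ → true) b n
    pos zero    = s≤s z≤n
    pos (suc n) = ≤-trans (pos n) (m≤m+n _ _)

  -- A string of length ℓ is coded by ⟨ℓ, a, b⟩; its i-th bit says whether β b i divides a.
  Coded : ℕ → Set
  Coded s = ∃ λ ℓ → ∃ λ a → ∃ λ b → s ≡ pr ℓ (pr a b)

  lenD : ∀ {s} → Dec (Coded s) → ℕ
  lenD (yes (ℓ , _)) = ℓ
  lenD (no _)        = 0

  bitD : ∀ {s} → Dec (Coded s) → ℕ → Maybe Bool
  bitD (yes (ℓ , a , b , _)) i = if does (i <? ℓ) then just (does (β b i ∣? a)) else nothing
  bitD (no _)                i = nothing

  abstract
    len : ℕ → ℕ
    len s = lenD {s} em

    bit : ℕ → ℕ → Maybe Bool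
    bit s = bitD {s} em

    len-code : ∀ ℓ a b → len (pr ℓ (pr a b)) ≡ ℓ
    len-code ℓ a b with em {Coded (pr ℓ (pr a b))}
    ... | yes (ℓ' , a' , b' , e) = sym (proj₁ (pr-inj {ℓ} {_} {ℓ'} e))
    ... | no n = ⊥-elim (n (ℓ , a , b , refl))

    len-junk : ∀ s → ¬ Coded s → len s ≡ 0
    len-junk s nc with em {Coded s}
    ... | yes c = ⊥-elim (nc c)
    ... | no _  = refl

    bit-code : ∀ ℓ a b i → i < ℓ → bit (pr ℓ (pr a b)) i ≡ just (does (β b i ∣? a))
    bit-code ℓ a b i l with em {Coded (pr ℓ (pr a b))}
    ... | no n = ⊥-elim (n (ℓ , a , b , refl))
    ... | yes (ℓ' , a' , b' , e) with refl , e' ← pr-inj {ℓ} {_} {ℓ'} e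
      with refl , refl ← pr-inj {a} {b} {a'} e' rewrite dec-true (i <? ℓ) l = refl

    bit-coded : ∀ s i b → bit s i ≡ just b → i < len s × Coded s
    bit-coded s i b e with em {Coded s}
    ... | no n = contradiction e λ ()
    ... | yes (ℓ' , a' , b' , eq) with i <? ℓ'
    ...   | yes l = l , ℓ' , a' , b' , eq
    ...   | no  l = ⊥-elim (f e)
      where
      f : (if does (i <? ℓ') then just (does (β b' i ∣? a')) else nothing) ≡ just b → ⊥
      f e' rewrite dec-false (i <? ℓ') l = contradiction e' λ ()

  BT BF : ℕ → ℕ → Set
  BT s i = bit s i ≡ just true
  BF s i = bit s i ≡ just false

  BT-< : ∀ {s i} → BT s i → i < len s
  BT-< {s} {i} e = proj₁ (bit-coded s i true e)

  BF-< : ∀ {s i} → BF s i → i < len s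
  BF-< {s} {i} e = proj₁ (bit-coded s i false e)

  BT-BF : ∀ {s i} {A : Set} → BT s i → BF s i → A
  BT-BF t f = contradiction (trans (sym t) f) λ ()

  coded : ∀ s → 0 < len s → Coded s
  coded s l with em {Coded s}
  ... | yes c = c
  ... | no nc = ⊥-elim (<-irrefl (sym (len-junk s nc)) l)

  BT⊎BF : ∀ s i → i < len s → BT s i ⊎ BF s i
  BT⊎BF s i l with coded s (≤-<-trans z≤n l)
  ... | ℓ , a , b , refl with does (β b i ∣? a) in eq
  ...   | true  = inj₁ (trans (bit-code ℓ a b i (subst (i <_) (len-code ℓ a b) l)) (cong just eq))
  ...   | false = inj₂ (trans (bit-code ℓ a b i (subst (i <_) (len-code ℓ a b) l)) (cong just eq))

  len-≤ : ∀ s → len s ≤ s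
  len-≤ s with em {Coded s}
  ... | yes (ℓ , a , b , refl) = subst (_≤ s) (sym (len-code ℓ a b)) (pr-≥₁ ℓ (pr a b))
  ... | no nc = subst (_≤ s) (sym (len-junk s nc)) z≤n

  infix 4 _⊏_ _⊑_ _≋_ _⊂_

  _⊏_ : ℕ → SubsetOfω → Set
  s ⊏ f = (∀ i → BT s i → f i ≡ true) × (∀ i → BF s i → f i ≡ false)

  _⊑_ : ℕ → ℕ → Set
  s ⊑ t = (∀ i → BT s i → BT t i) × (∀ i → BF s i → BF t i)

  -- Here s stands for the finite set of its ones and its zeros are ignored, whereas `_⊏_` reads s
  -- as an initial segment.
  _⊂_ : ℕ → SubsetOfω → Set
  s ⊂ f = ∀ i → BT s i → f i ≡ true

  -- A string has many codes, one or more for each admissible b, so this replaces equality of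
  -- numbers.
  _≋_ : ℕ → ℕ → Set
  s ≋ t = s ⊑ t × t ⊑ s

  ⊏-code : ∀ {ℓ b} → Modulus ℓ b → ∀ f → pr ℓ (pr (βprod f b ℓ) b) ⊏ f
  ⊏-code {ℓ} {b} M f =
      (λ i e → trans (sym (βprod-correct M f i (l e))) (eq e))
    , (λ i e → trans (sym (βprod-correct M f i (l e))) (eq e))
    where
    s = pr ℓ (pr (βprod f b ℓ) b)
    l : ∀ {i v} → bit s i ≡ just v → i < ℓ
    l {i} {v} e = subst (i <_) (len-code ℓ (βprod f b ℓ) b) (proj₁ (bit-coded s i v e))
    eq : ∀ {i v} → bit s i ≡ just v → does (β b i ∣? βprod f b ℓ) ≡ v
    eq {i} e = just-injective (trans (sym (bit-code ℓ (βprod f b ℓ) b i (l e))) e)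

  abstract
    pref : SubsetOfω → ℕ → ℕ
    pref f ℓ = pr ℓ (pr (βprod f (ℓ !) ℓ) (ℓ !))

    pref-len : ∀ f ℓ → len (pref f ℓ) ≡ ℓ
    pref-len f ℓ = len-code ℓ (βprod f (ℓ !) ℓ) (ℓ !)

    pref-⊏ : ∀ f ℓ → pref f ℓ ⊏ f
    pref-⊏ f ℓ = ⊏-code (modulus-exists ℓ) f

  ⊏-BT : ∀ {s f i} → s ⊏ f → i < len s → f i ≡ true → BT s i
  ⊏-BT {s} {f} {i} (_ , h) l e with BT⊎BF s i l
  ... | inj₁ t = t
  ... | inj₂ x = contradiction (trans (sym e) (h i x)) λ ()

  ⊏-BF : ∀ {s f i} → s ⊏ f → i < len s → f i ≡ false → BF s i
  ⊏-BF {s} {f} {i} (h , _) l e with BT⊎BF s i l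
  ... | inj₂ t = t
  ... | inj₁ x = contradiction (trans (sym (h i x)) e) λ ()

  pref-BT : ∀ f ℓ i → i < ℓ → f i ≡ true → BT (pref f ℓ) i
  pref-BT f ℓ i l e = ⊏-BT (pref-⊏ f ℓ) (subst (i <_) (sym (pref-len f ℓ)) l) e

  pref-BF : ∀ f ℓ i → i < ℓ → f i ≡ false → BF (pref f ℓ) i
  pref-BF f ℓ i l e = ⊏-BF (pref-⊏ f ℓ) (subst (i <_) (sym (pref-len f ℓ)) l) e

  ⊏-⊑ : ∀ {s t f} → s ⊏ f → t ⊏ f → len s ≤ len t → s ⊑ t
  ⊏-⊑ s t l = (λ i e → ⊏-BT t (<-≤-trans (BT-< e) l) (proj₁ s i e))
             , (λ i e → ⊏-BF t (<-≤-trans (BF-< e) l) (proj₂ s i e))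

  ⊑-⊏ : ∀ {s t f} → s ⊑ t → t ⊏ f → s ⊏ f
  ⊑-⊏ (a , b) (c , d) = (λ i e → c i (a i e)) , (λ i e → d i (b i e))

  ⊑-refl : ∀ {s} → s ⊑ s
  ⊑-refl = (λ _ e → e) , (λ _ e → e)

  ⊑-trans : ∀ {s t u} → s ⊑ t → t ⊑ u → s ⊑ u
  ⊑-trans (a , b) (c , d) = (λ i e → c i (a i e)) , (λ i e → d i (b i e))

  bitFun : ℕ → SubsetOfω
  bitFun s i with bit s i
  ... | just true = true
  ... | _         = false

  ⊏-bitFun : ∀ s → s ⊏ bitFun s
  ⊏-bitFun s = T , F
    where
    T : ∀ i → BT s i → bitFun s i ≡ true
    T i e rewrite e = refl
    F : ∀ i → BF s i → bitFun s i ≡ false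
    F i e rewrite e = refl

  module _ {G : SubsetOfω} where

    ∣' : ∀ {k} (s t : Term k) → S1 G (λ ρ → evalT ρ s ∣ evalT ρ t)
    ∣' {k} s t = S1-iff (λ ρ → (λ (q , e) → divides q (f ρ q e)) , (λ (divides q e) → q , g ρ q e))
        (∃' (at (wkT t ≐ (v0 ⊗ wkT s))))
      where
      f : ∀ ρ q → evalT (extend q ρ) (wkT t) ≡ q * evalT (extend q ρ) (wkT s) → evalT ρ t ≡ q * evalT ρ s
      f ρ q e rewrite eval-wk ρ q s | eval-wk ρ q t = e
      g : ∀ ρ q → evalT ρ t ≡ q * evalT ρ s → evalT (extend q ρ) (wkT t) ≡ q * evalT (extend q ρ) (wkT s)
      g ρ q e rewrite eval-wk ρ q s | eval-wk ρ q t = e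

    ∤' : S1 G {2} (λ ρ → ¬ (ρ #0 ∣ ρ #1))
    ∤' = S1-iff (λ ρ → (λ h d → f ρ h d) , (λ n q _ e → n (divides q e)))
        (∀' (succ v1) (at (neg (v2 ≐ (v0 ⊗ v1)))))
      where
      f : ∀ (ρ : Env 2) → (∀ q → q < suc (ρ #1) → ρ #1 ≢ q * ρ #0) → ¬ (ρ #0 ∣ ρ #1)
      f ρ h (divides q e) with ρ #0
      ... | zero  = h 0 (s≤s z≤n) (trans e (*-zeroʳ q))
      ... | suc z = h q (s≤s (≤-trans (m≤m*n q (suc z)) (≤-reflexive (sym e)))) e

    βT : ∀ {k} → Term k → Term k → Term k
    βT b i = succ (succ i ⊗ b)

    BT' : ∀ {k} (s i : Term k) → S1 G (λ ρ → BT (evalT ρ s) (evalT ρ i))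
    BT' s i = ren core (s ∷ i ∷ [])
      where
      core : S1 G {2} (λ ρ → BT (ρ #0) (ρ #1))
      core = S1-iff (λ ρ →
          (λ { (ℓ , a , b , e , l , d) → subst (λ s → BT s (ρ #1)) (sym e)
                 (trans (bit-code ℓ a b (ρ #1) l) (cong just (dec-true (β b (ρ #1) ∣? a) d))) })
        , (λ t → g ρ t (proj₂ (bit-coded _ _ _ t))))
        (∃' (∃' (∃' (at (v3 ≐ prT v2 (prT v1 v0)) & at (v4 ≺ v2) & ∣' (βT v0 v4) v1))))
        where
        g : ∀ (ρ : Env 2) → BT (ρ #0) (ρ #1) → Coded (ρ #0) → ∃ λ ℓ → ∃ λ a → ∃ λ b →
          ρ #0 ≡ pr ℓ (pr a b) × ρ #1 < ℓ × β b (ρ #1) ∣ a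
        g ρ t (ℓ , a , b , e) = ℓ , a , b , e , l , d
          where
          l : ρ #1 < ℓ
          l = subst (_ <_) (trans (cong len e) (len-code ℓ a b)) (BT-< t)
          d : β b (ρ #1) ∣ a
          d with β b (ρ #1) ∣? a in eq
          ... | yes p = p
          ... | no _  = contradiction (trans (sym (trans (bit-code ℓ a b (ρ #1) l)
                          (cong (λ z → just (does z)) eq))) (subst (λ s → BT s (ρ #1)) e t)) λ ()

    BF' : ∀ {k} (s i : Term k) → S1 G (λ ρ → BF (evalT ρ s) (evalT ρ i))
    BF' s i = ren core (s ∷ i ∷ [])
      where
      core : S1 G {2} (λ ρ → BF (ρ #0) (ρ #1))
      core = S1-iff (λ ρ →
          (λ { (ℓ , a , b , e , l , d) → subst (λ s → BF s (ρ #1)) (sym e)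
                 (trans (bit-code ℓ a b (ρ #1) l) (cong just (dec-false (β b (ρ #1) ∣? a) d))) })
        , (λ t → g ρ t (proj₂ (bit-coded _ _ _ t))))
        (∃' (∃' (∃' (at (v3 ≐ prT v2 (prT v1 v0)) & at (v4 ≺ v2) & ren ∤' (βT v0 v4 ∷ v1 ∷ [])))))
        where
        g : ∀ (ρ : Env 2) → BF (ρ #0) (ρ #1) → Coded (ρ #0) → ∃ λ ℓ → ∃ λ a → ∃ λ b →
          ρ #0 ≡ pr ℓ (pr a b) × ρ #1 < ℓ × ¬ (β b (ρ #1) ∣ a)
        g ρ t (ℓ , a , b , e) = ℓ , a , b , e , l , d
          where
          l : ρ #1 < ℓ
          l = subst (_ <_) (trans (cong len e) (len-code ℓ a b)) (BF-< t)
          d : ¬ (β b (ρ #1) ∣ a)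
          d p = contradiction (trans (sym (trans (bit-code ℓ a b (ρ #1) l)
                          (cong just (dec-true (β b (ρ #1) ∣? a) p)))) (subst (λ s → BF s (ρ #1)) e t)) λ ()

    len' : ∀ {k} (s ℓ : Term k) → S1 G (λ ρ → len (evalT ρ s) ≡ evalT ρ ℓ)
    len' s ℓ = ren core (s ∷ ℓ ∷ [])
      where
      core : S1 G {2} (λ ρ → len (ρ #0) ≡ ρ #1)
      core = S1-iff (λ ρ →
          (λ { (inj₁ (a , b , e)) → trans (cong len e) (len-code _ a b)
             ; (inj₂ (z , h)) → trans (len-junk _ λ (ℓ , a , b , e) →
                  h ℓ (s≤s (subst (ℓ ≤_) (sym e) (pr-≥₁ ℓ _)))
                    a (s≤s (subst (a ≤_) (sym e) (≤-trans (pr-≥₁ a b) (pr-≥₂ ℓ _))))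
                    b (s≤s (subst (b ≤_) (sym e) (≤-trans (pr-≥₂ a b) (pr-≥₂ ℓ _)))) e) (sym z) })
        , g ρ)
        (∃' (∃' (at (v2 ≐ prT v3 (prT v1 v0))))
         ∣∣ at (v1 ≐ zer) & ∀' (succ v0) (∀' (succ v1) (∀' (succ v2) (at (neg (v3 ≐ prT v2 (prT v1 v0)))))))
        where
        g : ∀ (ρ : Env 2) → len (ρ #0) ≡ ρ #1 →
          (∃ λ a → ∃ λ b → ρ #0 ≡ pr (ρ #1) (pr a b)) ⊎
          (ρ #1 ≡ 0 × (∀ ℓ → ℓ < suc (ρ #0) → ∀ a → a < suc (ρ #0) → ∀ b → b < suc (ρ #0) →
             ρ #0 ≢ pr ℓ (pr a b)))
        g ρ h with em {Coded (ρ #0)}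
        ... | yes (ℓ , a , b , e) = inj₁ (a , b , trans e (cong (λ z → pr z (pr a b))
                (trans (sym (len-code ℓ a b)) (trans (cong len (sym e)) h))))
        ... | no nc = inj₂ (trans (sym h) (len-junk _ nc) , λ ℓ _ a _ b _ e → nc (ℓ , a , b , e))

    inner : ∀ {k} → Fin (suc k) → Term (suc (suc k))
    inner zero    = v0
    inner (suc i) = var (suc (suc i))

    -- An implication with a Σ⁰₁ premise Q is not Σ⁰₁ as it stands. Below `len s` the premise can be
    -- replaced by its complement R, which is Σ⁰₁ too, and the quantifier becomes bounded.
    allBits : ∀ {k} {P : Env (suc k) → Set} {Q R : ℕ → ℕ → Set}
      (R' : ∀ {k} (s i : Term k) → S1 G (λ ρ → R (evalT ρ s) (evalT ρ i))) →
      (∀ {s i} → Q s i → i < len s) → (∀ s i → i < len s → R s i ⊎ Q s i) → (∀ {s i} → Q s i → R s i → ⊥) →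
      (s : Term k) → S1 G P → S1 G (λ ρ → ∀ i → Q (evalT ρ s) i → P (extend i ρ))
    allBits {k} {P} {Q} {R} R' Q< split disj s p = S1-iff (λ ρ → f ρ , g ρ)
      (∃' (len' (wkT s) v0 & ∀' v0 (R' (wkT (wkT s)) v0 ∣∣ renf p inner)))
      where
      eq : ∀ ρ i ℓ → evalT (extend i (extend ℓ ρ)) (wkT (wkT s)) ≡ evalT ρ s
      eq ρ i ℓ = trans (eval-wk (extend ℓ ρ) i (wkT s)) (eval-wk ρ ℓ s)
      same : ∀ ρ i ℓ j → evalT (extend i (extend ℓ ρ)) (inner j) ≡ extend i ρ j
      same ρ i ℓ zero    = refl
      same ρ i ℓ (suc j) = refl
      f : ∀ ρ → _ → ∀ i → Q (evalT ρ s) i → P (extend i ρ)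
      f ρ (ℓ , e , h) i q with h i (subst (i <_) (trans (cong len (sym (eval-wk ρ ℓ s))) e) (Q< q))
      ... | inj₁ r = ⊥-elim (disj q (subst (λ z → R z i) (eq ρ i ℓ) r))
      ... | inj₂ x = S1-ext p (same ρ i ℓ) x
      g : ∀ ρ → (∀ i → Q (evalT ρ s) i → P (extend i ρ)) → _
      g ρ h = ℓ , cong len (eval-wk ρ ℓ s) , λ i l →
        Sum.map (subst (λ z → R z i) (sym (eq ρ i ℓ)))
                (λ q → S1-ext p (λ j → sym (same ρ i ℓ j)) (h i q)) (split _ i l)
        where ℓ = len (evalT ρ s)

    allT : ∀ {k} {P : Env (suc k) → Set} (s : Term k) → S1 G P →
      S1 G (λ ρ → ∀ i → BT (evalT ρ s) i → P (extend i ρ))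
    allT = allBits {Q = BT} {BF} BF' BT-< (λ s i l → Sum.swap (BT⊎BF s i l)) (λ t f → BT-BF t f)

    allF : ∀ {k} {P : Env (suc k) → Set} (s : Term k) → S1 G P →
      S1 G (λ ρ → ∀ i → BF (evalT ρ s) i → P (extend i ρ))
    allF = allBits {Q = BF} {BT} BT' BF-< BT⊎BF (λ f t → BT-BF t f)

    -- Every string of length ℓ has a code ⟨ℓ, a, b⟩ with a ≤ A, whenever b and A satisfy the
    -- conditions stated here; so the quantifier over these strings is a bounded one.
    allS : ∀ {k} {P : Env (suc k) → Set} (ℓ : Term k) →
      (∀ {ρ s t} → s ≋ t → P (extend s ρ) → P (extend t ρ)) → S1 G P →
      S1 G (λ ρ → ∀ s → len s ≡ evalT ρ ℓ → P (extend s ρ))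
    allS {k} {P} ℓ ext p = S1-iff (λ ρ → f ρ , g ρ)
      (∃' (∃' (at (zer ≺ v1) & ∀' (wkT (wkT ℓ)) (∣' (succ v0) v2) &
         at (zer ≺ v0) & ∀' (wkT (wkT ℓ)) (∣' (βT v2 v0) v1) &
         ∀' (succ v0) (renf p code))))
      where
      ℓ'' : ∀ {k} → Term k → Term (suc (suc (suc k)))
      ℓ'' t = wkT (wkT (wkT t))
      code : Fin (suc k) → Term (suc (suc (suc k)))
      code zero    = prT (ℓ'' ℓ) (prT v0 v2)
      code (suc i) = var (suc (suc (suc i)))
      eq2 : ∀ ρ b A → evalT (extend A (extend b ρ)) (wkT (wkT ℓ)) ≡ evalT ρ ℓ
      eq2 ρ b A = trans (eval-wk (extend b ρ) A (wkT ℓ)) (eval-wk ρ b ℓ)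
      eq3 : ∀ ρ b A a → evalT (extend a (extend A (extend b ρ))) (ℓ'' ℓ) ≡ evalT ρ ℓ
      eq3 ρ b A a = trans (eval-wk (extend A (extend b ρ)) a (wkT (wkT ℓ))) (eq2 ρ b A)
      same : ∀ ρ b A a j → evalT (extend a (extend A (extend b ρ))) (code j)
        ≡ extend (pr (evalT ρ ℓ) (pr a b)) ρ j
      same ρ b A a zero    = cong (λ z → pr z (pr a b)) (eq3 ρ b A a)
      same ρ b A a (suc j) = refl
      f : ∀ ρ → _ → ∀ s → len s ≡ evalT ρ ℓ → P (extend s ρ)
      f ρ (b , A , b>0 , mul , A>0 , com , h) s e =
        ext (c⊑s , s⊑c) (S1-ext p (same ρ b A a) (h a (s≤s a≤A)))
        where
        L = evalT ρ ℓ
        M : Modulus L b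
        M = modulus b>0 λ k l → mul k (subst (k <_) (sym (eq2 ρ b A)) l)
        -- The code of s for the given b; s itself may use another modulus, which is why P has to be
        -- invariant under `_≋_`.
        a = βprod (bitFun s) b L
        a≤A : a ≤ A
        a≤A = ∣⇒≤ ⦃ >-nonZero A>0 ⦄ (βprod-divides M (bitFun s) L A ≤-refl
          λ i l → com i (subst (i <_) (sym (eq2 ρ b A)) l))
        c⊏ : pr L (pr a b) ⊏ bitFun s
        c⊏ = ⊏-code M (bitFun s)
        c⊑s : pr L (pr a b) ⊑ s
        c⊑s = ⊏-⊑ c⊏ (⊏-bitFun s) (≤-reflexive (trans (len-code L a b) (sym e)))
        s⊑c : s ⊑ pr L (pr a b)
        s⊑c = ⊏-⊑ (⊏-bitFun s) c⊏ (≤-reflexive (trans e (sym (len-code L a b))))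
      g : ∀ ρ → (∀ s → len s ≡ evalT ρ ℓ → P (extend s ρ)) → _
      g ρ h = b , A , positive M , (λ k l → multiple M k (subst (k <_) (eq2 ρ b A) l)) , A>0 ,
          (λ i l → com i (subst (i <_) (eq2 ρ b A) l)) ,
          λ a _ → S1-ext p (λ j → sym (same ρ b A a j)) (h _ (len-code L a b))
        where
        L = evalT ρ ℓ
        b = L !
        M = modulus-exists L
        A = proj₁ (β-common-multiple L b)
        A>0 = proj₁ (proj₂ (β-common-multiple L b))
        com = proj₂ (proj₂ (β-common-multiple L b))

    ⊑' : ∀ {k} (s t : Term k) → S1 G (λ ρ → evalT ρ s ⊑ evalT ρ t)
    ⊑' s t = ren (allT v0 (BT' v2 v0) & allF v0 (BF' v2 v0)) (s ∷ t ∷ [])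

    ⊏' : ∀ {k} (s : Term k) → S1 G (λ ρ → evalT ρ s ⊏ G)
    ⊏' s = ren (allT v0 (at (inX v0)) & allF v0 (S1-iff (λ ρ → ≢true) (at (neg (inX v0))))) (s ∷ [])

-- The use principle

module Queries (em : ExcludedMiddle 0ℓ) where
  open Strings em

  -- Evaluation of a Δ₀ formula (Tr s true) or its negation (Tr s false) in which every query is answered by s.
  Tr : ∀ {k} → ℕ → Bool → Env k → Δ₀ k → Set
  Tr s true  ρ (t ≐ u)  = evalT ρ t ≡ evalT ρ u
  Tr s false ρ (t ≐ u)  = evalT ρ t ≢ evalT ρ u
  Tr s true  ρ (t ≺ u)  = evalT ρ t < evalT ρ u
  Tr s false ρ (t ≺ u)  = ¬ (evalT ρ t < evalT ρ u)
  Tr s b     ρ (inX t)  = bit s (evalT ρ t) ≡ just b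
  Tr s b     ρ (neg φ)  = Tr s (not b) ρ φ
  Tr s true  ρ (φ ∧' ψ) = Tr s true ρ φ × Tr s true ρ ψ
  Tr s false ρ (φ ∧' ψ) = Tr s false ρ φ ⊎ Tr s false ρ ψ
  Tr s true  ρ (φ ∨' ψ) = Tr s true ρ φ ⊎ Tr s true ρ ψ
  Tr s false ρ (φ ∨' ψ) = Tr s false ρ φ × Tr s false ρ ψ
  Tr s true  ρ (∀< t φ) = ∀ y → y < evalT ρ t → Tr s true (extend y ρ) φ
  Tr s false ρ (∀< t φ) = ∃ λ y → y < evalT ρ t × Tr s false (extend y ρ) φ
  Tr s true  ρ (∃< t φ) = ∃ λ y → y < evalT ρ t × Tr s true (extend y ρ) φ
  Tr s false ρ (∃< t φ) = ∀ y → y < evalT ρ t → Tr s false (extend y ρ) φ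

  ⊑-bit : ∀ {s t i} → s ⊑ t → ∀ b → bit s i ≡ just b → bit t i ≡ just b
  ⊑-bit (T , F) true  = T _
  ⊑-bit (T , F) false = F _

  Tr-mono : ∀ {k s t} → s ⊑ t → ∀ b (ρ : Env k) φ → Tr s b ρ φ → Tr t b ρ φ
  Tr-mono h true  ρ (t ≐ u)  x = x
  Tr-mono h false ρ (t ≐ u)  x = x
  Tr-mono h true  ρ (t ≺ u)  x = x
  Tr-mono h false ρ (t ≺ u)  x = x
  Tr-mono h true  ρ (inX t)  x = ⊑-bit h true x
  Tr-mono h false ρ (inX t)  x = ⊑-bit h false x
  Tr-mono h true  ρ (neg φ)  x = Tr-mono h false ρ φ x
  Tr-mono h false ρ (neg φ)  x = Tr-mono h true ρ φ x
  Tr-mono h true  ρ (φ ∧' ψ) (x , y) = Tr-mono h true ρ φ x , Tr-mono h true ρ ψ y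
  Tr-mono h false ρ (φ ∧' ψ) x = Sum.map (Tr-mono h false ρ φ) (Tr-mono h false ρ ψ) x
  Tr-mono h true  ρ (φ ∨' ψ) x = Sum.map (Tr-mono h true ρ φ) (Tr-mono h true ρ ψ) x
  Tr-mono h false ρ (φ ∨' ψ) (x , y) = Tr-mono h false ρ φ x , Tr-mono h false ρ ψ y
  Tr-mono h true  ρ (∀< t φ) f = λ y l → Tr-mono h true (extend y ρ) φ (f y l)
  Tr-mono h false ρ (∀< t φ) (y , l , x) = y , l , Tr-mono h false (extend y ρ) φ x
  Tr-mono h true  ρ (∃< t φ) (y , l , x) = y , l , Tr-mono h true (extend y ρ) φ x
  Tr-mono h false ρ (∃< t φ) f = λ y l → Tr-mono h false (extend y ρ) φ (f y l)

  Holds : SubsetOfω → ∀ {k} → Bool → Env k → Δ₀ k → Set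
  Holds G true  ρ φ = satΔ G ρ φ
  Holds G false ρ φ = ¬ satΔ G ρ φ

  Tr-sound : ∀ {k s G} → s ⊏ G → ∀ b (ρ : Env k) φ → Tr s b ρ φ → Holds G b ρ φ
  Tr-sound h true  ρ (t ≐ u)  x = x
  Tr-sound h false ρ (t ≐ u)  x = x
  Tr-sound h true  ρ (t ≺ u)  x = x
  Tr-sound h false ρ (t ≺ u)  x = x
  Tr-sound h true  ρ (inX t)  x = proj₁ h _ x
  Tr-sound h false ρ (inX t)  x e = contradiction (trans (sym e) (proj₂ h _ x)) λ ()
  Tr-sound h true  ρ (neg φ)  x = Tr-sound h false ρ φ x
  Tr-sound h false ρ (neg φ)  x n = n (Tr-sound h true ρ φ x)
  Tr-sound h true  ρ (φ ∧' ψ) (x , y) = Tr-sound h true ρ φ x , Tr-sound h true ρ ψ y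
  Tr-sound h false ρ (φ ∧' ψ) (inj₁ x) (a , b) = Tr-sound h false ρ φ x a
  Tr-sound h false ρ (φ ∧' ψ) (inj₂ x) (a , b) = Tr-sound h false ρ ψ x b
  Tr-sound h true  ρ (φ ∨' ψ) x = Sum.map (Tr-sound h true ρ φ) (Tr-sound h true ρ ψ) x
  Tr-sound h false ρ (φ ∨' ψ) (x , y) = Sum.[ Tr-sound h false ρ φ x , Tr-sound h false ρ ψ y ]
  Tr-sound h true  ρ (∀< t φ) f = λ y l → Tr-sound h true (extend y ρ) φ (f y l)
  Tr-sound h false ρ (∀< t φ) (y , l , x) f = Tr-sound h false (extend y ρ) φ x (f y l)
  Tr-sound h true  ρ (∃< t φ) (y , l , x) = y , l , Tr-sound h true (extend y ρ) φ x
  Tr-sound h false ρ (∃< t φ) f (y , l , x) = Tr-sound h false (extend y ρ) φ (f y l) x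

  dne : {A : Set} → ¬ ¬ A → A
  dne {A} nn with em {A}
  ... | yes a = a
  ... | no n  = ⊥-elim (nn n)

  Eventually : (ℕ → Set) → SubsetOfω → Set
  Eventually Q G = ∃ λ ℓ → Q (pref G ℓ)

  pref-mono : ∀ G {ℓ ℓ'} → ℓ ≤ ℓ' → pref G ℓ ⊑ pref G ℓ'
  pref-mono G {ℓ} {ℓ'} l = ⊏-⊑ (pref-⊏ G ℓ) (pref-⊏ G ℓ')
    (subst₂ _≤_ (sym (pref-len G ℓ)) (sym (pref-len G ℓ')) l)

  module Complete (G : SubsetOfω) where

    E : ∀ {k} → Bool → Env k → Δ₀ k → Set
    E b ρ φ = Eventually (λ s → Tr s b ρ φ) G

    raise : ∀ {k ℓ ℓ'} b (ρ : Env k) φ → ℓ ≤ ℓ' → Tr (pref G ℓ) b ρ φ → Tr (pref G ℓ') b ρ φ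
    raise b ρ φ l = Tr-mono (pref-mono G l) b ρ φ

    both : ∀ {k} b (ρ : Env k) φ ψ → E b ρ φ → E b ρ ψ →
      ∃ λ ℓ → Tr (pref G ℓ) b ρ φ × Tr (pref G ℓ) b ρ ψ
    both b ρ φ ψ (ℓ , x) (ℓ' , y) = ℓ ⊔ ℓ' ,
      raise b ρ φ (m≤m⊔n ℓ ℓ') x , raise b ρ ψ (m≤n⊔m ℓ ℓ') y

    every : ∀ {k} b (ρ : Env k) φ n → (∀ y → y < n → E b (extend y ρ) φ) →
      ∃ λ ℓ → ∀ y → y < n → Tr (pref G ℓ) b (extend y ρ) φ
    every b ρ φ n f = let (T , g) = collect {G} {P = λ y ℓ → Tr (pref G ℓ) b (extend y ρ) φ} n f in
      T , λ y l → let (t , t≤ , x) = g y l in raise b (extend y ρ) φ t≤ x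

    complete : ∀ {k} b (ρ : Env k) φ → Holds G b ρ φ → E b ρ φ
    complete true  ρ (t ≐ u)  x = 0 , x
    complete false ρ (t ≐ u)  x = 0 , x
    complete true  ρ (t ≺ u)  x = 0 , x
    complete false ρ (t ≺ u)  x = 0 , x
    complete true  ρ (inX t)  x = suc (evalT ρ t) , pref-BT G _ _ ≤-refl x
    complete false ρ (inX t)  x = suc (evalT ρ t) , pref-BF G _ _ ≤-refl (proj₁ ≢true x)
    complete true  ρ (neg φ)  x = complete false ρ φ x
    complete false ρ (neg φ)  x = complete true ρ φ (dne x)
    complete true  ρ (φ ∧' ψ) (x , y) = both true ρ φ ψ (complete true ρ φ x) (complete true ρ ψ y)
    complete false ρ (φ ∧' ψ) x with em {satΔ G ρ φ}
    ... | yes p = map₂ inj₂ (complete false ρ ψ (λ q → x (p , q)))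
    ... | no n  = map₂ inj₁ (complete false ρ φ n)
    complete true  ρ (φ ∨' ψ) (inj₁ x) = map₂ inj₁ (complete true ρ φ x)
    complete true  ρ (φ ∨' ψ) (inj₂ x) = map₂ inj₂ (complete true ρ ψ x)
    complete false ρ (φ ∨' ψ) x = both false ρ φ ψ (complete false ρ φ (λ p → x (inj₁ p)))
                                                  (complete false ρ ψ (λ p → x (inj₂ p)))
    complete true  ρ (∀< t φ) f = every true ρ φ _ (λ y l → complete true (extend y ρ) φ (f y l))
    complete false ρ (∀< t φ) n with em {∃ λ y → y < evalT ρ t × ¬ satΔ G (extend y ρ) φ}
    ... | yes (y , l , m) = let (ℓ , x) = complete false (extend y ρ) φ m in ℓ , y , l , x
    ... | no  ne = ⊥-elim (n λ y l → dne λ m → ne (y , l , m))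
    complete true  ρ (∃< t φ) (y , l , x) = let (ℓ , x') = complete true (extend y ρ) φ x in ℓ , y , l , x'
    complete false ρ (∃< t φ) n = every false ρ φ _ (λ y l → complete false (extend y ρ) φ (λ x → n (y , l , x)))

  flipT : ∀ {k} → Fin (suc (suc k)) → Term (suc (suc k))
  flipT zero          = v1
  flipT (suc zero)    = v0
  flipT (suc (suc i)) = var (suc (suc i))

  flip-eq : ∀ {k} (ρ : Env (suc k)) y i →
    evalT (extend y ρ) (flipT i) ≡ extend (ρ #0) (extend y (λ j → ρ (suc j))) i
  flip-eq ρ y zero          = refl
  flip-eq ρ y (suc zero)    = refl
  flip-eq ρ y (suc (suc i)) = refl

  module _ {G : SubsetOfω} where

    private
      tail-eq : ∀ {k} (ρ : Env (suc k)) t → evalT ρ (wkT t) ≡ evalT (λ j → ρ (suc j)) t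
      tail-eq ρ t = eval-sub {θ = λ i → var (suc i)} {ρ} (λ _ → refl) t

    Tr' : ∀ {k} b (φ : Δ₀ k) → S1 G (λ ρ → Tr (ρ #0) b (λ i → ρ (suc i)) φ)

    private
      ball' : ∀ {k} b (t : Term k) φ → S1 G (λ ρ →
        ∀ y → y < evalT (λ i → ρ (suc i)) t → Tr (ρ #0) b (extend y (λ i → ρ (suc i))) φ)
      ball' b t φ = S1-iff (λ ρ →
          (λ f y l → S1-ext (Tr' b φ) (flip-eq ρ y) (f y (subst (y <_) (sym (tail-eq ρ t)) l)))
        , (λ f y l → S1-ext (Tr' b φ) (λ i → sym (flip-eq ρ y i)) (f y (subst (y <_) (tail-eq ρ t) l))))
        (∀' (wkT t) (renf (Tr' b φ) flipT))

      bex' : ∀ {k} b (t : Term k) φ → S1 G (λ ρ →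
        ∃ λ y → y < evalT (λ i → ρ (suc i)) t × Tr (ρ #0) b (extend y (λ i → ρ (suc i))) φ)
      bex' b t φ = S1-iff (λ ρ →
          (λ (y , l , x) → y , subst (y <_) (trans (eval-wk ρ y (wkT t)) (tail-eq ρ t)) l
                         , S1-ext (Tr' b φ) (flip-eq ρ y) x)
        , (λ (y , l , x) → y , subst (y <_) (sym (trans (eval-wk ρ y (wkT t)) (tail-eq ρ t))) l
                         , S1-ext (Tr' b φ) (λ i → sym (flip-eq ρ y i)) x))
        (∃' (at (v0 ≺ wkT (wkT t)) & renf (Tr' b φ) flipT))

    Tr' true  (t ≐ u)  = S1-iff (λ ρ → subst₂ _≡_ (tail-eq ρ t) (tail-eq ρ u) , subst₂ _≡_ (sym (tail-eq ρ t)) (sym (tail-eq ρ u)))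
      (at (wkT t ≐ wkT u))
    Tr' false (t ≐ u)  = S1-iff (λ ρ → subst₂ _≢_ (tail-eq ρ t) (tail-eq ρ u) , subst₂ _≢_ (sym (tail-eq ρ t)) (sym (tail-eq ρ u)))
      (at (neg (wkT t ≐ wkT u)))
    Tr' true  (t ≺ u)  = S1-iff (λ ρ → subst₂ _<_ (tail-eq ρ t) (tail-eq ρ u) , subst₂ _<_ (sym (tail-eq ρ t)) (sym (tail-eq ρ u)))
      (at (wkT t ≺ wkT u))
    Tr' false (t ≺ u)  = S1-iff (λ ρ → subst₂ _≮_ (tail-eq ρ t) (tail-eq ρ u) , subst₂ _≮_ (sym (tail-eq ρ t)) (sym (tail-eq ρ u)))
      (at (neg (wkT t ≺ wkT u)))
    Tr' true  (inX t)  = S1-iff (λ ρ → subst (BT _) (tail-eq ρ t) , subst (BT _) (sym (tail-eq ρ t))) (BT' v0 (wkT t))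
    Tr' false (inX t)  = S1-iff (λ ρ → subst (BF _) (tail-eq ρ t) , subst (BF _) (sym (tail-eq ρ t))) (BF' v0 (wkT t))
    Tr' true  (neg φ)  = Tr' false φ
    Tr' false (neg φ)  = Tr' true φ
    Tr' true  (φ ∧' ψ) = Tr' true φ & Tr' true ψ
    Tr' false (φ ∧' ψ) = Tr' false φ ∣∣ Tr' false ψ
    Tr' true  (φ ∨' ψ) = Tr' true φ ∣∣ Tr' true ψ
    Tr' false (φ ∨' ψ) = Tr' false φ & Tr' false ψ
    Tr' true  (∀< t φ) = ball' true t φ
    Tr' false (∀< t φ) = bex' false t φ
    Tr' true  (∃< t φ) = bex' true t φ
    Tr' false (∃< t φ) = ball' false t φ

  -- The oracle is replaced by a string. As `Use` does not query G, it is Σ⁰₁ over every H: over ∅,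
  -- so that the universal predicate captures it, or over any oracle that computes G.
  record FiniteUse (G : SubsetOfω) {k} (P : Env k → Set) : Set₁ where
    field
      Use   : ℕ → Env k → Set
      use'  : ∀ {H} → S1 H (λ ρ → Use (ρ #0) (λ i → ρ (suc i)))
      mono  : ∀ {s t} → s ⊑ t → ∀ ρ → Use s ρ → Use t ρ
      sound : ∀ ρ s → s ⊏ G → Use s ρ → P ρ
      total : ∀ ρ → P ρ → ∃ λ ℓ → Use (pref G ℓ) ρ

  abstract
    finite-use : ∀ {G k} {P : Env k → Set} → S1 G P → FiniteUse G P
    finite-use {G} {k} (δ , d) = record
      { Use   = λ s ρ → ∃ λ t → Tr s true (extend t ρ) δ
      ; use'  = S1-iff (λ ρ → (λ (t , x) → t , S1-ext (Tr' {∅} true δ) (flip-eq ρ t) x)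
                            , (λ (t , x) → t , S1-ext (Tr' {∅} true δ) (λ i → sym (flip-eq ρ t i)) x))
                  (∃' (renf (Tr' true δ) flipT))
      ; mono  = λ h ρ (t , x) → t , Tr-mono h true _ δ x
      ; sound = λ ρ s h (t , x) → proj₂ (d ρ) (t , Tr-sound h true _ δ x)
      ; total = λ ρ p → let (t , x) = proj₁ (d ρ) p ; (ℓ , y) = Complete.complete G true _ δ x in ℓ , t , y }

-- A universal Σ⁰₁ predicate

module UniversalSet (em : ExcludedMiddle 0ℓ) where
  open Strings em
  open Queries em

  -- The pairing function is a parameter since unfolding pr at the numeral tags below is infeasible.
  module Evaluation (pp : ℕ → ℕ → ℕ) (pp-inj : ∀ {a b c d} → pp a b ≡ pp c d → a ≡ c × b ≡ d) where

    codeT : ∀ {k} → Term k → ℕ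
    codeT (var i)  = pp 0 (toℕ i)
    codeT zer      = pp 1 0
    codeT (succ t) = pp 2 (codeT t)
    codeT (s ⊕ t)  = pp 3 (pp (codeT s) (codeT t))
    codeT (s ⊗ t)  = pp 4 (pp (codeT s) (codeT t))

    -- Codes of formulas without set parameter; atoms inX t are coded as false.
    codeΔ : ∀ {k} → Δ₀ k → ℕ
    codeΔ (s ≐ t)  = pp 5 (pp (codeT s) (codeT t))
    codeΔ (s ≺ t)  = pp 6 (pp (codeT s) (codeT t))
    codeΔ (inX t)  = pp 5 (pp (codeT t) (pp 2 (codeT t)))
    codeΔ (neg φ)  = pp 7 (codeΔ φ)
    codeΔ (φ ∧' ψ) = pp 8 (pp (codeΔ φ) (codeΔ ψ))
    codeΔ (φ ∨' ψ) = pp 7 (pp 8 (pp (pp 7 (codeΔ φ)) (pp 7 (codeΔ ψ))))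
    codeΔ (∀< t φ) = pp 9 (pp (codeT t) (codeΔ φ))
    codeΔ (∃< t φ) = pp 7 (pp 9 (pp (codeT t) (pp 7 (codeΔ φ))))

    codeE : ∀ {k} → Env k → ℕ
    codeE {zero}  ρ = 0
    codeE {suc k} ρ = pp (ρ #0) (codeE (λ i → ρ (suc i)))

    jd : ℕ → ℕ → ℕ → ℕ
    jd c r v = pp c (pp r v)

    jd-inj : ∀ {c r v c' r' v'} → jd c r v ≡ jd c' r' v' → c ≡ c' × r ≡ r' × v ≡ v'
    jd-inj {c} {r} {v} {c'} {r'} e =
      let (a , e') = pp-inj {c} {_} {c'} e ; (b , d) = pp-inj {r} {v} {r'} e' in a , b , d

    Bin : (ℕ → Set) → (ℕ → ℕ → ℕ → Set) → ℕ → ℕ → ℕ → Set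
    Bin D op x r v = ∃ λ s → ∃ λ t → ∃ λ a → ∃ λ b →
      x ≡ pp s t × D (jd s r a) × D (jd t r b) × op a b v

    Test : (ℕ → ℕ → Set) → ℕ → ℕ → ℕ → Set
    Test R a b v = R a b × v ≡ 1 ⊎ ¬ R a b × v ≡ 0

    -- Rule D k x r v: the value v of the expression with tag k and body x in the environment r
    -- is justified by the evaluations in D.
    Rule : (ℕ → Set) → ℕ → ℕ → ℕ → ℕ → Set
    Rule D 0 x r v = ∃ λ a → ∃ λ r' → r ≡ pp a r' × (x ≡ 0 × v ≡ a ⊎ ∃ λ i → x ≡ suc i × D (jd (pp 0 i) r' v))
    Rule D 1 x r v = v ≡ 0
    Rule D 2 x r v = ∃ λ w → v ≡ suc w × D (jd x r w)
    Rule D 3 x r v = Bin D (λ a b v → v ≡ a + b) x r v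
    Rule D 4 x r v = Bin D (λ a b v → v ≡ a * b) x r v
    Rule D 5 x r v = Bin D (Test _≡_) x r v
    Rule D 6 x r v = Bin D (Test _<_) x r v
    Rule D 7 x r v = ∃ λ a → D (jd x r a) × (a ≡ 1 × v ≡ 0 ⊎ a ≡ 0 × v ≡ 1)
    Rule D 8 x r v = Bin D (λ a b v → v ≡ a * b) x r v
    Rule D 9 x r v = ∃ λ t → ∃ λ f → ∃ λ b → x ≡ pp t f × D (jd t r b) ×
      (v ≡ 1 × (∀ y → y < b → D (jd f (pp y r) 1)) ⊎ v ≡ 0 × ∃ λ y → y < b × D (jd f (pp y r) 0))
    Rule D _ x r v = ⊥

    Justified : (ℕ → Set) → ℕ → Set
    Justified D d = ∃ λ k → ∃ λ x → ∃ λ r → ∃ λ v → d ≡ jd (pp k x) r v × Rule D k x r v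

    -- No order of evaluation is imposed. Premises concern subexpressions, or a variable in a
    -- shorter environment, so soundness goes by induction on the expression, and closed lists can
    -- simply be concatenated.
    Closed : (ℕ → Set) → Set
    Closed D = ∀ d → D d → Justified D d

    Bin-mono : ∀ {D D'} op {x r v} → (∀ d → D d → D' d) → Bin D op x r v → Bin D' op x r v
    Bin-mono op h (s , t , a , b , e , p , q , o) = s , t , a , b , e , h _ p , h _ q , o

    Rule-mono : ∀ {D D'} → (∀ d → D d → D' d) → ∀ k {x r v} → Rule D k x r v → Rule D' k x r v
    Rule-mono h 0 (a , r' , e , z) = a , r' , e , Sum.map₂ (λ (i , e , p) → i , e , h _ p) z
    Rule-mono h 1 z = z
    Rule-mono h 2 (w , e , p) = w , e , h _ p
    Rule-mono h 3 z = Bin-mono (λ a b v → v ≡ a + b) h z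
    Rule-mono h 4 z = Bin-mono (λ a b v → v ≡ a * b) h z
    Rule-mono h 5 z = Bin-mono (Test _≡_) h z
    Rule-mono h 6 z = Bin-mono (Test _<_) h z
    Rule-mono h 7 (a , p , z) = a , h _ p , z
    Rule-mono h 8 z = Bin-mono (λ a b v → v ≡ a * b) h z
    Rule-mono h 9 (t , f , b , e , p , z) = t , f , b , e , h _ p ,
      Sum.map (λ (e , g) → e , λ y l → h _ (g y l)) (λ (e , y , l , q) → e , y , l , h _ q) z

    Val : ∀ {k} → Δ₀ k → Env k → ℕ → Set
    Val φ ρ v = v ≡ 1 × satΔ ∅ ρ φ ⊎ v ≡ 0 × ¬ satΔ ∅ ρ φ

    val-neg : ∀ {k} (φ : Δ₀ k) ρ {a v} → Val φ ρ a → a ≡ 1 × v ≡ 0 ⊎ a ≡ 0 × v ≡ 1 → Val (neg φ) ρ v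
    val-neg φ ρ (inj₁ (refl , p)) (inj₁ (_ , e)) = inj₂ (e , λ n → n p)
    val-neg φ ρ (inj₂ (refl , p)) (inj₂ (_ , e)) = inj₁ (e , p)

    val-and : ∀ {k} (φ ψ : Δ₀ k) ρ {a b v} → Val φ ρ a → Val ψ ρ b → v ≡ a * b → Val (φ ∧' ψ) ρ v
    val-and φ ψ ρ (inj₁ (refl , p)) (inj₁ (refl , q)) e = inj₁ (e , p , q)
    val-and φ ψ ρ (inj₁ (refl , p)) (inj₂ (refl , q)) e = inj₂ (e , λ x → q (proj₂ x))
    val-and φ ψ ρ (inj₂ (refl , p)) _ e = inj₂ (e , λ x → p (proj₁ x))

    val-iff : ∀ {k} {φ ψ : Δ₀ k} {ρ v} → satΔ ∅ ρ φ iff satΔ ∅ ρ ψ → Val φ ρ v → Val ψ ρ v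
    val-iff (f , g) = Sum.map (λ (e , p) → e , f p) (λ (e , n) → e , λ q → n (g q))

    1≢0 : ∀ {A : Set} → 1 ≡ 0 → A
    1≢0 ()

    deMorgan-∨ : ∀ {k} (φ ψ : Δ₀ k) ρ → satΔ ∅ ρ (neg (neg φ ∧' neg ψ)) iff satΔ ∅ ρ (φ ∨' ψ)
    deMorgan-∨ φ ψ ρ = (λ n → dne λ m → n ((λ p → m (inj₁ p)) , (λ q → m (inj₂ q))))
                     , (λ { (inj₁ p) (n , _) → n p ; (inj₂ q) (_ , n) → n q })

    deMorgan-∃ : ∀ {k} t (φ : Δ₀ (suc k)) ρ → satΔ ∅ ρ (neg (∀< t (neg φ))) iff satΔ ∅ ρ (∃< t φ)
    deMorgan-∃ t φ ρ = (λ n → dne λ m → n λ y l p → m (y , l , p)) , (λ (y , l , p) h → h y l p)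

    module _ {D : ℕ → Set} (cl : Closed D) where

      invert : ∀ k x r v → D (jd (pp k x) r v) → Rule D k x r v
      invert k x r v d with cl _ d
      ... | k' , x' , r' , v' , e , R with jd-inj {pp k x} {r} {v} {pp k' x'} {r'} {v'} e
      ...   | e' , refl , refl with pp-inj {k} {x} {k'} {x'} e'
      ...     | refl , refl = R

      invertBin : ∀ op s t {r v} → Bin D op (pp s t) r v →
        ∃ λ a → ∃ λ b → D (jd s r a) × D (jd t r b) × op a b v
      invertBin op s t (s' , t' , a , b , e , p , q , o) with pp-inj {s} {t} {s'} {t'} e
      ... | refl , refl = a , b , p , q , o

      sound-var : ∀ {k} (i : Fin k) (ρ : Env k) v → D (jd (pp 0 (toℕ i)) (codeE ρ) v) → v ≡ ρ i
      sound-var {suc k} zero ρ v d with invert 0 0 (codeE ρ) v d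
      ... | a , r' , e , inj₁ (_ , refl) = sym (proj₁ (pp-inj {ρ #0} {_} {a} {r'} e))
      sound-var {suc k} (suc i) ρ v d with invert 0 (suc (toℕ i)) (codeE ρ) v d
      ... | a , r' , e , inj₂ (_ , refl , d') with pp-inj {ρ #0} {_} {a} {r'} e
      ...   | refl , refl = sound-var i (λ j → ρ (suc j)) v d'

      soundT : ∀ {k} (t : Term k) (ρ : Env k) v → D (jd (codeT t) (codeE ρ) v) → v ≡ evalT ρ t
      soundT (var i) ρ v d = sound-var i ρ v d
      soundT zer ρ v d = invert 1 0 (codeE ρ) v d
      soundT (succ t) ρ v d with invert 2 (codeT t) (codeE ρ) v d
      ... | w , refl , d' = cong suc (soundT t ρ w d')
      soundT (s ⊕ t) ρ v d with invertBin (λ a b v → v ≡ a + b) (codeT s) (codeT t) (invert 3 (pp (codeT s) (codeT t)) (codeE ρ) v d)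
      ... | a , b , p , q , refl = cong₂ _+_ (soundT s ρ a p) (soundT t ρ b q)
      soundT (s ⊗ t) ρ v d with invertBin (λ a b v → v ≡ a * b) (codeT s) (codeT t) (invert 4 (pp (codeT s) (codeT t)) (codeE ρ) v d)
      ... | a , b , p , q , refl = cong₂ _*_ (soundT s ρ a p) (soundT t ρ b q)

      soundNeg : ∀ {k} (φ : Δ₀ k) → (∀ ρ v → D (jd (codeΔ φ) (codeE ρ) v) → Val φ ρ v) →
        ∀ ρ v → D (jd (pp 7 (codeΔ φ)) (codeE ρ) v) → Val (neg φ) ρ v
      soundNeg φ ih ρ v d with invert 7 (codeΔ φ) (codeE ρ) v d
      ... | a , d' , z = val-neg φ ρ (ih ρ a d') z

      soundAll : ∀ {k} t (φ : Δ₀ (suc k)) → (∀ ρ v → D (jd (codeΔ φ) (codeE ρ) v) → Val φ ρ v) →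
        ∀ ρ v → D (jd (pp 9 (pp (codeT t) (codeΔ φ))) (codeE ρ) v) → Val (∀< t φ) ρ v
      soundAll t φ ih ρ v d with invert 9 (pp (codeT t) (codeΔ φ)) (codeE ρ) v d
      ... | t' , f' , b , e , d' , z with pp-inj {codeT t} {codeΔ φ} {t'} {f'} e
      ...   | refl , refl with soundT t ρ b d'
      ...     | refl with z
      ...       | inj₁ (e' , h) = inj₁ (e' , λ y l →
                    Sum.[ proj₂ , (λ (e , _) → 1≢0 e) ] (ih (extend y ρ) 1 (h y l)))
      ...       | inj₂ (e' , y , l , q) = inj₂ (e' , λ g →
                    Sum.[ (λ (e , _) → 1≢0 (sym e)) , (λ (_ , n) → n (g y l)) ] (ih (extend y ρ) 0 q))

      soundΔ : ∀ {k} (φ : Δ₀ k) ρ v → D (jd (codeΔ φ) (codeE ρ) v) → Val φ ρ v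
      soundΔ (s ≐ t) ρ v d with invertBin (Test _≡_) (codeT s) (codeT t) (invert 5 (pp (codeT s) (codeT t)) (codeE ρ) v d)
      ... | a , b , p , q , z with soundT s ρ a p | soundT t ρ b q
      ...   | refl | refl = Sum.map swap swap z
      soundΔ (s ≺ t) ρ v d with invertBin (Test _<_) (codeT s) (codeT t) (invert 6 (pp (codeT s) (codeT t)) (codeE ρ) v d)
      ... | a , b , p , q , z with soundT s ρ a p | soundT t ρ b q
      ...   | refl | refl = Sum.map swap swap z
      -- The code is that of `t ≐ succ t`, so only the value 0 can be justified, which is right for
      -- the empty parameter.
      soundΔ (inX t) ρ v d with invertBin (Test _≡_) (codeT t) (codeT (succ t)) (invert 5 (pp (codeT t) (codeT (succ t))) (codeE ρ) v d)
      ... | a , b , p , q , z with soundT t ρ a p | soundT (succ t) ρ b q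
      ...   | refl | refl with z
      ...     | inj₁ (e , _) = ⊥-elim (1+n≢n (sym e))
      ...     | inj₂ (_ , e) = inj₂ (e , λ ())
      soundΔ (neg φ) ρ v d = soundNeg φ (soundΔ φ) ρ v d
      soundΔ (φ ∧' ψ) ρ v d with invertBin (λ a b v → v ≡ a * b) (codeΔ φ) (codeΔ ψ) (invert 8 (pp (codeΔ φ) (codeΔ ψ)) (codeE ρ) v d)
      ... | a , b , p , q , e = val-and φ ψ ρ (soundΔ φ ρ a p) (soundΔ ψ ρ b q) e
      soundΔ (φ ∨' ψ) ρ v d = val-iff {φ = neg (neg φ ∧' neg ψ)} {φ ∨' ψ} (deMorgan-∨ φ ψ ρ)
        (soundNeg (neg φ ∧' neg ψ) conj ρ v d)
        where
        conj : ∀ ρ v → D (jd (codeΔ (neg φ ∧' neg ψ)) (codeE ρ) v) → Val (neg φ ∧' neg ψ) ρ v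
        conj ρ v d with invertBin (λ a b v → v ≡ a * b) (codeΔ (neg φ)) (codeΔ (neg ψ)) (invert 8 (pp (codeΔ (neg φ)) (codeΔ (neg ψ))) (codeE ρ) v d)
        ... | a , b , p , q , e = val-and (neg φ) (neg ψ) ρ (soundNeg φ (soundΔ φ) ρ a p) (soundNeg ψ (soundΔ ψ) ρ b q) e
      soundΔ (∀< t φ) ρ v d = soundAll t φ (soundΔ φ) ρ v d
      soundΔ (∃< t φ) ρ v d = val-iff {φ = neg (∀< t (neg φ))} {∃< t φ} (deMorgan-∃ t φ ρ)
        (soundNeg (∀< t (neg φ)) (soundAll t (neg φ) (soundNeg φ (soundΔ φ))) ρ v d)

    ClosedList : List ℕ → Set
    ClosedList L = Closed (_∈ₗ L)

    closed-++ : ∀ {L M} → ClosedList L → ClosedList M → ClosedList (L ++ M)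
    closed-++ {L} {M} f g d m with ∈-++⁻ L m
    ... | inj₁ x = let (k , x' , r , v , e , R) = f d x in k , x' , r , v , e , Rule-mono (λ _ → ∈-++⁺ˡ) k R
    ... | inj₂ x = let (k , x' , r , v , e , R) = g d x in k , x' , r , v , e , Rule-mono (λ _ → ∈-++⁺ʳ L) k R

    closed-∷ : ∀ {L} k {x r v} → ClosedList L → Rule (_∈ₗ L) k x r v → ClosedList (jd (pp k x) r v ∷ L)
    closed-∷ k f R d (here refl) = k , _ , _ , _ , refl , Rule-mono (λ _ → there) k R
    closed-∷ k f R d (there x)   = let (k , x' , r , v , e , R) = f d x in k , x' , r , v , e , Rule-mono (λ _ → there) k R

    Evaluates : ℕ → ℕ → ℕ → Set
    Evaluates c r v = ∃ λ L → ClosedList L × jd c r v ∈ₗ L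

    step : ∀ {L} k x r v → ClosedList L → Rule (_∈ₗ L) k x r v → Evaluates (pp k x) r v
    step k x r v c R = _ , closed-∷ k c R , here refl

    stepBin : ∀ op {s t r a b} k v → (∀ {D} → Bin D op (pp s t) r v → Rule D k (pp s t) r v) →
      Evaluates s r a → Evaluates t r b → op a b v → Evaluates (pp k (pp s t)) r v
    stepBin op k v R (L , c , m) (L' , c' , m') o = step k _ _ v (closed-++ c c')
      (R (_ , _ , _ , _ , refl , ∈-++⁺ˡ m , ∈-++⁺ʳ L m' , o))

    compl-var : ∀ {k} (i : Fin k) (ρ : Env k) → Evaluates (pp 0 (toℕ i)) (codeE ρ) (ρ i)
    compl-var zero ρ = step {L = []} 0 _ _ _ (λ _ ()) (_ , _ , refl , inj₁ (refl , refl))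
    compl-var (suc i) ρ = let (L , c , m) = compl-var i (λ j → ρ (suc j)) in
      step 0 _ _ _ c (_ , _ , refl , inj₂ (toℕ i , refl , m))

    complT : ∀ {k} (t : Term k) (ρ : Env k) → Evaluates (codeT t) (codeE ρ) (evalT ρ t)
    complT (var i)  ρ = compl-var i ρ
    complT zer      ρ = step {L = []} 1 0 (codeE ρ) 0 (λ _ ()) refl
    complT (succ t) ρ = let (L , c , m) = complT t ρ in step 2 _ _ _ c (_ , refl , m)
    complT (s ⊕ t)  ρ = stepBin (λ a b v → v ≡ a + b) 3 _ (λ z → z) (complT s ρ) (complT t ρ) refl
    complT (s ⊗ t)  ρ = stepBin (λ a b v → v ≡ a * b) 4 _ (λ z → z) (complT s ρ) (complT t ρ) refl

    EvalΔ : ∀ {k} → ℕ → Δ₀ k → Env k → Set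
    EvalΔ c φ ρ = ∃ λ v → Evaluates c (codeE ρ) v × Val φ ρ v

    complTest : ∀ {k s t} (R : ℕ → ℕ → Set) n {r a b} → (φ : Δ₀ k) → ∀ ρ →
      (∀ {D v} → Bin D (Test R) (pp s t) r v → Rule D n (pp s t) r v) →
      satΔ ∅ ρ φ iff R a b → Evaluates s r a → Evaluates t r b → r ≡ codeE ρ → EvalΔ (pp n (pp s t)) φ ρ
    complTest R n {a = a} {b} φ ρ rule (f , g) es et refl with em {R a b}
    ... | yes p = 1 , stepBin (Test R) n 1 rule es et (inj₁ (p , refl)) , inj₁ (refl , g p)
    ... | no np = 0 , stepBin (Test R) n 0 rule es et (inj₂ (np , refl)) , inj₂ (refl , λ x → np (f x))

    complNeg : ∀ {k c} (φ : Δ₀ k) {ρ} → EvalΔ c φ ρ → EvalΔ (pp 7 c) (neg φ) ρ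
    complNeg φ {ρ} (v , (L , cl , m) , inj₁ (refl , p)) =
      0 , step 7 _ _ 0 cl (1 , m , inj₁ (refl , refl)) , inj₂ (refl , λ n → n p)
    complNeg φ {ρ} (v , (L , cl , m) , inj₂ (refl , p)) =
      1 , step 7 _ _ 1 cl (0 , m , inj₂ (refl , refl)) , inj₁ (refl , p)

    complAnd : ∀ {k c d} (φ ψ : Δ₀ k) {ρ} → EvalΔ c φ ρ → EvalΔ d ψ ρ → EvalΔ (pp 8 (pp c d)) (φ ∧' ψ) ρ
    complAnd φ ψ {ρ} (a , e , p) (b , e' , q) =
      a * b , stepBin (λ a b v → v ≡ a * b) 8 (a * b) (λ z → z) e e' refl , val-and φ ψ ρ p q refl

    closed-union : ∀ {c r} n → (∀ y → y < n → Evaluates c (pp y r) 1) →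
      ∃ λ L → ClosedList L × (∀ y → y < n → jd c (pp y r) 1 ∈ₗ L)
    closed-union zero    f = [] , (λ _ ()) , λ _ ()
    closed-union (suc n) f =
      let (L , c , g) = closed-union n (λ y l → f y (m<n⇒m<1+n l)) ; (L' , c' , m) = f n ≤-refl in
      L ++ L' , closed-++ c c' , λ y l →
        Sum.[ (λ l' → ∈-++⁺ˡ (g y l')) , (λ { refl → ∈-++⁺ʳ L m }) ] (m≤n⇒m<n∨m≡n (≤-pred l))

    complAll : ∀ {k c} t (φ : Δ₀ (suc k)) ρ → (∀ y → EvalΔ c φ (extend y ρ)) →
      EvalΔ (pp 9 (pp (codeT t) c)) (∀< t φ) ρ
    complAll {c = c} t φ ρ ih with complT t ρ | em {∃ λ y → y < evalT ρ t × ¬ satΔ ∅ (extend y ρ) φ}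
    ... | L , cl , m | yes (y , l , n) with ih y
    ...   | v , _ , inj₁ (_ , p) = ⊥-elim (n p)
    ...   | v , (L' , cl' , m') , inj₂ (refl , _) =
      0 , step 9 _ _ 0 (closed-++ cl cl')
            (_ , _ , _ , refl , ∈-++⁺ˡ m , inj₂ (refl , y , l , ∈-++⁺ʳ L m')) , inj₂ (refl , λ g → n (g y l))
    complAll {c = c} t φ ρ ih | L , cl , m | no ne =
      let (L' , cl' , g) = closed-union (evalT ρ t) true-instances in
      1 , step 9 _ _ 1 (closed-++ cl cl')
            (_ , _ , _ , refl , ∈-++⁺ˡ m , inj₁ (refl , λ y l → ∈-++⁺ʳ L (g y l)))
        , inj₁ (refl , λ y l → dne λ n → ne (y , l , n))
      where
      true-instances : ∀ y → y < evalT ρ t → Evaluates c (pp y (codeE ρ)) 1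
      true-instances y l with ih y
      ... | v , e , inj₁ (refl , _) = e
      ... | v , e , inj₂ (_ , n) = ⊥-elim (ne (y , l , n))

    complΔ : ∀ {k} (φ : Δ₀ k) ρ → EvalΔ (codeΔ φ) φ ρ
    complΔ (s ≐ t) ρ = complTest _≡_ 5 (s ≐ t) ρ (λ z → z) ((λ z → z) , (λ z → z)) (complT s ρ) (complT t ρ) refl
    complΔ (s ≺ t) ρ = complTest _<_ 6 (s ≺ t) ρ (λ z → z) ((λ z → z) , (λ z → z)) (complT s ρ) (complT t ρ) refl
    complΔ (inX t) ρ = 0 , stepBin (Test _≡_) 5 0 (λ z → z) (complT t ρ) (complT (succ t) ρ)
      (inj₂ ((λ e → 1+n≢n (sym e)) , refl)) , inj₂ (refl , λ ())
    complΔ (neg φ) ρ = complNeg φ (complΔ φ ρ)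
    complΔ (φ ∧' ψ) ρ = complAnd φ ψ (complΔ φ ρ) (complΔ ψ ρ)
    complΔ (φ ∨' ψ) ρ with complNeg (neg φ ∧' neg ψ)
      (complAnd (neg φ) (neg ψ) (complNeg φ (complΔ φ ρ)) (complNeg ψ (complΔ ψ ρ)))
    ... | v , e , p = v , e , val-iff {φ = neg (neg φ ∧' neg ψ)} {φ ∨' ψ} (deMorgan-∨ φ ψ ρ) p
    complΔ (∀< t φ) ρ = complAll t φ ρ (λ y → complΔ φ (extend y ρ))
    complΔ (∃< t φ) ρ with complNeg (∀< t (neg φ)) (complAll t (neg φ) ρ (λ y → complNeg φ (complΔ φ (extend y ρ))))
    ... | v , e , p = v , e , val-iff {φ = neg (∀< t (neg φ))} {∃< t φ} (deMorgan-∃ t φ ρ) p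

    list-bound : ∀ (L : List ℕ) → ∃ λ N → ∀ d → d ∈ₗ L → d < N
    list-bound []      = 0 , λ _ ()
    list-bound (x ∷ L) = let (N , h) = list-bound L in suc x ⊔ N ,
      λ { d (here refl) → m≤m⊔n (suc x) N ; d (there m) → ≤-trans (h d m) (m≤n⊔m (suc x) N) }

    list-string : ∀ (L : List ℕ) → ∃ λ D → ∀ d → d ∈ₗ L iff BT D d
    list-string L = pref f N , λ d →
        (λ m → pref-BT f N d (h d m) (dec-true (d ∈? L) m))
      , (λ t → back d (proj₁ (pref-⊏ f N) d t))
      where
      N = proj₁ (list-bound L)
      h = proj₂ (list-bound L)
      f : ℕ → Bool
      f d = does (d ∈? L)
      back : ∀ d → f d ≡ true → d ∈ₗ L
      back d e with d ∈? L
      ... | yes m = m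

    -- The Σ⁰₁ truth definition: an evaluation needs only finitely many judgements, and these form
    -- the ones of a single string D.
    Derivation : ∀ {k} (φ : Δ₀ k) ρ → satΔ ∅ ρ φ iff ∃ λ D → Closed (BT D) × BT D (jd (codeΔ φ) (codeE ρ) 1)
    Derivation φ ρ = there' , back
      where
      there' : satΔ ∅ ρ φ → _
      there' p with complΔ φ ρ
      ... | v , _ , inj₂ (_ , n) = ⊥-elim (n p)
      ... | v , (L , cl , m) , inj₁ (refl , _) = let (D , h) = list-string L in
        D , (λ d t → let (k , x , r , v , e , R) = cl d (proj₂ (h d) t) in
                     k , x , r , v , e , Rule-mono (λ d → proj₁ (h d)) k R)
          , proj₁ (h _) m
      back : _ → satΔ ∅ ρ φ
      back (D , cl , t) with soundΔ cl φ ρ 1 t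
      ... | inj₁ (_ , p) = p

  open Evaluation pr (λ {a} {b} {c} {d} → pr-inj {a} {b} {c} {d})

  module _ {G : SubsetOfω} where

    pr≡ : ∀ {k} (x a b : Term k) → S1 G (λ ρ → evalT ρ x ≡ pr (evalT ρ a) (evalT ρ b))
    pr≡ x a b = at (x ≐ prT a b)

    inD : ∀ {k} (D c r v : Term k) → S1 G (λ ρ → BT (evalT ρ D) (jd (evalT ρ c) (evalT ρ r) (evalT ρ v)))
    inD D c r v = BT' D (prT c (prT r v))

    bin' : ∀ (op : ℕ → ℕ → ℕ → Set) → S1 G {3} (λ ρ → op (ρ #0) (ρ #1) (ρ #2)) →
      S1 G {4} (λ ρ → Bin (BT (ρ #3)) op (ρ #2) (ρ #1) (ρ #0))
    bin' op o = ∃' (∃' (∃' (∃' (pr≡ v6 v3 v2 & inD v7 v3 v5 v1 & inD v7 v2 v5 v0 & ren o (v1 ∷ v0 ∷ v4 ∷ [])))))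

    test' : ∀ (R : ℕ → ℕ → Set) → S1 G {2} (λ ρ → R (ρ #0) (ρ #1)) →
      S1 G {2} (λ ρ → ¬ R (ρ #0) (ρ #1)) →
      S1 G {3} (λ ρ → Test R (ρ #0) (ρ #1) (ρ #2))
    test' R r nr = ren r (v0 ∷ v1 ∷ []) & at (v2 ≐ num 1) ∣∣ ren nr (v0 ∷ v1 ∷ []) & at (v2 ≐ num 0)

    tag : ∀ n → S1 G {4} (λ ρ → Rule (BT (ρ #3)) n (ρ #2) (ρ #1) (ρ #0)) →
      S1 G {5} (λ ρ → ρ #3 ≡ n ×
        Rule (BT (ρ #4)) n (ρ #2) (ρ #1) (ρ #0))
    tag n R = S1-iff (λ ρ → (λ (e , x) → trans e (eval-num ρ n) , x) , (λ (e , x) → trans e (sym (eval-num ρ n)) , x))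
      (at (v3 ≐ num n) & ren R (v0 ∷ v1 ∷ v2 ∷ v4 ∷ []))

    rule' : S1 G {5} (λ ρ → Rule (BT (ρ #4)) (ρ #3)
      (ρ #2) (ρ #1) (ρ #0))
    rule' = S1-iff (λ ρ → to ρ , from ρ _ refl)
      ( tag 0 (∃' (∃' (pr≡ v3 v1 v0 & (at (v4 ≐ num 0) & at (v2 ≐ v1)
                 ∣∣ ∃' (at (v5 ≐ succ v0) & inD v6 (prT zer v0) v1 v3)))))
      ∣∣ tag 1 (at (v0 ≐ num 0))
      ∣∣ tag 2 (∃' (at (v1 ≐ succ v0) & inD v4 v3 v2 v0))
      ∣∣ tag 3 (bin' (λ a b v → v ≡ a + b) (at (v2 ≐ (v0 ⊕ v1))))
      ∣∣ tag 4 (bin' (λ a b v → v ≡ a * b) (at (v2 ≐ (v0 ⊗ v1))))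
      ∣∣ tag 5 (bin' (Test _≡_) (test' _≡_ (at (v0 ≐ v1)) (at (neg (v0 ≐ v1)))))
      ∣∣ tag 6 (bin' (Test _<_) (test' _<_ (at (v0 ≺ v1)) (at (neg (v0 ≺ v1)))))
      ∣∣ tag 7 (∃' (inD v4 v3 v2 v0 & (at (v0 ≐ num 1) & at (v1 ≐ num 0) ∣∣ at (v0 ≐ num 0) & at (v1 ≐ num 1))))
      ∣∣ tag 8 (bin' (λ a b v → v ≡ a * b) (at (v2 ≐ (v0 ⊗ v1))))
      ∣∣ tag 9 (∃' (∃' (∃' (pr≡ v5 v2 v1 & inD v6 v2 v4 v0 &
                 (at (v3 ≐ num 1) & ∀' v0 (inD v7 v2 (prT v0 v5) (num 1))
                  ∣∣ at (v3 ≐ num 0) & ∃' (at (v0 ≺ v1) & inD v7 v2 (prT v0 v5) (num 0))))))))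
      where
      D : Env 5 → ℕ → Set
      D ρ = BT (ρ #4)
      Rl : Env 5 → ℕ → Set
      Rl ρ k = Rule (D ρ) k (ρ #2) (ρ #1) (ρ #0)
      Is : Env 5 → ℕ → Set
      Is ρ n = ρ #3 ≡ n × Rl ρ n
      un : ∀ ρ {n} → Is ρ n → Rl ρ (ρ #3)
      un ρ (e , x) = subst (Rl ρ) (sym e) x
      Any : Env 5 → Set
      Any ρ = Is ρ 0 ⊎ Is ρ 1 ⊎ Is ρ 2 ⊎ Is ρ 3 ⊎ Is ρ 4 ⊎ Is ρ 5 ⊎ Is ρ 6 ⊎ Is ρ 7 ⊎ Is ρ 8 ⊎ Is ρ 9
      to : ∀ ρ → Any ρ → Rl ρ (ρ #3)
      to ρ = Sum.[ un ρ , Sum.[ un ρ , Sum.[ un ρ , Sum.[ un ρ , Sum.[ un ρ ,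
             Sum.[ un ρ , Sum.[ un ρ , Sum.[ un ρ , Sum.[ un ρ , un ρ ] ] ] ] ] ] ] ] ]
      from : ∀ ρ k → ρ #3 ≡ k → Rl ρ k → Any ρ
      from ρ 0 e x = inj₁ (e , x)
      from ρ 1 e x = inj₂ (inj₁ (e , x))
      from ρ 2 e x = inj₂ (inj₂ (inj₁ (e , x)))
      from ρ 3 e x = inj₂ (inj₂ (inj₂ (inj₁ (e , x))))
      from ρ 4 e x = inj₂ (inj₂ (inj₂ (inj₂ (inj₁ (e , x)))))
      from ρ 5 e x = inj₂ (inj₂ (inj₂ (inj₂ (inj₂ (inj₁ (e , x))))))
      from ρ 6 e x = inj₂ (inj₂ (inj₂ (inj₂ (inj₂ (inj₂ (inj₁ (e , x)))))))
      from ρ 7 e x = inj₂ (inj₂ (inj₂ (inj₂ (inj₂ (inj₂ (inj₂ (inj₁ (e , x))))))))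
      from ρ 8 e x = inj₂ (inj₂ (inj₂ (inj₂ (inj₂ (inj₂ (inj₂ (inj₂ (inj₁ (e , x)))))))))
      from ρ 9 e x = inj₂ (inj₂ (inj₂ (inj₂ (inj₂ (inj₂ (inj₂ (inj₂ (inj₂ (e , x)))))))))

    closed' : S1 G {1} (λ ρ → Closed (BT (ρ #0)))
    closed' = allT v0 (∃' (∃' (∃' (∃' (at (v4 ≐ prT (prT v3 v2) (prT v1 v0)) &
      ren rule' (v0 ∷ v1 ∷ v2 ∷ v3 ∷ v5 ∷ []))))))

  -- U ⟨c, x⟩ n evaluates the formula with code c at (n, x); so ⟨c, _⟩ are the indices of the s-m-n theorem.
  abstract
    U : ℕ → ℕ → Set
    U e n = ∃ λ c → ∃ λ x → e ≡ pr c x × ∃ λ t → ∃ λ D →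
      Closed (BT D) × BT D (jd c (pr t (pr n (pr x 0))) 1)


    U' : ∀ {G k} (e n : Term k) → S1 G (λ ρ → U (evalT ρ e) (evalT ρ n))
    U' e n = ren (∃' (∃' (pr≡ v2 v1 v0 & ∃' (∃' (ren closed' (v0 ∷ []) &
      inD v0 v3 (prT v1 (prT v5 (prT v2 zer))) (num 1)))))) (e ∷ n ∷ [])

    universal : ∀ {R : ℕ → ℕ → Set} → S1 ∅ {2} (λ ρ → R (ρ #0) (ρ #1)) →
      ∃ λ c → ∀ n x → R n x iff U (pr c x) n
    universal {R} (δ , d) = codeΔ δ , λ n x → to n x , from n x
      where
      env : ℕ → ℕ → Env 2
      env n x = extend n (extend x (λ ()))
      to : ∀ n x → R n x → U (pr (codeΔ δ) x) n
      to n x r = let (t , p) = proj₁ (d (env n x)) r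
                     (D , cl , m) = proj₁ (Derivation δ (extend t (env n x))) p
                 in codeΔ δ , x , refl , t , D , cl , m
      from : ∀ n x → U (pr (codeΔ δ) x) n → R n x
      from n x (c , y , e , t , D , cl , m) with pr-inj {codeΔ δ} {x} {c} {y} e
      ... | refl , refl = proj₂ (d (env n x)) (t , proj₂ (Derivation δ (extend t (env n x))) (D , cl , m))

-- Jumps, Turing reducibility and the arithmetical hierarchy

module Degrees (em : ExcludedMiddle 0ℓ) where
  open Strings em
  open Queries em
  open UniversalSet em

  abstract
    ⌊_⌋ : Set → Bool
    ⌊ P ⌋ = does (em {P})

    ⌊⌋-true : ∀ {P} → ⌊ P ⌋ ≡ true iff P
    ⌊⌋-true {P} with em {P}
    ... | yes p = (λ _ → p) , (λ _ → refl)
    ... | no n  = (λ ()) , (λ p → ⊥-elim (n p))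

  ⌊⌋-false : ∀ {P} → ⌊ P ⌋ ≡ false iff ¬ P
  ⌊⌋-false {P} = (λ e p → contradiction (trans (sym (proj₂ ⌊⌋-true p)) e) λ ())
               , (λ n → proj₁ ≢true (λ e → n (proj₁ ⌊⌋-true e)))

  JP : SubsetOfω → ℕ → Set
  JP q e = ∃ λ s → s ⊏ q × U e s

  jump : SubsetOfω → SubsetOfω
  jump q e = ⌊ JP q e ⌋

  JP' : ∀ {q k} (e : Term k) → S1 q (λ ρ → JP q (evalT ρ e))
  JP' e = ren (∃' (⊏' v0 & U' v1 v0)) (e ∷ [])

  abstract
    enumerate₁ : ∀ {q} {P : Env 1 → Set} → S1 q P → ∃ λ c → ∀ x → P (single x) iff JP q (pr c x)
    enumerate₁ {q} {P} p = proj₁ uni , λ x →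
        (λ px → let (ℓ , u) = total (single x) px in pref q ℓ , pref-⊏ q ℓ , proj₁ (proj₂ uni (pref q ℓ) x) u)
      , (λ (s , h , u) → sound (single x) s h (proj₂ (proj₂ uni s x) u))
      where
      open FiniteUse (finite-use p)
      eq : ∀ (ρ : Env 2) i → ρ i ≡ extend (ρ #0) (single (ρ #1)) i
      eq ρ #0       = refl
      eq ρ #1 = refl
      uni : ∃ λ c → ∀ n x → Use n (single x) iff U (pr c x) n
      uni = universal {λ s x → Use s (single x)}
        (S1-iff (λ ρ → S1-ext (use' {∅}) (eq ρ) , S1-ext (use' {∅}) (λ i → sym (eq ρ i))) use')

    -- The reduction to the jump is given by a term, so over the jump both the predicate and its
    -- negation become literals; see `jump⁺` and `jump⁻`. Variables are merged pairwise until one is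
    -- left.
    enumerate : ∀ {q} k {P : Env (suc k) → Set} → S1 q P → ∃ λ t → ∀ ρ → P ρ iff JP q (evalT ρ t)
    enumerate zero {P} p = let (c , h) = enumerate₁ p in prT (num c) v0 , λ ρ →
        (λ x → subst (λ z → JP _ (pr z (ρ #0))) (sym (eval-num ρ c)) (proj₁ (h (ρ #0)) (S1-ext p (λ { zero → refl }) x)))
      , (λ x → S1-ext p (λ { zero → refl }) (proj₂ (h (ρ #0)) (subst (λ z → JP _ (pr z (ρ #0))) (eval-num ρ c) x)))
    enumerate {q} (suc k) {P} p = subT θ t , λ ρ →
        (λ x → subst (JP q) (sym (ev ρ)) (proj₁ (h _) (ρ #0 , ρ #1 , refl , S1-ext p (eq ρ) x)))
      , (λ x → back ρ (proj₂ (h _) (subst (JP q) (ev ρ) x)))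
      where
      inn : Fin (suc (suc k)) → Term (suc (suc (suc k)))
      inn zero          = v1
      inn (suc zero)    = v0
      inn (suc (suc i)) = var (suc (suc (suc i)))
      Unpacked : Env (suc k) → Set
      Unpacked ρ = ∃ λ a → ∃ λ b → ρ #0 ≡ pr a b × P (λ i → evalT (extend b (extend a ρ)) (inn i))
      ih : ∃ λ t → ∀ ρ → Unpacked ρ iff JP q (evalT ρ t)
      ih = enumerate k (∃' (∃' (pr≡ v2 v1 v0 & renf p inn)))
      t : Term (suc k)
      t = proj₁ ih
      h : ∀ ρ → Unpacked ρ iff JP q (evalT ρ t)
      h = proj₂ ih
      θ : Fin (suc k) → Term (suc (suc k))
      θ zero    = prT v0 v1
      θ (suc i) = var (suc (suc i))
      packed : Env (suc (suc k)) → Env (suc k)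
      packed ρ #0    = pr (ρ #0) (ρ #1)
      packed ρ (suc i) = ρ (suc (suc i))
      ev : ∀ ρ → evalT ρ (subT θ t) ≡ evalT (packed ρ) t
      ev ρ = eval-sub {θ = θ} {ρ} {packed ρ} (λ { zero → refl ; (suc i) → refl }) t
      eq : ∀ ρ i → ρ i ≡ evalT (extend (ρ #1) (extend (ρ #0) (packed ρ))) (inn i)
      eq ρ #0          = refl
      eq ρ #1    = refl
      eq ρ (suc (suc i)) = refl
      back : ∀ ρ → Unpacked (packed ρ) → P ρ
      back ρ (a , b , e , x) with pr-inj {ρ #0} {ρ #1} {a} {b} e
      ... | refl , refl = S1-ext p (λ i → sym (eq ρ i)) x

  jump⁺ : ∀ {q k} {P : Env (suc k) → Set} → S1 q P → S1 (jump q) P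
  jump⁺ {q} {k} p = let (t , h) = enumerate k p in
    S1-iff (λ ρ → (λ e → proj₂ (h ρ) (proj₁ ⌊⌋-true e)) , (λ x → proj₂ ⌊⌋-true (proj₁ (h ρ) x))) (at (inX t))

  jump⁻ : ∀ {q k} {P : Env (suc k) → Set} → S1 q P → S1 (jump q) (λ ρ → ¬ P ρ)
  jump⁻ {q} {k} p = let (t , h) = enumerate k p in
    S1-iff (λ ρ → (λ n x → n (proj₂ ⌊⌋-true (proj₁ (h ρ) x))) , (λ n e → n (proj₂ (h ρ) (proj₁ ⌊⌋-true e))))
      (at (neg (inX t)))

  infix 4 _≤T_
  -- Turing reducibility in the form of Post's theorem: a is Δ⁰₁ relative to b.
  record _≤T_ (a b : SubsetOfω) : Set where
    field
      member : S1 b {1} (λ ρ → a (ρ #0) ≡ true)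
      absent : S1 b {1} (λ ρ → a (ρ #0) ≡ false)
  open _≤T_

  ≤T-refl : ∀ {a} → a ≤T a
  ≤T-refl .member = at (inX v0)
  ≤T-refl .absent = S1-iff (λ ρ → ≢true) (at (neg (inX v0)))

  ⊏-≤T : ∀ {a b} → a ≤T b → ∀ {k} (s : Term k) → S1 b (λ ρ → evalT ρ s ⊏ a)
  ⊏-≤T h s = ren (allT v0 (ren (member h) (v0 ∷ [])) & allF v0 (ren (absent h) (v0 ∷ []))) (s ∷ [])

  S1-≤T : ∀ {a b k} {P : Env k → Set} → a ≤T b → S1 a P → S1 b P
  S1-≤T {a} h p = S1-iff (λ ρ → (λ (s , h , u) → sound ρ s h u)
                            , (λ x → let (ℓ , u) = total ρ x in pref a ℓ , pref-⊏ a ℓ , u))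
      (∃' (⊏-≤T h v0 & use'))
    where open FiniteUse (finite-use p)

  ≤T-trans : ∀ {a b c} → a ≤T b → b ≤T c → a ≤T c
  ≤T-trans h h' .member = S1-≤T h' (member h)
  ≤T-trans h h' .absent = S1-≤T h' (absent h)

  jump-≤T : ∀ {a b} → a ≤T b → jump a ≤T jump b
  jump-≤T h .member = S1-iff (λ ρ → iff-sym ⌊⌋-true) (jump⁺ (S1-≤T h (JP' v0)))
  jump-≤T h .absent = S1-iff (λ ρ → iff-sym ⌊⌋-false) (jump⁻ (S1-≤T h (JP' v0)))

  infixl 5 _⊞_
  _⊞_ : SubsetOfω → SubsetOfω → SubsetOfω
  (q ⊞ r) 0             = q 0
  (q ⊞ r) 1             = r 0
  (q ⊞ r) (suc (suc n)) = ((λ i → q (suc i)) ⊞ (λ i → r (suc i))) n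

  ⊞-even : ∀ q r i → (q ⊞ r) (i + i) ≡ q i
  ⊞-even q r zero    = refl
  ⊞-even q r (suc i) rewrite +-suc i i = ⊞-even (λ i → q (suc i)) (λ i → r (suc i)) i

  ⊞-odd : ∀ q r i → (q ⊞ r) (suc (i + i)) ≡ r i
  ⊞-odd q r zero    = refl
  ⊞-odd q r (suc i) rewrite +-suc i i = ⊞-odd (λ i → q (suc i)) (λ i → r (suc i)) i

  half : ∀ n → ∃ λ i → n ≡ i + i ⊎ n ≡ suc (i + i)
  half zero          = 0 , inj₁ refl
  half (suc zero)    = 0 , inj₂ refl
  half (suc (suc n)) with half n
  ... | i , inj₁ refl = suc i , inj₁ (cong suc (sym (+-suc i i)))
  ... | i , inj₂ refl = suc i , inj₂ (cong (λ z → suc (suc z)) (sym (+-suc i i)))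

  ≤T-⊞ˡ : ∀ {q r} → q ≤T q ⊞ r
  ≤T-⊞ˡ {q} {r} .member = S1-iff (λ ρ → trans (sym (⊞-even q r _)) , trans (⊞-even q r _)) (at (inX (v0 ⊕ v0)))
  ≤T-⊞ˡ {q} {r} .absent = S1-iff (λ ρ → iff-trans ≢true (trans (sym (⊞-even q r _)) , trans (⊞-even q r _)))
    (at (neg (inX (v0 ⊕ v0))))

  ≤T-⊞ʳ : ∀ {q r} → r ≤T q ⊞ r
  ≤T-⊞ʳ {q} {r} .member = S1-iff (λ ρ → trans (sym (⊞-odd q r _)) , trans (⊞-odd q r _)) (at (inX (succ (v0 ⊕ v0))))
  ≤T-⊞ʳ {q} {r} .absent = S1-iff (λ ρ → iff-trans ≢true (trans (sym (⊞-odd q r _)) , trans (⊞-odd q r _)))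
    (at (neg (inX (succ (v0 ⊕ v0)))))

  module _ (q r : SubsetOfω) (b : Bool) where

    Half : ℕ → Set
    Half n = (∃ λ i → n ≡ i + i × q i ≡ b) ⊎ (∃ λ i → n ≡ suc (i + i) × r i ≡ b)

    half-⊞ : ∀ n → Half n iff (q ⊞ r) n ≡ b
    half-⊞ n = (λ { (inj₁ (i , refl , e)) → trans (⊞-even q r i) e
                  ; (inj₂ (i , refl , e)) → trans (⊞-odd q r i) e })
             , λ e → back e (half n)
      where
      back : (q ⊞ r) n ≡ b → (∃ λ i → n ≡ i + i ⊎ n ≡ suc (i + i)) → Half n
      back e (i , inj₁ refl) = inj₁ (i , refl , trans (sym (⊞-even q r i)) e)
      back e (i , inj₂ refl) = inj₂ (i , refl , trans (sym (⊞-odd q r i)) e)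

  ⊞-lub : ∀ {q r c} → q ≤T c → r ≤T c → q ⊞ r ≤T c
  ⊞-lub {q} {r} h h' .member = S1-iff (λ ρ → half-⊞ q r true _)
    (∃' (at (v1 ≐ (v0 ⊕ v0)) & ren (member h) (v0 ∷ [])) ∣∣ ∃' (at (v1 ≐ succ (v0 ⊕ v0)) & ren (member h') (v0 ∷ [])))
  ⊞-lub {q} {r} h h' .absent = S1-iff (λ ρ → half-⊞ q r false _)
    (∃' (at (v1 ≐ (v0 ⊕ v0)) & ren (absent h) (v0 ∷ [])) ∣∣ ∃' (at (v1 ≐ succ (v0 ⊕ v0)) & ren (absent h') (v0 ∷ [])))

  -- Mix q t s: the string s is an initial segment of q ⊞ r for every r extending t.
  Mix : SubsetOfω → ℕ → ℕ → Set
  Mix q t s =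
      (∀ n → BT s n → (∃ λ i → n ≡ i + i × q i ≡ true) ⊎ (∃ λ i → n ≡ suc (i + i) × BT t i))
    × (∀ n → BF s n → (∃ λ i → n ≡ i + i × q i ≡ false) ⊎ (∃ λ i → n ≡ suc (i + i) × BF t i))

  Mix' : ∀ {q k} (t s : Term k) → S1 q (λ ρ → Mix q (evalT ρ t) (evalT ρ s))
  Mix' t s = ren
    ( allT v1 (∃' (at (v1 ≐ (v0 ⊕ v0)) & at (inX v0)) ∣∣ ∃' (at (v1 ≐ succ (v0 ⊕ v0)) & BT' v2 v0))
    & allF v1 (∃' (at (v1 ≐ (v0 ⊕ v0)) & ren (absent ≤T-refl) (v0 ∷ [])) ∣∣ ∃' (at (v1 ≐ succ (v0 ⊕ v0)) & BF' v2 v0)))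
    (t ∷ s ∷ [])

  Mix-⊏ : ∀ {q r t s} → Mix q t s → t ⊏ r → s ⊏ q ⊞ r
  Mix-⊏ {q} {r} (T , F) (T' , F') =
      (λ n e → proj₁ (half-⊞ q r true n) (Sum.map₂ (λ (i , e , b) → i , e , T' i b) (T n e)))
    , (λ n e → proj₁ (half-⊞ q r false n) (Sum.map₂ (λ (i , e , b) → i , e , F' i b) (F n e)))

  ⊏-Mix : ∀ {q r s} → s ⊏ q ⊞ r → Mix q (pref r (len s)) s
  ⊏-Mix {q} {r} {s} (T , F) =
      (λ n e → Sum.map₂ (λ (i , e' , b) → i , e' , pref-BT r (len s) i (lt i e' (BT-< e)) b) (proj₂ (half-⊞ q r true n) (T n e)))
    , (λ n e → Sum.map₂ (λ (i , e' , b) → i , e' , pref-BF r (len s) i (lt i e' (BF-< e)) b) (proj₂ (half-⊞ q r false n) (F n e)))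
    where
    lt : ∀ {n ℓ} i → n ≡ suc (i + i) → n < ℓ → i < ℓ
    lt i refl l = ≤-<-trans (≤-trans (m≤m+n i i) (n≤1+n _)) l

  -- The open class of those r for which e belongs to the jump of q ⊞ r.
  JO : SubsetOfω → ℕ → ℕ → Set
  JO q e t = ∃ λ s → Mix q t s × U e s

  JO' : ∀ {q k} (e t : Term k) → S1 q (λ ρ → JO q (evalT ρ e) (evalT ρ t))
  JO' e t = ren (∃' (Mix' v2 v0 & U' v1 v0)) (e ∷ t ∷ [])

  Meets : (ℕ → Set) → SubsetOfω → Set
  Meets O r = ∃ λ t → t ⊏ r × O t

  JP-JO : ∀ q r e → JP (q ⊞ r) e iff Meets (JO q e) r
  JP-JO q r e = (λ (s , h , u) → pref r (len s) , pref-⊏ r (len s) , s , ⊏-Mix h , u)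
              , (λ (t , h , s , m , u) → s , Mix-⊏ m h , u)

  -- H q m P: the predicate P is Σ⁰₍ₘ₊₁₎ relative to q.
  data H (q : SubsetOfω) : ℕ → ∀ {k} → (Env k → Set) → Set₁ where
    σ₁   : ∀ {k} {P : Env k → Set} → S1 q P → H q 0 P
    hneg : ∀ {m k} {P Q : Env k → Set} → H q m Q → (∀ ρ → P ρ iff ¬ Q ρ) → H q (suc m) P
    hex  : ∀ {m k} {P : Env k → Set} {Q : Env (suc k) → Set} → H q (suc m) Q →
      (∀ ρ → P ρ iff ∃ λ y → Q (extend y ρ)) → H q (suc m) P

  -- In the base case a Σ⁰₁(`jump q`) fact is certified by a string s that is a prefix of the jump:
  -- its ones are a Σ⁰₁(q) matter and its zeros a Π⁰₁(q) one. Pulling out s and the witness t leaves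
  -- a Π⁰₁(q) kernel.
  H-jump : ∀ {q m k} {P : Env k → Set} → H (jump q) m P → H q (suc m) P
  H-jump (hneg h e) = hneg (H-jump h) e
  H-jump (hex h e)  = hex (H-jump h) e
  H-jump {q} {k = k} {P} (σ₁ p) = hex {Q = λ ρ → ∃ λ t → ¬ R (extend t ρ)}
      (hex {Q = λ ρ → ¬ R ρ} (hneg (σ₁ R') (λ ρ → (λ x → x) , (λ x → x))) (λ ρ → (λ x → x) , (λ x → x)))
      (λ ρ → to ρ , from ρ)
    where
    open FiniteUse (finite-use p)
    W : Env (suc k) → Set
    W ρ = (∀ i → BT (ρ #0) i → JP q i) × Use (ρ #0) (λ i → ρ (suc i))
    W' : S1 q W
    W' = allT v0 (JP' v0) & use'
    V : ℕ → Set
    V s = ∃ λ i → BF s i × JP q i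
    V' : S1 q {suc (suc k)} (λ ρ → V (ρ #1))
    V' = ∃' (BF' v2 v0 & JP' v0)
    δ = proj₁ W'
    R : Env (suc (suc k)) → Set
    R ρ = ¬ satΔ q ρ δ ⊎ V (ρ #1)
    R' : S1 q R
    R' = at (neg δ) ∣∣ V'
    to : ∀ ρ → P ρ → ∃ λ s → ∃ λ t → ¬ R (extend t (extend s ρ))
    to ρ x = let (ℓ , u) = total ρ x ; s = pref (jump q) ℓ ; (T , F) = pref-⊏ (jump q) ℓ
                 (t , z) = proj₁ (proj₂ W' (extend s ρ)) ((λ i b → proj₁ ⌊⌋-true (T i b)) , u) in
      s , t , Sum.[ (λ n → n z) , (λ (i , b , j) → proj₁ ⌊⌋-false (F i b) j) ]
    from : ∀ ρ → (∃ λ s → ∃ λ t → ¬ R (extend t (extend s ρ))) → P ρ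
    from ρ (s , t , n) = let (T , u) = proj₂ (proj₂ W' (extend s ρ)) (t , dne (λ m → n (inj₁ m))) in
      sound ρ s ((λ i b → proj₂ ⌊⌋-true (T i b)) , (λ i b → proj₂ ⌊⌋-false (λ j → n (inj₂ (i , b , j))))) u

  negΣ : ∀ {m k} → SigmaF m k → PiF m k
  negΠ : ∀ {m k} → PiF m k → SigmaF m k
  negΣ (bnd φ)  = bnd (neg φ)
  negΣ (base φ) = base (negΠ φ)
  negΣ (ex φ)   = all (negΣ φ)
  negΠ (bnd φ)  = bnd (neg φ)
  negΠ (base φ) = base (negΣ φ)
  negΠ (all φ)  = ex (negΠ φ)

  sat-negΣ : ∀ {G m k} (φ : SigmaF m k) ρ → satΠ G ρ (negΣ φ) iff ¬ satΣ G ρ φ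
  sat-negΠ : ∀ {G m k} (φ : PiF m k) ρ → satΣ G ρ (negΠ φ) iff ¬ satΠ G ρ φ
  sat-negΣ (bnd φ)  ρ = (λ x → x) , (λ x → x)
  sat-negΣ (base φ) ρ = sat-negΠ φ ρ
  sat-negΣ (ex φ)   ρ = (λ f (y , x) → proj₁ (sat-negΣ φ _) (f y) x)
                      , (λ n y → proj₂ (sat-negΣ φ _) (λ x → n (y , x)))
  sat-negΠ (bnd φ)  ρ = (λ x → x) , (λ x → x)
  sat-negΠ (base φ) ρ = sat-negΣ φ ρ
  sat-negΠ (all φ)  ρ = (λ (y , x) f → proj₁ (sat-negΠ φ _) x (f y))
                      , (λ n → dne λ m → n λ y → dne λ k → m (y , proj₂ (sat-negΠ φ _) k))

  H-formula : ∀ {q m k} {P : Env k → Set} → H q m P → Σ (SigmaF (suc m) k) λ φ → ∀ ρ → P ρ iff satΣ q ρ φ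
  H-formula (σ₁ (δ , d)) = ex (base (bnd δ)) , d
  H-formula (hneg h e)   = let (φ , s) = H-formula h in base (negΣ φ) , λ ρ →
    iff-trans (e ρ) (iff-trans ((λ n x → n (proj₂ (s ρ) x)) , (λ n x → n (proj₁ (s ρ) x))) (iff-sym (sat-negΣ φ ρ)))
  H-formula (hex h e)    = let (φ , s) = H-formula h in ex φ , λ ρ →
    iff-trans (e ρ) ((λ (y , x) → y , proj₁ (s _) x) , (λ (y , x) → y , proj₂ (s _) x))

  module Avoid (B : SubsetOfω) where

    Σ₁B : SubsetOfω → Set
    Σ₁B q = S1 q {1} (λ ρ → B (ρ #0) ≡ true)

    -- Phrased through iterated jumps so that passing from q to a set computable from `jump q` costs
    -- exactly one level.
    NS : ℕ → SubsetOfω → Set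
    NS zero    q = ¬ Σ₁B q
    NS (suc m) q = NS m (jump q)

    NS-≤T : ∀ m {a b} → a ≤T b → NS m b → NS m a
    NS-≤T zero    h n p = n (S1-≤T h p)
    NS-≤T (suc m) h n   = NS-≤T m (jump-≤T h) n

    NS-H : ∀ m q → ¬ H q m {1} (λ ρ → B (ρ #0) ≡ true) → NS m q
    NS-H zero    q n p = n (σ₁ p)
    NS-H (suc m) q n   = NS-H m (jump q) λ h → n (H-jump h)

    NS-∅ : ∀ n → ¬ IsSigma⁰-plain (suc n) B → NS n ∅
    NS-∅ n ns = NS-H n ∅ λ h → let (φ , s) = H-formula h in ns (φ , λ x → s (single x))

-- Compactness and basis theorems

module BasisTheorems (em : ExcludedMiddle 0ℓ) where
  open Strings em
  open Queries em
  open UniversalSet em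
  open Degrees em
  open _≤T_

  -- Compactness of Cantor space

  Cov : (ℕ → Set) → Set
  Cov Bad = ∃ λ ℓ → ∀ s → len s ≡ ℓ → ∃ λ t → t ⊑ s × Bad t

  Cov-map : ∀ {P Q : ℕ → Set} → (∀ t → P t → Q t) → Cov P → Cov Q
  Cov-map f (ℓ , h) = ℓ , λ s e → let (t , l , p) = h s e in t , l , f t p

  Cov-Meets : ∀ {Bad} → Cov Bad → ∀ r → Meets Bad r
  Cov-Meets (ℓ , h) r = let (t , l , b) = h (pref r ℓ) (pref-len r ℓ) in t , ⊑-⊏ l (pref-⊏ r ℓ) , b

  -- Effective compactness: that a Σ⁰₁ open class is all of Cantor space is again Σ⁰₁, since
  -- quantifying over the strings of one length is a bounded quantification. All complexity bounds
  -- for covering questions rest on this.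
  Cov' : ∀ {q k} {P : Env (suc k) → Set} → S1 q P → S1 q (λ ρ → Cov (λ t → P (extend t ρ)))
  Cov' {q} {k} {P} p = S1-iff (λ ρ →
      (λ (ℓ , h) → ℓ , λ s e → shift (eq ρ ℓ s) (h s e))
    , (λ (ℓ , h) → ℓ , λ s e → shift (λ t i → sym (eq ρ ℓ s t i)) (h s e)))
    (∃' (allS {P = Hit} v0 (λ {ρ} → ext {ρ}) (∃' (⊑' v0 v1 & renf p θ))))
    where
    θ : Fin (suc k) → Term (suc (suc (suc k)))
    θ zero    = v0
    θ (suc i) = var (suc (suc (suc i)))
    Hit : Env (suc (suc k)) → Set
    Hit ρ = ∃ λ t → t ⊑ ρ #0 × P (λ i → evalT (extend t ρ) (θ i))
    eq : ∀ ρ ℓ s t i → evalT (extend t (extend s (extend ℓ ρ))) (θ i) ≡ extend t ρ i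
    eq ρ ℓ s t zero    = refl
    eq ρ ℓ s t (suc i) = refl
    shift : ∀ {s} {f g : ℕ → Env (suc k)} → (∀ t i → f t i ≡ g t i) →
      (∃ λ t → t ⊑ s × P (f t)) → ∃ λ t → t ⊑ s × P (g t)
    shift h (t , l , x) = t , l , S1-ext p (h t) x
    ext : ∀ {ρ s s'} → s ≋ s' → Hit (extend s ρ) → Hit (extend s' ρ)
    ext {ρ} {s} {s'} (a , _) (t , l , x) = t , ⊑-trans l a ,
      S1-ext p {λ i → evalT (extend t (extend s ρ)) (θ i)} (λ { zero → refl ; (suc i) → refl }) x

  -- `D ℓ f` is to be read as "f is dead by level ℓ", a property of its first ℓ bits.
  record Tree (D : ℕ → SubsetOfω → Set) : Set where
    field
      grow  : ∀ {ℓ ℓ' f} → ℓ ≤ ℓ' → D ℓ f → D ℓ' f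
      local : ∀ {ℓ f g} → (∀ i → i < ℓ → f i ≡ g i) → D ℓ f → D ℓ g
  open Tree

  cons : Bool → SubsetOfω → SubsetOfω
  cons b f zero    = b
  cons b f (suc i) = f i

  Below : Bool → (ℕ → SubsetOfω → Set) → ℕ → SubsetOfω → Set
  Below b D ℓ f = D (suc ℓ) (cons b f)

  Below-tree : ∀ {D} → Tree D → ∀ b → Tree (Below b D)
  Below-tree T b .grow l = grow T (s≤s l)
  Below-tree T b .local h = local T λ { zero _ → refl ; (suc i) (s≤s l) → h i l }

  Escapes : (ℕ → SubsetOfω → Set) → Set
  Escapes D = ∀ ℓ → ∃ λ f → ¬ D ℓ f

  -- The step of König's lemma: if the two halves were entirely dead by levels ℓ and ℓ', everything
  -- would be dead by level 1 + (ℓ ⊔ ℓ').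
  escape-branch : ∀ {D} → Tree D → Escapes D → ∃ λ b → Escapes (Below b D)
  escape-branch {D} T esc with em {Escapes (Below true D)} | em {Escapes (Below false D)}
  ... | yes e | _     = true , e
  ... | no _  | yes e = false , e
  ... | no n  | no n' = ⊥-elim (n λ ℓ → dne λ m → n' λ ℓ' → dne λ m' → clash ℓ ℓ' m m')
    where
    clash : ∀ ℓ ℓ' → ¬ (∃ λ f → ¬ Below true D ℓ f) → ¬ (∃ λ f → ¬ Below false D ℓ' f) → ⊥
    clash ℓ ℓ' m m' with esc (suc (ℓ ⊔ ℓ'))
    ... | f , nd with f zero in eq
    ...   | true  = m ((λ i → f (suc i)) , λ d → nd (local T (λ { zero _ → sym eq ; (suc i) _ → refl })
                      (grow T (s≤s (m≤m⊔n ℓ ℓ')) d)))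
    ...   | false = m' ((λ i → f (suc i)) , λ d → nd (local T (λ { zero _ → sym eq ; (suc i) _ → refl })
                      (grow T (s≤s (m≤n⊔m ℓ ℓ')) d)))

  branch : ∀ {D} → Tree D → Escapes D → SubsetOfω
  branch T esc zero    = proj₁ (escape-branch T esc)
  branch T esc (suc i) = branch (Below-tree T _) (proj₂ (escape-branch T esc)) i

  branch-escapes : ∀ {D} (T : Tree D) (esc : Escapes D) ℓ → ¬ D ℓ (branch T esc)
  branch-escapes T esc zero d = proj₂ (esc 0) (local T (λ _ ()) d)
  branch-escapes T esc (suc ℓ) d = branch-escapes (Below-tree T _) (proj₂ (escape-branch T esc)) ℓ
    (local T (λ { zero _ → refl ; (suc i) _ → refl }) d)

  abstract
    chain-compact : (Bads : ℕ → ℕ → Set) → (∀ {m n t} → m ≤ n → Bads m t → Bads n t) →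
      (∀ n → ¬ Cov (Bads n)) → ∃ λ r → ∀ n → ¬ Meets (Bads n) r
    chain-compact Bads mono nc = branch T esc , λ n (t , h , b) → branch-escapes T esc (n ⊔ len t)
        (t , h , m≤n⊔m n (len t) , mono (m≤m⊔n n (len t)) b)
      where
      -- The level bounds both the stage and the length of t; the second bound makes D depend on ℓ
      -- bits only.
      D : ℕ → SubsetOfω → Set
      D ℓ f = ∃ λ t → t ⊏ f × len t ≤ ℓ × Bads ℓ t
      T : Tree D
      T .grow l (t , h , l' , b) = t , h , ≤-trans l' l , mono l b
      T .local h (t , (a , b) , l , x) = t , ((λ i e → trans (sym (h i (<-≤-trans (BT-< e) l))) (a i e))
                                            , (λ i e → trans (sym (h i (<-≤-trans (BF-< e) l))) (b i e))) , l , x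
      esc : Escapes D
      esc ℓ = dne λ m → nc ℓ (ℓ , λ s e → let (t , h , l , b) = dne {D ℓ (bitFun s)} (λ n → m (bitFun s , n)) in
        t , ⊏-⊑ h (⊏-bitFun s) (subst (len t ≤_) (sym e) l) , b)

  compact : (Bad : ℕ → Set) → ¬ Cov Bad → ∃ λ r → ¬ Meets Bad r
  compact Bad nc = let (r , h) = chain-compact (λ _ → Bad) (λ _ b → b) (λ _ → nc) in r , h 0

  Ban : (ℕ → ℕ → Set) → SubsetOfω → ℕ → ℕ → Set
  Ban O g n t = ∃ λ i → i < n × g i ≡ false × O i t

  -- The open classes O 0, O 1, … are avoided in turn whenever this is still possible; j records the choices.
  record GreedyAvoidance (q : SubsetOfω) (O : ℕ → ℕ → Set) : Set where
    field
      r j     : SubsetOfω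
      decided : ∀ e → j e ≡ true iff Meets (O e) r
      forced  : ∀ e → j e ≡ true → Cov (λ t → Ban O j e t ⊎ O e t)
      j≤T     : j ≤T jump q

  module Greedy (q : SubsetOfω) (O : ℕ → ℕ → Set) (O' : S1 q {2} (λ ρ → O (ρ #0) (ρ #1))) where

    K : SubsetOfω → ℕ → Set
    K g e = Cov (λ t → Ban O g e t ⊎ O e t)

    K-local : ∀ {g h} e → (∀ i → i < e → g i ≡ h i) → K g e → K h e
    K-local e eq = Cov-map λ t → Sum.map₁ λ (i , l , f , o) → i , l , trans (sym (eq i l)) f , o

    -- `K` takes the earlier bits in the form of a set, so j is obtained from approximating sets;
    -- stage e is final below e.
    stages : ℕ → SubsetOfω
    stages zero    i = false
    stages (suc e) i = if does (i ≟ e) then ⌊ K (stages e) e ⌋ else stages e i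

    j : SubsetOfω
    j e = stages (suc e) e

    step-new : ∀ e → stages (suc e) e ≡ ⌊ K (stages e) e ⌋
    step-new e rewrite dec-true (e ≟ e) refl = refl

    step-old : ∀ e i → i < e → stages e i ≡ j i
    step-old (suc e) i l with i ≟ e
    ... | yes refl = refl
    ... | no ne rewrite dec-false (i ≟ e) ne = step-old e i (≤∧≢⇒< (≤-pred l) ne)

    j-spec : ∀ e → j e ≡ true iff K j e
    j-spec e = (λ t → K-local e (step-old e) (proj₁ ⌊⌋-true (trans (sym (step-new e)) t)))
             , (λ k → trans (step-new e) (proj₂ ⌊⌋-true (K-local e (λ i l → sym (step-old e i l)) k)))

    -- Class n is banned only if it does not complete a cover together with the classes banned
    -- before it.
    not-covered : ∀ n → ¬ Cov (Ban O j n)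
    not-covered zero (ℓ , h) with h (pref ∅ ℓ) (pref-len ∅ ℓ)
    ... | _ , _ , _ , () , _
    not-covered (suc n) c with j n in eq
    ... | true  = not-covered n (Cov-map (λ t (i , l , f , o) → i , ≤∧≢⇒< (≤-pred l)
        (λ { refl → contradiction (trans (sym eq) f) λ () }) , f , o) c)
    ... | false = contradiction (trans (sym (proj₂ (j-spec n) (Cov-map split c))) eq) λ ()
      where
      split : ∀ t → Ban O j (suc n) t → Ban O j n t ⊎ O n t
      split t (i , l , f , o) with m≤n⇒m<n∨m≡n (≤-pred l)
      ... | inj₁ l'   = inj₁ (i , l' , f , o)
      ... | inj₂ refl = inj₂ o

    private
      limit : ∃ λ r → ∀ n → ¬ Meets (Ban O j n) r
      limit = chain-compact (Ban O j) (λ l (i , l' , x) → i , ≤-trans l' l , x) not-covered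

    r : SubsetOfω
    r = proj₁ limit

    avoids : ∀ n → ¬ Meets (Ban O j n) r
    avoids = proj₂ limit

    decided : ∀ e → j e ≡ true iff Meets (O e) r
    decided e = to , from
      where
      to : j e ≡ true → Meets (O e) r
      to t with Cov-Meets (proj₁ (j-spec e) t) r
      ... | s , h , inj₁ b = ⊥-elim (avoids e (s , h , b))
      ... | s , h , inj₂ o = s , h , o
      from : Meets (O e) r → j e ≡ true
      from (s , h , o) with j e in eq
      ... | true  = refl
      ... | false = ⊥-elim (avoids (suc e) (s , h , e , ≤-refl , eq , o))

    private
      BanS : ℕ → ℕ → ℕ → Set
      BanS v n t = ∃ λ i → i < n × BF v i × O i t

      KS : ℕ → ℕ → Set
      KS v e = Cov (λ t → BanS v e t ⊎ O e t)

      KS' : S1 q {2} (λ ρ → KS (ρ #0) (ρ #1))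
      KS' = Cov' (∃' (at (v0 ≺ v3) & BF' v2 v0 & ren O' (v0 ∷ v1 ∷ [])) ∣∣ ren O' (v2 ∷ v0 ∷ []))

      -- Each bit answers the covering question posed relative to the preceding bits of the same
      -- string. Only initial segments of j are correct, and the questions are Σ⁰₁(q), so the jump
      -- of q can recognise them and thereby compute j.
      Correct : ℕ → Set
      Correct v = (∀ i → BT v i → KS v i) × (∀ i → BF v i → ¬ KS v i)

      KS-K : ∀ {v} e → (∀ i → i < e → BF v i iff j i ≡ false) → KS v e iff K j e
      KS-K e h = Cov-map (λ t → Sum.map₁ λ (i , l , f , o) → i , l , proj₁ (h i l) f , o)
               , Cov-map (λ t → Sum.map₁ λ (i , l , f , o) → i , l , proj₂ (h i l) f , o)

      bits : ∀ {v} → v ⊏ j → ∀ i → i < len v → BF v i iff j i ≡ false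
      bits h i l = proj₂ h i , ⊏-BF h l

      correct-bits : ∀ v → Correct v → ∀ n → n ≤ len v → ∀ i → i < n → BF v i iff j i ≡ false
      correct-bits v (T , F) (suc n) l i li with m≤n⇒m<n∨m≡n (≤-pred li)
      ... | inj₁ l' = correct-bits v (T , F) n (<⇒≤ l) i l'
      ... | inj₂ refl = (λ f → proj₁ ≢true λ t → F i f (proj₂ eq (proj₁ (j-spec i) t)))
                      , (λ f → Sum.[ (λ t → contradiction (trans (sym (proj₂ (j-spec i) (proj₁ eq (T i t)))) f) λ ())
                                   , (λ x → x) ] (BT⊎BF v i l))
        where
        eq : KS v i iff K j i
        eq = KS-K i (correct-bits v (T , F) n (<⇒≤ l))

      pref-correct : ∀ ℓ → Correct (pref j ℓ)
      pref-correct ℓ =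
          (λ i t → proj₂ (eq i (BT-< t)) (proj₁ (j-spec i) (proj₁ h i t)))
        , (λ i f k → contradiction (trans (sym (proj₂ (j-spec i) (proj₁ (eq i (BF-< f)) k))) (proj₂ h i f)) λ ())
        where
        h = pref-⊏ j ℓ
        eq : ∀ i → i < len (pref j ℓ) → KS (pref j ℓ) i iff K j i
        eq i l = KS-K i λ i' l' → bits h i' (<-trans l' l)

      Correct' : S1 (jump q) {1} (λ ρ → Correct (ρ #0))
      Correct' = allT v0 (ren (jump⁺ KS') (v1 ∷ v0 ∷ [])) & allF v0 (ren (jump⁻ KS') (v1 ∷ v0 ∷ []))

      at-end : ∀ v → Correct v → KS v (len v) iff j (len v) ≡ true
      at-end v c = iff-trans (KS-K (len v) (correct-bits v c (len v) ≤-refl)) (iff-sym (j-spec (len v)))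

    j≤T : j ≤T jump q
    j≤T .member = S1-iff (λ ρ →
        (λ (v , e , c , k) → subst (λ z → j z ≡ true) e (proj₁ (at-end v c) (subst (KS v) (sym e) k)))
      , (λ t → pref j (ρ #0) , pref-len j (ρ #0) , pref-correct (ρ #0) ,
          subst (KS _) (pref-len j (ρ #0)) (proj₂ (at-end _ (pref-correct (ρ #0)))
            (subst (λ z → j z ≡ true) (sym (pref-len j (ρ #0))) t))))
      (∃' (len' v0 v1 & ren Correct' (v0 ∷ []) & ren (jump⁺ KS') (v0 ∷ v1 ∷ [])))
    j≤T .absent = S1-iff (λ ρ →
        (λ (v , e , c , n) → subst (λ z → j z ≡ false) e
          (proj₁ ≢true λ t → n (subst (KS v) e (proj₂ (at-end v c) t))))
      , (λ f → pref j (ρ #0) , pref-len j (ρ #0) , pref-correct (ρ #0) ,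
          λ k → contradiction (trans (sym (proj₁ (at-end _ (pref-correct (ρ #0)))
                 (subst (KS _) (sym (pref-len j (ρ #0))) k)))
               (subst (λ z → j z ≡ false) (sym (pref-len j (ρ #0))) f)) λ ()))
      (∃' (len' v0 v1 & ren Correct' (v0 ∷ []) & ren (jump⁻ KS') (v0 ∷ v1 ∷ [])))

  abstract
    greedy : ∀ q (O : ℕ → ℕ → Set) → S1 q {2} (λ ρ → O (ρ #0) (ρ #1)) → GreedyAvoidance q O
    greedy q O O' = record { Greedy q O O' ; forced = λ e → proj₁ (Greedy.j-spec q O O' e) }

  module Basis (B : SubsetOfω) where
    open Avoid B

    -- The low basis theorem. Class 0 is `Bad`, avoided since nothing precedes it and it does not
    -- cover; class e + 1 puts e into the jump of `q ⊞ r`. Hence j, shifted by one, is that jump.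
    module Low (q : SubsetOfω) {Bad : ℕ → Set} (Bad' : S1 q {1} (λ ρ → Bad (ρ #0))) (nc : ¬ Cov Bad) where

      O : ℕ → ℕ → Set
      O i t = i ≡ 0 × Bad t ⊎ ∃ λ e → i ≡ suc e × JO q e t

      O' : S1 q {2} (λ ρ → O (ρ #0) (ρ #1))
      O' = at (v0 ≐ zer) & ren Bad' (v1 ∷ []) ∣∣ ∃' (at (v1 ≐ succ v0) & JO' v0 v2)

      open GreedyAvoidance (greedy q O O')
        using (r; j; decided; forced; j≤T) public

      avoid-Bad : ¬ Meets Bad r
      avoid-Bad (t , h , b) = nc (Cov-map strip (forced 0 (proj₂ (decided 0) (t , h , inj₁ (refl , b)))))
        where
        strip : ∀ t → Ban O j 0 t ⊎ O 0 t → Bad t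
        strip t (inj₁ (_ , () , _))
        strip t (inj₂ (inj₁ (_ , b))) = b
        strip t (inj₂ (inj₂ (_ , () , _)))

      jump-r : ∀ e → jump (q ⊞ r) e ≡ true iff j (suc e) ≡ true
      jump-r e = iff-trans ⌊⌋-true (iff-trans (JP-JO q r e) (iff-trans
          ((λ (t , h , o) → t , h , inj₂ (e , refl , o)) , λ { (t , h , inj₂ (_ , refl , o)) → t , h , o })
          (iff-sym (decided (suc e)))))

      low : jump (q ⊞ r) ≤T jump q
      low = ≤T-trans shift j≤T
        where
        shift : jump (q ⊞ r) ≤T j
        shift .member = S1-iff (λ ρ → iff-sym (jump-r (ρ #0))) (at (inX (succ v0)))
        shift .absent = S1-iff (λ ρ → iff-trans ((λ n t → n (proj₁ (jump-r (ρ #0)) t)) ,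
          (λ n t → n (proj₂ (jump-r (ρ #0)) t))) ≢true) (at (neg (inX (succ v0))))

    module Preserve (q : SubsetOfω) {Bad : ℕ → Set} (Bad' : S1 q {1} (λ ρ → Bad (ρ #0)))
                    (nc : ¬ Cov Bad) (ns : ¬ Σ₁B q) where

      Banned : List ℕ → ℕ → Set
      Banned L t = Bad t ⊎ ∃ λ i → i ∈ₗ L × JO q i t

      mem' : ∀ L → S1 q {1} (λ ρ → ρ #0 ∈ₗ L)
      mem' []      = S1-iff (λ ρ → (λ n → ⊥-elim (n refl)) , λ ()) (at (neg (zer ≐ zer)))
      mem' (x ∷ L) = S1-iff (λ ρ → Sum.[ (λ e → here (trans e (eval-num ρ x))) , there ]
          , λ { (here e) → inj₁ (trans e (sym (eval-num ρ x))) ; (there m) → inj₂ m })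
        (at (v0 ≐ num x) ∣∣ mem' L)

      Banned' : ∀ L → S1 q {1} (λ ρ → Banned L (ρ #0))
      Banned' L = Bad' ∣∣ ∃' (ren (mem' L) (v0 ∷ []) & JO' v0 v1)

      JO-at : ∀ e → S1 q {2} (λ ρ → JO q (pr e (ρ #1)) (ρ #0))
      JO-at e = S1-iff (λ ρ → subst (J₀ ρ) (eval-num ρ e) , subst (J₀ ρ) (sym (eval-num ρ e)))
        (JO' (prT (num e) v1) v0)
        where
        J₀ : Env 2 → ℕ → Set
        J₀ ρ c = JO q (pr c (ρ #1)) (ρ #0)

      cov' : ∀ L e → S1 q {1} (λ ρ → Cov (λ t → Banned L t ⊎ JO q (pr e (ρ #0)) t))
      cov' L e = Cov' (ren (Banned' L) (v0 ∷ []) ∣∣ JO-at e)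

      Settled : ℕ → List ℕ → Set
      Settled e L = ∃ λ x → B x ≡ true × pr e x ∈ₗ L ⊎ B x ≢ true × Cov (λ t → Banned L t ⊎ JO q (pr e x) t)

      OK : List ℕ → Set
      OK L = ¬ Cov (Banned L)

      -- Either some x in B can be kept out of the e-th enumeration by a further ban, or some x
      -- outside B is forced into it. If neither were possible, B would be the set of all x forced
      -- by a cover, which is Σ⁰₁(q).
      settle : ∀ e L → OK L → ∃ λ L' → OK L' × Settled e L' × (∀ i → i ∈ₗ L → i ∈ₗ L')
      settle e L ok with em {∃ λ x → B x ≡ true × ¬ Cov (λ t → Banned L t ⊎ JO q (pr e x) t)}
      ... | yes (x , b , n) = pr e x ∷ L ,
          (λ c → n (Cov-map (λ { t (inj₁ z) → inj₁ (inj₁ z)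
                               ; t (inj₂ (_ , here refl , o)) → inj₂ o
                               ; t (inj₂ (i , there m , o)) → inj₁ (inj₂ (i , m , o)) }) c)) ,
          (x , inj₁ (b , here refl)) , λ i → there
      ... | no ne = L , ok , dne (λ ns' → ns (S1-iff (λ ρ → to ns' (ρ #0) , from (ρ #0)) (cov' L e))) , λ i m → m
        where
        C : ℕ → Set
        C x = Cov (λ t → Banned L t ⊎ JO q (pr e x) t)
        to : ¬ Settled e L → ∀ x → C x → B x ≡ true
        to ns' x c = dne λ n → ns' (x , inj₂ (n , c))
        from : ∀ x → B x ≡ true → C x
        from x b = dne λ n → ne (x , b , n)

      state : ℕ → Σ (List ℕ) OK
      state zero    = [] , λ c → nc (Cov-map (λ { t (inj₁ b) → b ; t (inj₂ (_ , () , _)) }) c)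
      state (suc e) = let (L , ok) = state e ; (L' , ok' , _) = settle e L ok in L' , ok'

      Ls : ℕ → List ℕ
      Ls e = proj₁ (state e)

      Ls-mono : ∀ {m n} i → m ≤ n → i ∈ₗ Ls m → i ∈ₗ Ls n
      Ls-mono {m} {zero} i z≤n x = x
      Ls-mono {m} {suc n} i l x with m≤n⇒m<n∨m≡n l
      ... | inj₂ refl = x
      ... | inj₁ l' = let (L , ok) = state n in proj₂ (proj₂ (proj₂ (settle n L ok))) i (Ls-mono i (≤-pred l') x)

      limit : ∃ λ r → ∀ n → ¬ Meets (Banned (Ls n)) r
      limit = chain-compact (λ n → Banned (Ls n)) (λ l → Sum.map₂ λ (i , m , o) → i , Ls-mono i l m , o) (λ n → proj₂ (state n))

      r : SubsetOfω
      r = proj₁ limit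

      avoid-Bad : ¬ Meets Bad r
      avoid-Bad (t , h , b) = proj₂ limit 0 (t , h , inj₁ b)

      not-enumerated : ∀ c → ¬ (∀ x → B x ≡ true iff Meets (JO q (pr c x)) r)
      not-enumerated c spec = clash (let (L , ok) = state c in proj₁ (proj₂ (proj₂ (settle c L ok))))
        where
        last : ∀ x → B x ≢ true → ¬ Meets (λ t → Banned (Ls (suc c)) t ⊎ JO q (pr c x) t) r
        last x n (t , h , inj₁ z) = proj₂ limit (suc c) (t , h , z)
        last x n (t , h , inj₂ o) = n (proj₂ (spec x) (t , h , o))
        clash : Settled c (Ls (suc c)) → ⊥
        clash (x , inj₁ (b , m)) = let (t , h , o) = proj₁ (spec x) b in proj₂ limit (suc c) (t , h , inj₂ (_ , m , o))
        clash (x , inj₂ (n , cov)) = last x n (Cov-Meets cov r)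

      preserved : ¬ Σ₁B (q ⊞ r)
      preserved p = let (c , spec) = enumerate₁ p in
        not-enumerated c λ x → iff-trans (spec x) (JP-JO q r (pr c x))

    -- At level 0 the non-enumerability of B must be preserved by hand; at higher levels only the
    -- jump of `q ⊞ r` matters, so lowness suffices.
    basis : ∀ m q {Bad : ℕ → Set} → S1 q {1} (λ ρ → Bad (ρ #0)) → ¬ Cov Bad → NS m q →
      ∃ λ r → ¬ Meets Bad r × NS m (q ⊞ r)
    basis zero    q Bad' nc ns = r , avoid-Bad , preserved
      where open Preserve q Bad' nc ns
    basis (suc m) q Bad' nc ns = r , avoid-Bad , NS-≤T m low ns
      where open Low q Bad' nc

-- Partition regular classes and splitting columns

module Strata (em : ExcludedMiddle 0ℓ) where
  open Strings em
  open Queries em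
  open UniversalSet em
  open Degrees em
  open BasisTheorems em
  open _≤T_

  infix 4 _◂_
  -- Q presents an open class closed under supersets: Z belongs to it as soon as Z includes one of
  -- the finite sets s with `Q s`.
  _◂_ : SubsetOfω → (ℕ → Set) → Set
  Z ◂ Q = ∃ λ s → s ⊂ Z × Q s

  ◂-⊆ : ∀ {Z Z' Q} → Z ⊆ Z' → Z ◂ Q → Z' ◂ Q
  ◂-⊆ h (s , l , x) = s , (λ i b → h i (l i b)) , x

  ◂-map : ∀ {Z} {P Q : ℕ → Set} → (∀ s → P s → Q s) → Z ◂ P → Z ◂ Q
  ◂-map f (s , l , x) = s , l , f s x

  full : SubsetOfω
  full _ = true

  ε : ℕ
  ε = pref ∅ 0

  ε-⊂ : ∀ {Z} → ε ⊂ Z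
  ε-⊂ i t = ⊥-elim (n≮0 (subst (i <_) (pref-len ∅ 0) (BT-< t)))

  pref-⊂ : ∀ Z ℓ → pref Z ℓ ⊂ Z
  pref-⊂ Z ℓ = proj₁ (pref-⊏ Z ℓ)

  -- 𝒱 is an intersection of Σ⁰₁(p) open classes over a merely Π⁰₁(p) set of indices a. The second
  -- index ℓ is a lower bound for elements in the ground stratum, and in later ones the length of
  -- the initial segment of u that selects an element of the ultrafilter.
  record Stratum (p : SubsetOfω) : Set₁ where
    field
      Cls  : ℕ → ℕ → ℕ → Set
      Cls' : S1 p {3} (λ ρ → Cls (ρ #0) (ρ #1) (ρ #2))
      On   : ℕ → Set
      Off' : S1 p {1} (λ ρ → ¬ On (ρ #0))

    𝒱 : SubsetOfω → Set
    𝒱 Z = ∀ a ℓ → On a → Z ◂ Cls a ℓ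

    field
      regular  : ∀ {Z Z₀ Z₁} → 𝒱 Z → (∀ i → Z i ≡ true → Z₀ i ≡ true ⊎ Z₁ i ≡ true) → 𝒱 Z₀ ⊎ 𝒱 Z₁
      infinite : ∀ {Z} → 𝒱 Z → Infinite Z
      whole    : 𝒱 full

    𝒱-⊆ : ∀ {Z Z'} → Z ⊆ Z' → 𝒱 Z → 𝒱 Z'
    𝒱-⊆ h v a ℓ t = ◂-⊆ h (v a ℓ t)

  Rel : Set₁
  Rel = ℕ → ℕ → ℕ → Set

  S1Rel : SubsetOfω → Rel → Set
  S1Rel p R = S1 p {3} (λ ρ → R (ρ #0) (ρ #1) (ρ #2))

  Ext : SubsetOfω → ℕ → ℕ → Set
  Ext Z σ τ = σ ⊑ τ × (∀ i → BT τ i → BT σ i ⊎ Z i ≡ true)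

  -- R' is meant to express the failure of ∃ z. R τ e ⟨w, z⟩ along a generic set with reservoirs in 𝒱.
  record Link (𝒱 : SubsetOfω → Set) (p : SubsetOfω) (R R' : Rel) : Set where
    field
      force : ∀ σ e w → ¬ R' σ e w → ∀ Z → 𝒱 Z → ∃ λ τ → ∃ λ z → Ext Z σ τ × R τ e (pr w z)
      thin  : ∀ σ e w → R' σ e w → ∃ λ Y → Y ≤T p × (∀ Z → 𝒱 Z → ∃ λ i → Z i ≡ true × Y i ≡ true) ×
        (∀ τ z → Ext Y σ τ → ¬ R τ e (pr w z))

  pr-mono : ∀ {a b c d} → a ≤ c → b ≤ d → pr a b ≤ pr c d
  pr-mono l l' = +-mono-≤ (*-mono-≤ (+-mono-≤ l l') (+-mono-≤ l l')) l

  dbl-≤ : ∀ {m n} → m + m < suc (n + n) → m ≤ n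
  dbl-≤ {m} {n} l = ≮⇒≥ λ n<m → <⇒≱ (+-mono-< n<m n<m) (≤-pred l)

  dbl-inj : ∀ {m n} → m + m ≡ n + n → m ≡ n
  dbl-inj {m} {n} e = ≤-antisym (dbl-≤ (s≤s (≤-reflexive e))) (dbl-≤ (s≤s (≤-reflexive (sym e))))

  dbl≢ : ∀ m n → m + m ≢ suc (n + n)
  dbl≢ (suc m) n e = dbl≢ n m (sym (trans (sym (+-suc m m)) (suc-injective e)))

  XP : SubsetOfω → ℕ → ℕ → Set
  XP r v i = (∀ k → BT v k → r (pr k i) ≡ true) × (∀ k → BF v k → r (pr k i) ≡ false)

  -- The Boolean combination of the columns of r prescribed by the string v.
  X : SubsetOfω → ℕ → SubsetOfω
  X r v i = ⌊ XP r v i ⌋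

  X-⊑ : ∀ {r v w} → v ⊑ w → X r w ⊆ X r v
  X-⊑ (T , F) i e = let (a , b) = proj₁ ⌊⌋-true e in proj₂ ⌊⌋-true ((λ k t → a k (T k t)) , (λ k f → b k (F k f)))

  XS : ℕ → ℕ → ℕ → Set
  XS t v i = (∀ k → BT v k → BT t (pr k i)) × (∀ k → BF v k → BF t (pr k i))

  XS' : ∀ {q k} (t v i : Term k) → S1 q (λ ρ → XS (evalT ρ t) (evalT ρ v) (evalT ρ i))
  XS' t v i = ren (allT v1 (BT' v1 (prT v0 v3)) & allF v1 (BF' v1 (prT v0 v3))) (t ∷ v ∷ i ∷ [])

  XS-XP : ∀ {r t v i} → t ⊏ r → XS t v i → XP r v i
  XS-XP (a , b) (T , F) = (λ k x → a _ (T k x)) , (λ k x → b _ (F k x))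

  XP-XS : ∀ {r t v i} → t ⊏ r → (∀ k → k < len v → pr k i < len t) → XP r v i → XS t v i
  XP-XS h l (T , F) = (λ k x → ⊏-BT h (l k (BT-< x)) (T k x)) , (λ k x → ⊏-BF h (l k (BF-< x)) (F k x))

  module Universal (p : SubsetOfω) where

    abstract
      UP : ℕ → ℕ → Set
      UP a s = ∃ λ c → ∃ λ y → a ≡ pr c y × JP p (pr c (pr y s))

      UP' : S1 p {2} (λ ρ → UP (ρ #0) (ρ #1))
      UP' = ∃' (∃' (pr≡ v2 v1 v0 & JP' (prT v1 (prT v0 v3))))

      index : ∀ {P : ℕ → ℕ → Set} → S1 p {2} (λ ρ → P (ρ #0) (ρ #1)) →
        ∃ λ c → ∀ s y → P s y iff UP (pr c y) s
      index {P} p' = let (c , h) = en in c , λ s y →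
          (λ x → c , y , refl , proj₁ (h (pr y s)) (y , s , refl , x))
        , (λ { (c' , y' , e , x) → back s y (proj₂ (h (pr y s)) (subst₂ (λ c y → JP p (pr c (pr y s)))
            (sym (proj₁ (pr-inj {c} {y} {c'} {y'} e))) (sym (proj₂ (pr-inj {c} {y} {c'} {y'} e))) x)) })
        where
        Packed : ℕ → Set
        Packed x = ∃ λ y → ∃ λ s → x ≡ pr y s × P s y
        en : ∃ λ c → ∀ x → Packed x iff JP p (pr c x)
        en = enumerate₁ {p} {λ ρ → Packed (ρ #0)} (∃' (∃' (pr≡ v2 v1 v0 & ren p' (v0 ∷ v1 ∷ []))))
        back : ∀ s y → Packed (pr y s) → P s y
        back s y (y' , s' , e , x) with pr-inj {y} {s} {y'} {s'} e
        ... | refl , refl = x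

  -- The columns of r: column ⟨⟨a, b⟩, v⟩ splits X r v into parts outside the classes a and b, if possible.
  module Columns (p : SubsetOfω) where
    open Universal p public

    Sub : ℕ → ℕ → ℕ → ℕ → Set
    Sub a v t s = UP a s × (∀ i → BT s i → XS t v i)

    SubT SubF : ℕ → ℕ → ℕ → ℕ → ℕ → Set
    SubT c a v t s = UP a s × (∀ i → BT s i → XS t v i × BT t (pr c i))
    SubF c a v t s = UP a s × (∀ i → BT s i → XS t v i × BF t (pr c i))

    task : ℕ → ℕ → ℕ → ℕ
    task a b v = pr (pr a b) v

    -- Classes of r for the greedy construction. Those with even index only make j record whether
    -- `X r v` lies in the open class a. The one with odd index says that column `task a b v` fails
    -- to split `X r v`, so avoiding it produces a splitting.
    E Task : ℕ → ℕ → Set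
    E i t = ∃ λ a → ∃ λ v → i ≡ pr a v + pr a v × ∃ λ s → Sub a v t s
    Task i t = ∃ λ a → ∃ λ b → ∃ λ v → i ≡ suc (task a b v + task a b v) ×
      ((∃ λ s → SubT (task a b v) a v t s) ⊎ (∃ λ s → SubF (task a b v) b v t s))

    O : ℕ → ℕ → Set
    O i t = E i t ⊎ Task i t

    abstract
      O' : S1 p {2} (λ ρ → O (ρ #0) (ρ #1))
      O' = ∃' (∃' (at (v2 ≐ (prT v1 v0 ⊕ prT v1 v0)) & ∃' (ren UP' (v2 ∷ v0 ∷ []) & allT v0 (XS' v5 v2 v0))))
        ∣∣ ∃' (∃' (∃' (at (v3 ≐ succ (prT (prT v2 v1) v0 ⊕ prT (prT v2 v1) v0)) &
             ( ∃' (ren UP' (v3 ∷ v0 ∷ []) & allT v0 (XS' v6 v2 v0 & BT' v6 (prT (prT (prT v4 v3) v2) v0)))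
            ∣∣ ∃' (ren UP' (v2 ∷ v0 ∷ []) & allT v0 (XS' v6 v2 v0 & BF' v6 (prT (prT (prT v4 v3) v2) v0)))))))

    SemE : SubsetOfω → ℕ → ℕ → Set
    SemE r a v = ∃ λ s → UP a s × (∀ i → BT s i → XP r v i)

    SemTask : SubsetOfω → ℕ → ℕ → ℕ → Set
    SemTask r a b v =
        (∃ λ s → UP a s × (∀ i → BT s i → XP r v i × r (pr (task a b v) i) ≡ true))
      ⊎ (∃ λ s → UP b s × (∀ i → BT s i → XP r v i × r (pr (task a b v) i) ≡ false))

    semE-◂ : ∀ {r a v} → SemE r a v iff X r v ◂ UP a
    semE-◂ = (λ (s , u , h) → s , (λ i b → proj₂ ⌊⌋-true (h i b)) , u)
           , (λ (s , h , u) → s , u , λ i b → proj₁ ⌊⌋-true (h i b))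

    -- By monotonicity of `pr`, a prefix of this length holds the entries of all columns below
    -- `c ⊔ len v` at all elements of s.
    long : ℕ → ℕ → ℕ → ℕ
    long c v s = suc (pr (c ⊔ len v) (len s))

    long-enough : ∀ {r} c v s {i} → i < len s → ∀ k → k < c ⊔ len v → pr k i < len (pref r (long c v s))
    long-enough {r} c v s l k l' = subst (_ <_) (sym (pref-len r _)) (s≤s (pr-mono (<⇒≤ l') (<⇒≤ l)))

    E-sem : ∀ {r} a v → Meets (E (pr a v + pr a v)) r iff SemE r a v
    E-sem {r} a v = to , from
      where
      to : Meets (E (pr a v + pr a v)) r → SemE r a v
      to (t , h , a' , v' , e , s , u , x) with pr-inj {a} {v} {a'} {v'} (dbl-inj e)
      ... | refl , refl = s , u , λ i b → XS-XP h (x i b)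
      from : SemE r a v → Meets (E (pr a v + pr a v)) r
      from (s , u , x) = pref r (long 0 v s) , pref-⊏ r _ , a , v , refl , s , u ,
        λ i b → XP-XS (pref-⊏ r _) (long-enough 0 v s (BT-< b)) (x i b)

    Task-sem : ∀ {r} a b v → Meets (Task (suc (task a b v + task a b v))) r iff SemTask r a b v
    Task-sem {r} a b v = to , from
      where
      c = task a b v
      to : Meets (Task (suc (c + c))) r → SemTask r a b v
      to (t , h , a' , b' , v' , e , z) with pr-inj {pr a b} {v} {pr a' b'} {v'} (dbl-inj (suc-injective e))
      ... | e' , refl with pr-inj {a} {b} {a'} {b'} e'
      ...   | refl , refl = Sum.map
        (λ (s , u , x) → s , u , λ i b → XS-XP h (proj₁ (x i b)) , proj₁ h _ (proj₂ (x i b)))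
        (λ (s , u , x) → s , u , λ i b → XS-XP h (proj₁ (x i b)) , proj₂ h _ (proj₂ (x i b))) z
      xs : ∀ s i → BT s i → XP r v i → XS (pref r (long (suc c) v s)) v i
      xs s i t x = XP-XS (pref-⊏ r _) (λ k l → long-enough (suc c) v s (BT-< t) k (≤-trans l (m≤n⊔m (suc c) (len v)))) x
      in-range : ∀ s i → BT s i → pr c i < len (pref r (long (suc c) v s))
      in-range s i t = long-enough (suc c) v s (BT-< t) c (m≤m⊔n (suc c) (len v))
      from : SemTask r a b v → Meets (Task (suc (c + c))) r
      from (inj₁ (s , u , x)) = pref r (long (suc c) v s) , pref-⊏ r _ , a , b , v , refl , inj₁ (s , u ,
        λ i t → xs s i t (proj₁ (x i t)) , ⊏-BT (pref-⊏ r _) (in-range s i t) (proj₂ (x i t)))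
      from (inj₂ (s , u , x)) = pref r (long (suc c) v s) , pref-⊏ r _ , a , b , v , refl , inj₂ (s , u ,
        λ i t → xs s i t (proj₁ (x i t)) , ⊏-BF (pref-⊏ r _) (in-range s i t) (proj₂ (x i t)))

    XP-agree : ∀ {r r' v i} → (∀ k → k < len v → r (pr k i) ≡ r' (pr k i)) → XP r v i → XP r' v i
    XP-agree h (T , F) = (λ k t → trans (sym (h k (BT-< t))) (T k t)) , (λ k t → trans (sym (h k (BF-< t))) (F k t))

    open GreedyAvoidance (greedy p O O') public

    j-decides : ∀ a v → j (pr a v + pr a v) ≡ true iff X r v ◂ UP a
    j-decides a v = iff-trans (decided (pr a v + pr a v)) (iff-trans (to , from) (iff-trans (E-sem {r} a v) (semE-◂ {r} {a} {v})))
      where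
      i = pr a v + pr a v
      to : Meets (O i) r → Meets (E i) r
      to (t , h , inj₁ e) = t , h , e
      to (t , h , inj₂ (a' , b' , v' , e , _)) = ⊥-elim (dbl≢ (pr a v) (task a' b' v') e)
      from : Meets (E i) r → Meets (O i) r
      from (t , h , e) = t , h , inj₁ e

    -- Earlier classes and X r v do not depend on column c, so changing that column to C
    -- preserves all earlier decisions.
    module _ (a b v : ℕ) (C : SubsetOfω) where
      private
        c : ℕ
        c = task a b v

        i₀ : ℕ
        i₀ = suc (c + c)

        Changed : ℕ → Set
        Changed x = (∃ λ i → x ≡ pr c i × C i ≡ true) ⊎ (¬ (∃ λ i → x ≡ pr c i) × r x ≡ true)

        r' : SubsetOfω
        r' x = ⌊ Changed x ⌋

        bool-eq : ∀ {x y : Bool} → (x ≡ true iff y ≡ true) → x ≡ y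
        bool-eq {true}  {true}  _ = refl
        bool-eq {true}  {false} (f , _) = sym (f refl)
        bool-eq {false} {true}  (_ , g) = g refl
        bool-eq {false} {false} _ = refl

        column : ∀ i → r' (pr c i) ≡ C i
        column i = bool-eq (iff-trans ⌊⌋-true (to , λ e → inj₁ (i , refl , e)))
          where
          to : Changed (pr c i) → C i ≡ true
          to (inj₁ (i' , e , x)) = subst (λ z → C z ≡ true) (sym (proj₂ (pr-inj {c} {i} {c} {i'} e))) x
          to (inj₂ (n , _)) = ⊥-elim (n (i , refl))

        other : ∀ k i → k ≢ c → r' (pr k i) ≡ r (pr k i)
        other k i ne = bool-eq (iff-trans ⌊⌋-true (to , λ e → inj₂ (not-c , e)))
          where
          not-c : ¬ (∃ λ i' → pr k i ≡ pr c i')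
          not-c (i' , e) = ne (proj₁ (pr-inj {k} {i} {c} {i'} e))
          to : Changed (pr k i) → r (pr k i) ≡ true
          to (inj₁ (i' , e , _)) = ⊥-elim (not-c (i' , e))
          to (inj₂ (_ , x)) = x

        -- `X r v'` reads only columns k < len v' ≤ v' ≤ c. The coding of tasks ensures that v' ≤ c
        -- for every v' occurring in an earlier class.
        XP-back : ∀ v' i → v' ≤ c → XP r' v' i → XP r v' i
        XP-back v' i l = XP-agree {r'} {r} {v'} {i} λ k l' → other k i (<⇒≢ (<-≤-trans l' (≤-trans (len-≤ v') l)))

        earlier-E : ∀ a' v' → pr a' v' + pr a' v' < i₀ → SemE r' a' v' → SemE r a' v'
        earlier-E a' v' l (s , u , y) = s , u , λ i b → XP-back v' i (≤-trans (pr-≥₂ a' v') (dbl-≤ {pr a' v'} {c} l)) (y i b)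

        earlier-Task : ∀ a' b' v' → suc (task a' b' v' + task a' b' v') < i₀ → SemTask r' a' b' v' → SemTask r a' b' v'
        earlier-Task a' b' v' l = Sum.map (λ (s , u , y) → s , u , λ i b → back i (y i b))
                                          (λ (s , u , y) → s , u , λ i b → back i (y i b))
          where
          c' : ℕ
          c' = task a' b' v'
          v'≤ : v' ≤ c
          v'≤ = ≤-trans (pr-≥₂ (pr a' b') v') (dbl-≤ {c'} {c} (<-trans (n<1+n _) l))
          c'≢ : c' ≢ c
          c'≢ e = <-irrefl (cong (λ z → suc (z + z)) e) l
          back : ∀ i {w} → XP r' v' i × r' (pr c' i) ≡ w → XP r v' i × r (pr c' i) ≡ w
          back i (x , e) = XP-back v' i v'≤ x , trans (sym (other c' i c'≢)) e

        earlier : ∀ i → i < i₀ → Meets (O i) r' → Meets (O i) r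
        earlier i l (t , h , inj₁ (a' , v' , refl , x)) =
          let (t' , h' , e') = proj₂ (E-sem {r} a' v') (earlier-E a' v' l (proj₁ (E-sem {r'} a' v') (t , h , a' , v' , refl , x)))
          in t' , h' , inj₁ e'
        earlier i l (t , h , inj₂ (a' , b' , v' , refl , x)) =
          let (t' , h' , e') = proj₂ (Task-sem {r} a' b' v')
                (earlier-Task a' b' v' l (proj₁ (Task-sem {r'} a' b' v') (t , h , a' , b' , v' , refl , x)))
          in t' , h' , inj₂ e'

      split : ¬ (∃ λ s → s ⊂ X r v × s ⊂ C × UP a s) → ¬ (∃ λ s → s ⊂ X r v × (∀ i → BT s i → C i ≡ false) × UP b s) →
        ¬ SemTask r a b v
      -- A task that is met was forced: the task and the earlier bans cover Cantor space, so one of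
      -- them catches `r'`. But `r'` meets no earlier ban, and its column C does split `X r v`.
      split na nb st = refute (Cov-Meets (forced i₀ (proj₂ (decided i₀) task-met)) r')
        where
        task-met : Meets (O i₀) r
        task-met = let (t , h , x) = proj₂ (Task-sem {r} a b v) st in t , h , inj₂ x
        here-X : ∀ {i} → XP r' v i → X r v i ≡ true
        here-X x = proj₂ ⌊⌋-true (XP-back v _ (pr-≥₂ (pr a b) v) x)
        not-now : ¬ SemTask r' a b v
        not-now (inj₁ (s , u , x)) = na (s , (λ i b → here-X (proj₁ (x i b))) ,
          (λ i b → trans (sym (column i)) (proj₂ (x i b))) , u)
        not-now (inj₂ (s , u , x)) = nb (s , (λ i b → here-X (proj₁ (x i b))) ,
          (λ i b → trans (sym (column i)) (proj₂ (x i b))) , u)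
        refute : Meets (λ t → Ban O j i₀ t ⊎ O i₀ t) r' → ⊥
        refute (t , h , inj₁ (i , l , f , o)) =
          contradiction (trans (sym (proj₂ (decided i) (earlier i l (t , h , o)))) f) λ ()
        refute (t , h , inj₂ (inj₁ (a' , v' , e , _))) = dbl≢ (pr a' v') c (sym e)
        refute (t , h , inj₂ (inj₂ x)) = not-now (proj₁ (Task-sem {r'} a b v) (t , h , x))

-- The next stratum and its forcing question

module NextStratum (em : ExcludedMiddle 0ℓ) where
  open Strings em
  open Queries em
  open UniversalSet em
  open Degrees em
  open BasisTheorems em
  open Strata em
  open _≤T_

  ExtS : ℕ → ℕ → ℕ → Set
  ExtS s σ τ = σ ⊑ τ × (∀ i → BT τ i → BT σ i ⊎ BT s i)

  ExtS' : ∀ {q k} (s σ τ : Term k) → S1 q (λ ρ → ExtS (evalT ρ s) (evalT ρ σ) (evalT ρ τ))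
  ExtS' s σ τ = ren (⊑' v1 v2 & allT v2 (BT' v2 v0 ∣∣ BT' v1 v0)) (s ∷ σ ∷ τ ∷ [])

  ExtS-Ext : ∀ {Z s σ τ} → s ⊂ Z → ExtS s σ τ → Ext Z σ τ
  ExtS-Ext h (a , b) = a , λ i t → Sum.map₂ (h i) (b i t)

  Ext-ExtS : ∀ {Z σ τ} → Ext Z σ τ → ExtS (pref Z (len τ)) σ τ
  Ext-ExtS {Z} {σ} {τ} (a , b) = a , λ i t → Sum.map₂ (pref-BT Z (len τ) i (BT-< t)) (b i t)

  snocFun : ℕ → Bool → SubsetOfω
  snocFun v b k = if does (k ≟ len v) then b else bitFun v k

  snoc : ℕ → Bool → ℕ
  snoc v b = pref (snocFun v b) (suc (len v))

  snoc-last : ∀ v b → snocFun v b (len v) ≡ b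
  snoc-last v b rewrite dec-true (len v ≟ len v) refl = refl

  snoc-init : ∀ v b k → k ≢ len v → snocFun v b k ≡ bitFun v k
  snoc-init v b k ne rewrite dec-false (k ≟ len v) ne = refl

  snoc-BT : ∀ v b k → BT (snoc v b) k → (k ≡ len v × b ≡ true) ⊎ BT v k
  snoc-BT v b k t with k ≟ len v
  ... | yes refl = inj₁ (refl , trans (sym (snoc-last v b)) (proj₁ (pref-⊏ _ _) k t))
  ... | no ne = inj₂ (⊏-BT (⊏-bitFun v)
    (≤∧≢⇒< (≤-pred (subst (k <_) (pref-len _ _) (BT-< t))) ne)
    (trans (sym (snoc-init v b k ne)) (proj₁ (pref-⊏ _ _) k t)))

  snoc-BF : ∀ v b k → BF (snoc v b) k → (k ≡ len v × b ≡ false) ⊎ BF v k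
  snoc-BF v b k t with k ≟ len v
  ... | yes refl = inj₁ (refl , trans (sym (snoc-last v b)) (proj₂ (pref-⊏ _ _) k t))
  ... | no ne = inj₂ (⊏-BF (⊏-bitFun v)
    (≤∧≢⇒< (≤-pred (subst (k <_) (pref-len _ _) (BF-< t))) ne)
    (trans (sym (snoc-init v b k ne)) (proj₂ (pref-⊏ _ _) k t)))

  X-snoc : ∀ r v i → X r v i ≡ true → X r (snoc v true) i ≡ true ⊎ X r (snoc v false) i ≡ true
  X-snoc r v i e = go (r (pr (len v) i)) refl
    where
    x : XP r v i
    x = proj₁ ⌊⌋-true e
    extended : ∀ b → r (pr (len v) i) ≡ b → X r (snoc v b) i ≡ true
    extended b eq = proj₂ ⌊⌋-true
      ( (λ k t → Sum.[ (λ { (refl , refl) → eq }) , proj₁ x k ] (snoc-BT v b k t))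
      , (λ k t → Sum.[ (λ { (refl , refl) → eq }) , proj₂ x k ] (snoc-BF v b k t)) )
    go : ∀ b → r (pr (len v) i) ≡ b → X r (snoc v true) i ≡ true ⊎ X r (snoc v false) i ≡ true
    go true  eq = inj₁ (extended true eq)
    go false eq = inj₂ (extended false eq)

  module Build (B : SubsetOfω) (m : ℕ) {p : SubsetOfω} (S : Stratum p) (ns : Avoid.NS B (suc m) p) where
    open Avoid B
    open Basis B
    open Stratum S
    open Columns p

    ns-j : NS m j
    ns-j = NS-≤T m j≤T ns

    query : ℕ → ℕ → ℕ → ℕ
    query c y v = pr (pr c y) v + pr (pr c y) v

    queryT : ∀ {k} → ℕ → Term k → Term k → Term k
    queryT c y v = prT (prT (num c) y) v ⊕ prT (prT (num c) y) v

    eval-query : ∀ {k} (ρ : Env k) c y v → evalT ρ (queryT c y v) ≡ query c (evalT ρ y) (evalT ρ v)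
    eval-query ρ c y v = cong (λ z → query z (evalT ρ y) (evalT ρ v)) (eval-num ρ c)

    module _ (P : ℕ → ℕ → Set) (P' : S1 p {2} (λ ρ → P (ρ #0) (ρ #1))) where

      -- A question about `X r v` and a Σ⁰₁(p) class becomes a single query to j, uniformly in v and
      -- a parameter. Both answers are therefore Σ⁰₁(j), which is where one quantifier is saved.
      answer : ∃ λ c → ∀ v y → j (query c y v) ≡ true iff X r v ◂ (λ s → P s y)
      answer = let (c , h) = index {P} P' in c , λ v y → iff-trans (j-decides (pr c y) v)
        (◂-map (λ s → proj₂ (h s y)) , ◂-map (λ s → proj₁ (h s y)))

      j⁺ : S1 j {2} (λ ρ → X r (ρ #0) ◂ (λ s → P s (ρ #1)))
      j⁺ = let (c , h) = answer in S1-iff (λ ρ → iff-trans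
          (subst (λ z → j z ≡ true) (eval-query ρ c v1 v0) , subst (λ z → j z ≡ true) (sym (eval-query ρ c v1 v0)))
          (h (ρ #0) (ρ #1))) (at (inX (queryT c v1 v0)))

      j⁻ : S1 j {2} (λ ρ → ¬ X r (ρ #0) ◂ (λ s → P s (ρ #1)))
      j⁻ = let (c , h) = answer in S1-iff (λ ρ → iff-trans
          (subst (λ z → j z ≢ true) (eval-query ρ c v1 v0) , subst (λ z → j z ≢ true) (sym (eval-query ρ c v1 v0)))
          ((λ n x → n (proj₂ (h (ρ #0) (ρ #1)) x)) , (λ n x → n (proj₁ (h (ρ #0) (ρ #1)) x))))
        (at (neg (inX (queryT c v1 v0))))

    -- Constant classes pass Σ⁰₁(p) facts to j through the same queries; this makes `On` Σ⁰₁(j) and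
    -- p computable from j.
    ◂-const : ∀ {A : Set} v → (X r v ◂ (λ s → A)) iff A
    ◂-const v = (λ (_ , _ , x) → x) , (λ x → ε , ε-⊂ , x)

    X-ε : ∀ i → X r ε i ≡ true
    X-ε i = proj₂ ⌊⌋-true ((λ k t → ⊥-elim (n≮0 (subst (k <_) (pref-len ∅ 0) (BT-< t))))
                          , (λ k t → ⊥-elim (n≮0 (subst (k <_) (pref-len ∅ 0) (BF-< t)))))

    Off-j : S1 j {2} (λ ρ → ¬ X r (ρ #0) ◂ (λ _ → ¬ On (ρ #1)))
    Off-j = j⁻ (λ _ a → ¬ On a) (ren Off' (v1 ∷ []))

    on : ∀ a → (¬ X r 0 ◂ (λ _ → ¬ On a)) iff On a
    on a = (λ n → dne λ m → n (proj₂ (◂-const {¬ On a} 0) m)) , (λ o x → proj₁ (◂-const {¬ On a} 0) x o)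

    On-j : S1 j {1} (λ ρ → ¬ X r 0 ◂ (λ _ → ¬ On (ρ #0)))
    On-j = ren Off-j (zer ∷ v0 ∷ [])

    On' : S1 j {1} (λ ρ → On (ρ #0))
    On' = S1-iff (λ ρ → on (ρ #0)) On-j

    Cls₂ : ℕ → ℕ → Set
    Cls₂ s y = ∃ λ a → ∃ λ ℓ → y ≡ pr a ℓ × Cls a ℓ s

    Cls₂' : S1 p {2} (λ ρ → Cls₂ (ρ #0) (ρ #1))
    Cls₂' = ∃' (∃' (pr≡ v3 v1 v0 & ren Cls' (v1 ∷ v0 ∷ v2 ∷ [])))

    Cls₂-iff : ∀ s a ℓ → Cls₂ s (pr a ℓ) iff Cls a ℓ s
    Cls₂-iff s a ℓ = (λ (a' , ℓ' , e , x) → subst₂ (λ a ℓ → Cls a ℓ s)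
        (sym (proj₁ (pr-inj {a} {ℓ} {a'} {ℓ'} e))) (sym (proj₂ (pr-inj {a} {ℓ} {a'} {ℓ'} e))) x)
      , (λ x → a , ℓ , refl , x)

    -- The combination `X r w` lies outside 𝒱. As this is Σ⁰₁(j), the u all of whose initial
    -- segments select elements of 𝒱 form a Π⁰₁(j) class, to which the basis theorem applies.
    Small : ℕ → Set
    Small w = ∃ λ a → ∃ λ ℓ → On a × ¬ X r w ◂ (λ s → Cls₂ s (pr a ℓ))

    Small' : S1 j {1} (λ ρ → Small (ρ #0))
    Small' = ∃' (∃' (ren On' (v1 ∷ []) & ren (j⁻ Cls₂ Cls₂') (v2 ∷ prT v1 v0 ∷ [])))

    not-small : ∀ {w} → ¬ Small w → 𝒱 (X r w)
    not-small n a ℓ o = ◂-map (λ s → proj₁ (Cls₂-iff s a ℓ)) (dne λ m → n (a , ℓ , o , m))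

    not-small⁻ : ∀ {w} → 𝒱 (X r w) → ¬ Small w
    not-small⁻ v (a , ℓ , o , n) = n (◂-map (λ s → proj₂ (Cls₂-iff s a ℓ)) (v a ℓ o))

    large-string : ∀ ℓ → ∃ λ w → len w ≡ ℓ × 𝒱 (X r w)
    large-string zero    = ε , pref-len ∅ 0 , 𝒱-⊆ {full} {X r ε} (λ i _ → X-ε i) whole
    large-string (suc ℓ) = longer (large-string ℓ)
      where
      extended : ∀ w b → len w ≡ ℓ → 𝒱 (X r (snoc w b)) → ∃ λ w → len w ≡ suc ℓ × 𝒱 (X r w)
      extended w b e v = snoc w b , trans (pref-len (snocFun w b) (suc (len w))) (cong suc e) , v
      longer : (∃ λ w → len w ≡ ℓ × 𝒱 (X r w)) → ∃ λ w → len w ≡ suc ℓ × 𝒱 (X r w)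
      longer (w , e , v) with regular {X r w} {X r (snoc w true)} {X r (snoc w false)} v (X-snoc r w)
      ... | inj₁ v' = extended w true e v'
      ... | inj₂ v' = extended w false e v'

    not-covered : ¬ Cov Small
    not-covered (ℓ , h) = let (w , e , v) = large-string ℓ ; (t , l , x) = h w e in
      not-small⁻ (𝒱-⊆ {X r w} {X r t} (X-⊑ {r} {t} {w} l) v) x

    abstract
      ultrafilter : ∃ λ u → ¬ Meets Small u × NS m (j ⊞ u)
      ultrafilter = basis m j {Small} Small' not-covered ns-j

    u : SubsetOfω
    u = proj₁ ultrafilter

    p' : SubsetOfω
    p' = j ⊞ u

    ns' : NS m p'
    ns' = proj₂ (proj₂ ultrafilter)

    large : ∀ {w} → w ⊏ u → 𝒱 (X r w)
    large {w} h = not-small {w} λ x → proj₁ (proj₂ ultrafilter) (w , h , x)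

    p≤p' : p ≤T p'
    p≤p' = ≤T-trans p≤j ≤T-⊞ˡ
      where
      constant : ∀ (P : ℕ → Set) → S1 p {1} (λ ρ → P (ρ #0)) → S1 j {1} (λ ρ → P (ρ #0))
      constant P P' = S1-iff (λ ρ → ◂-const {P (ρ #0)} 0) (ren P-j (zer ∷ v0 ∷ []))
        where
        P-j : S1 j {2} (λ ρ → X r (ρ #0) ◂ (λ _ → P (ρ #1)))
        P-j = j⁺ (λ _ y → P y) (ren P' (v1 ∷ []))
      p≤j : p ≤T j
      p≤j .member = constant (λ i → p i ≡ true) (member ≤T-refl)
      p≤j .absent = constant (λ i → p i ≡ false) (absent ≤T-refl)

    singleton : ℕ → ℕ
    singleton i = pref (λ k → does (k ≟ i)) (suc i)

    -- Membership of i is itself a query, about the open class of all sets containing i; so j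
    -- computes every `X r w`.
    in-X : ∀ w i → X r w ◂ (λ s → BT s i) iff X r w i ≡ true
    in-X w i = (λ (s , h , t) → h i t)
      , (λ e → singleton i , (λ k t → subst (λ z → X r w z ≡ true) (sym (only k (proj₁ (pref-⊏ (λ k → does (k ≟ i)) (suc i)) k t))) e)
                           , pref-BT (λ k → does (k ≟ i)) (suc i) i ≤-refl (dec-true (i ≟ i) refl))
      where
      only : ∀ k → does (k ≟ i) ≡ true → k ≡ i
      only k d with k ≟ i
      ... | yes e = e
      ... | no ne = contradiction (trans (sym (dec-false (k ≟ i) ne)) d) λ ()

    not-in-X : ∀ w i → (¬ X r w ◂ (λ s → BT s i)) iff X r w i ≡ false
    not-in-X w i = iff-trans ((λ n e → n (proj₂ (in-X w i) e)) , (λ n x → n (proj₁ (in-X w i) x))) ≢true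

    X⁺ : S1 j {2} (λ ρ → X r (ρ #0) (ρ #1) ≡ true)
    X⁺ = S1-iff (λ ρ → in-X (ρ #0) (ρ #1)) (j⁺ (λ s i → BT s i) (BT' v0 v1))

    X⁻ : S1 j {2} (λ ρ → X r (ρ #0) (ρ #1) ≡ false)
    X⁻ = S1-iff (λ ρ → not-in-X (ρ #0) (ρ #1))
      (j⁻ (λ s i → BT s i) (BT' v0 v1))

    X≤p' : ∀ w → X r w ≤T p'
    X≤p' w .member = S1-≤T ≤T-⊞ˡ (S1-iff (λ ρ → subst (λ z → X r z (ρ #0) ≡ true) (eval-num ρ w)
      , subst (λ z → X r z (ρ #0) ≡ true) (sym (eval-num ρ w))) (ren X⁺ (num w ∷ v0 ∷ [])))
    X≤p' w .absent = S1-≤T ≤T-⊞ˡ (S1-iff (λ ρ → subst (λ z → X r z (ρ #0) ≡ false) (eval-num ρ w)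
      , subst (λ z → X r z (ρ #0) ≡ false) (sym (eval-num ρ w))) (ren X⁻ (num w ∷ v0 ∷ [])))

    Xn-⊆ : ∀ {w w'} → w ⊏ u → w' ⊏ u → len w ≤ len w' → X r w' ⊆ X r w
    Xn-⊆ {w} {w'} h h' l = X-⊑ {r} {w} {w'} (⊏-⊑ h h' l)

    OnN : ℕ → Set
    OnN a = ∀ w → w ⊏ u → X r w ◂ UP a

    OffN' : S1 p' {1} (λ ρ → ¬ OnN (ρ #0))
    OffN' = S1-iff (λ ρ → (λ (w , h , n) o → n (o w h))
                        , (λ n → dne λ m → n λ w h → dne λ k → m (w , h , k)))
      (∃' (⊏-≤T ≤T-⊞ʳ v0 & S1-≤T ≤T-⊞ˡ (ren (j⁻ (λ s a → UP a s) (ren UP' (v1 ∷ v0 ∷ []))) (v0 ∷ v1 ∷ []))))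

    ClsN : ℕ → ℕ → ℕ → Set
    ClsN a ℓ s = ∃ λ w → w ⊏ u × len w ≡ ℓ × ∃ λ s' → UP a s' × (∀ i → BT s' i → BT s i × X r w i ≡ true)

    ClsN' : S1 p' {3} (λ ρ → ClsN (ρ #0) (ρ #1) (ρ #2))
    ClsN' = ∃' (⊏-≤T ≤T-⊞ʳ v0 & len' v0 v2 & ∃' (S1-≤T p≤p' (ren UP' (v2 ∷ v0 ∷ [])) &
      allT v0 (BT' v5 v0 & S1-≤T ≤T-⊞ˡ (ren X⁺ (v2 ∷ v0 ∷ [])))))

    𝒱N : SubsetOfω → Set
    𝒱N Z = ∀ a ℓ → OnN a → Z ◂ ClsN a ℓ

    -- Membership in 𝒱N: every Z ∩ X r w with w an initial segment of u meets every class containing all X r w.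
    𝒱N-elim : ∀ {Z a} → 𝒱N Z → OnN a → ∀ {w} → w ⊏ u → ∃ λ s → s ⊂ Z × s ⊂ X r w × UP a s
    𝒱N-elim {a = a} v o {w} h with v a (len w) o
    ... | s , l , w' , h' , e , s' , x , y =
      s' , (λ i t → l i (proj₁ (y i t))) , (λ i t → Xn-⊆ h h' (≤-reflexive (sym e)) i (proj₂ (y i t))) , x

    ClsN-intro : ∀ {Z a} ℓ → (∃ λ s → s ⊂ Z × s ⊂ X r (pref u ℓ) × UP a s) → Z ◂ ClsN a ℓ
    ClsN-intro ℓ (s , l , l' , x) = s , l , pref u ℓ , pref-⊏ u ℓ , pref-len u ℓ , s , x , λ i t → t , l' i t

    module _ (P : ℕ → ℕ → Set) (P' : S1 p {2} (λ ρ → P (ρ #0) (ρ #1))) where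

      𝒱N-class : ∀ y → (∀ w → w ⊏ u → X r w ◂ (λ s → P s y)) → ∀ {Z} → 𝒱N Z →
        ∀ {w} → w ⊏ u → ∃ λ s → s ⊂ Z × s ⊂ X r w × P s y
      𝒱N-class y all-w v h = let (c , ix) = index {P} P'
                                 (s , l , l' , x) = 𝒱N-elim v (λ w h → ◂-map (λ s → proj₁ (ix s y)) (all-w w h)) h
                             in s , l , l' , proj₂ (ix s y) x

    𝒱N-⊆𝒱 : ∀ {Z} → 𝒱N Z → 𝒱 Z
    𝒱N-⊆𝒱 v a ℓ o = let (s , l , _ , x) = 𝒱N-class Cls₂ Cls₂' (pr a ℓ)
                            (λ w h → ◂-map (λ s → proj₂ (Cls₂-iff s a ℓ)) (large h a ℓ o)) v (pref-⊏ u 0)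
                       in s , l , proj₁ (Cls₂-iff s a ℓ) x

    Sp : ℕ → ℕ → ℕ → ℕ → Set
    Sp a b s c = (∃ λ s' → UP a s' × (∀ i → BT s' i → BT s i × BT c i))
               ⊎ (∃ λ s' → UP b s' × (∀ i → BT s' i → BT s i × BF c i))

    Sp' : S1 p {4} (λ ρ → Sp (ρ #0) (ρ #1) (ρ #2) (ρ #3))
    Sp' = ∃' (ren UP' (v1 ∷ v0 ∷ []) & allT v0 (BT' v4 v0 & BT' v5 v0))
       ∣∣ ∃' (ren UP' (v2 ∷ v0 ∷ []) & allT v0 (BT' v4 v0 & BF' v5 v0))

    Sp-≋ : ∀ {a b s c c'} → c ≋ c' → Sp a b s c → Sp a b s c'
    Sp-≋ ((T , F) , _) = Sum.map (λ (s' , x , h) → s' , x , λ i t → proj₁ (h i t) , T i (proj₂ (h i t)))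
                                 (λ (s' , x , h) → s' , x , λ i t → proj₁ (h i t) , F i (proj₂ (h i t)))

    -- W s ⟨a, b⟩: however s is split in two, the first part meets class a or the second meets class b.
    W : ℕ → ℕ → Set
    W s y = ∃ λ a → ∃ λ b → y ≡ pr a b × ∃ λ n → len s ≡ n × (∀ c → len c ≡ n → Sp a b s c)

    W' : S1 p {2} (λ ρ → W (ρ #0) (ρ #1))
    W' = ∃' (∃' (pr≡ v3 v1 v0 & ∃' (len' v3 v0 & splits)))
      where
      splits : S1 p {5} (λ ρ → ∀ c → len c ≡ ρ #0 →
        Sp (ρ #2) (ρ #1) (ρ #3) c)
      splits = allS {P = λ ρ → Sp (ρ #3) (ρ #2) (ρ #4) (ρ #0)}
        v0 Sp-≋ (ren Sp' (v3 ∷ v2 ∷ v4 ∷ v0 ∷ []))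

    module Splitting {a b : ℕ} (oa : OnN a) (ob : OnN b) {w : ℕ} (h : w ⊏ u) where

      BadC : ℕ → Set
      BadC c = (∃ λ s → UP a s × (∀ i → BT s i → X r w i ≡ true × BT c i))
             ⊎ (∃ λ s → UP b s × (∀ i → BT s i → X r w i ≡ true × BF c i))

      covered : Cov BadC → X r w ◂ (λ s → W s (pr a b))
      covered (n , hc) = pref (X r w) n , pref-⊂ (X r w) n , a , b , refl , n , pref-len (X r w) n , λ c e → sp c e (hc c e)
        where
        inside : ∀ {c} → len c ≡ n → ∀ i → i < len c → X r w i ≡ true → BT (pref (X r w) n) i
        inside e i l x = pref-BT (X r w) n i (subst (i <_) e l) x
        sp : ∀ c → len c ≡ n → (∃ λ t → t ⊑ c × BadC t) → Sp a b (pref (X r w) n) c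
        sp c e (t , (T , F) , inj₁ (s , x , y)) = inj₁ (s , x , λ i z → let t' = T i (proj₂ (y i z)) in
          inside e i (BT-< t') (proj₁ (y i z)) , t')
        sp c e (t , (T , F) , inj₂ (s , x , y)) = inj₂ (s , x , λ i z → let t' = F i (proj₂ (y i z)) in
          inside e i (BF-< t') (proj₁ (y i z)) , t')

      module _ (C : SubsetOfω) (free : ¬ Meets BadC C) where

        na : ¬ (∃ λ s → s ⊂ X r w × s ⊂ C × UP a s)
        na (s , l , l' , x) = free (pref C (len s) , pref-⊏ C (len s) ,
          inj₁ (s , x , λ i t → l i t , pref-BT C (len s) i (BT-< t) (l' i t)))

        nb : ¬ (∃ λ s → s ⊂ X r w × (∀ i → BT s i → C i ≡ false) × UP b s)
        nb (s , l , l' , x) = free (pref C (len s) , pref-⊏ C (len s) ,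
          inj₂ (s , x , λ i t → l i t , pref-BF C (len s) i (BT-< t) (l' i t)))

        c : ℕ
        c = task a b w

        -- Long enough for the initial segment of u to extend w and to decide column c.
        ℓ₂ : ℕ
        ℓ₂ = len w ⊔ suc c

        w₂ : ℕ
        w₂ = pref u ℓ₂

        X₂-⊆ : X r w₂ ⊆ X r w
        X₂-⊆ = Xn-⊆ h (pref-⊏ u ℓ₂) (subst (len w ≤_) (sym (pref-len u ℓ₂)) (m≤m⊔n (len w) (suc c)))

        absurd : ⊥
        absurd with BT⊎BF w₂ c (subst (c <_) (sym (pref-len u ℓ₂)) (m≤n⊔m (len w) (suc c)))
        ... | inj₁ t = let (s , l , x) = oa w₂ (pref-⊏ u ℓ₂) in split a b w C na nb (inj₁ (s , x , λ i z →
                proj₁ ⌊⌋-true (X₂-⊆ i (l i z)) , proj₁ (proj₁ ⌊⌋-true (l i z)) c t))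
        ... | inj₂ t = let (s , l , x) = ob w₂ (pref-⊏ u ℓ₂) in split a b w C na nb (inj₂ (s , x , λ i z →
                proj₁ ⌊⌋-true (X₂-⊆ i (l i z)) , proj₂ (proj₁ ⌊⌋-true (l i z)) c t))

      -- If no partition of `X r w` avoids class a on one side and class b on the other, compactness
      -- yields a finite part with this property. If some C does, then column `task a b w` does so
      -- too; but u contains one of its two parts, and that part would lie outside a class
      -- containing all of u.
      W-on : X r w ◂ (λ s → W s (pr a b))
      W-on = dne λ n → let (C , free) = compact BadC (λ cov → n (covered cov)) in absurd C free

    -- If Z₀ fails for a and Z₁ for b, use that the class `W` of the pair contains all of u. So Z
    -- includes a finite set, inside a given element of u, of which every split meets a or b; its
    -- split along Z₀ refutes one failure.
    regularN : ∀ {Z Z₀ Z₁} → 𝒱N Z → (∀ i → Z i ≡ true → Z₀ i ≡ true ⊎ Z₁ i ≡ true) → 𝒱N Z₀ ⊎ 𝒱N Z₁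
    regularN {Z} {Z₀} {Z₁} v cover with em {𝒱N Z₀}
    ... | yes v₀ = inj₁ v₀
    ... | no n₀  = inj₂ λ b ℓ' ob → dne λ nb → n₀ λ a ℓ oa → dne λ na → clash a b ℓ ℓ' oa ob na nb
      where
      clash : ∀ a b ℓ ℓ' → OnN a → OnN b → ¬ Z₀ ◂ ClsN a ℓ → ¬ Z₁ ◂ ClsN b ℓ' → ⊥
      clash a b ℓ ℓ' oa ob na nb = refute (𝒱N-class W W' (pr a b) (λ w h → Splitting.W-on oa ob h) v (pref-⊏ u L))
        where
        L : ℕ
        L = ℓ ⊔ ℓ'
        down : ∀ {k} → k ≤ L → X r (pref u L) ⊆ X r (pref u k)
        down {k} l = Xn-⊆ (pref-⊏ u k) (pref-⊏ u L) (subst₂ _≤_ (sym (pref-len u k)) (sym (pref-len u L)) l)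
        pick : ∀ s → s ⊂ Z → s ⊂ X r (pref u L) → Sp a b s (pref Z₀ (len s)) → ⊥
        pick s l l' (inj₁ (s' , x , y)) = na (ClsN-intro ℓ (s' ,
          (λ i t → proj₁ (pref-⊏ Z₀ (len s)) i (proj₂ (y i t))) ,
          (λ i t → down (m≤m⊔n ℓ ℓ') i (l' i (proj₁ (y i t)))) , x))
        pick s l l' (inj₂ (s' , x , y)) = nb (ClsN-intro ℓ' (s' , right ,
          (λ i t → down (m≤n⊔m ℓ ℓ') i (l' i (proj₁ (y i t)))) , x))
          where
          right : s' ⊂ Z₁
          right i t with cover i (l i (proj₁ (y i t)))
          ... | inj₂ e = e
          ... | inj₁ e = contradiction (trans (sym e) (proj₂ (pref-⊏ Z₀ (len s)) i (proj₂ (y i t)))) λ ()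
        refute : (∃ λ s → s ⊂ Z × s ⊂ X r (pref u L) × W s (pr a b)) → ⊥
        refute (s , l , l' , a' , b' , e , n , e' , g) = pick s l l'
          (subst₂ (λ a b → Sp a b s (pref Z₀ (len s))) (sym (proj₁ (pr-inj {a} {b} {a'} {b'} e)))
            (sym (proj₂ (pr-inj {a} {b} {a'} {b'} e))) (g (pref Z₀ (len s)) (trans (pref-len Z₀ (len s)) e')))

    wholeN : 𝒱N full
    wholeN a ℓ o = let (s , l , x) = o (pref u ℓ) (pref-⊏ u ℓ) in ClsN-intro ℓ (s , (λ _ _ → refl) , l , x)

    next : Stratum p'
    next = record
      { Cls = ClsN ; Cls' = ClsN' ; On = OnN ; Off' = OffN'
      ; regular = regularN ; infinite = λ v → infinite (𝒱N-⊆𝒱 v) ; whole = wholeN }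

    module _ (R : Rel) (R' : S1Rel p R) where

      Q : ℕ → ℕ → ℕ → ℕ → Set
      Q σ e w s = ∃ λ τ → ∃ λ z → ExtS s σ τ × R τ e (pr w z)

      Q₂ : ℕ → ℕ → Set
      Q₂ s y = ∃ λ σ → ∃ λ e → ∃ λ w → y ≡ pr σ (pr e w) × Q σ e w s

      Q₂' : S1 p {2} (λ ρ → Q₂ (ρ #0) (ρ #1))
      Q₂' = ∃' (∃' (∃' (at (v4 ≐ prT v2 (prT v1 v0)) &
        ∃' (∃' (ExtS' v5 v4 v1 & ren R' (v1 ∷ v3 ∷ prT v2 v0 ∷ []))))))

      Q₂-iff : ∀ s σ e w → Q₂ s (pr σ (pr e w)) iff Q σ e w s
      Q₂-iff s σ e w = to , (λ x → σ , e , w , refl , x)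
        where
        to : Q₂ s (pr σ (pr e w)) → Q σ e w s
        to (σ' , e' , w' , eq , x) with pr-inj {σ} {pr e w} {σ'} {pr e' w'} eq
        ... | refl , eq' with pr-inj {e} {w} {e'} {w'} eq'
        ...   | refl , refl = x

      -- The sets that permit an R-extension of σ form a Σ⁰₁(p) open class. If it contains all of u,
      -- it contains every member of `𝒱N`; otherwise some `X r v` from u lies outside it and blocks
      -- all such extensions. The latter case is Σ⁰₁(p').
      RN : Rel
      RN σ e w = ∃ λ v → v ⊏ u × ¬ X r v ◂ (λ s → Q₂ s (pr σ (pr e w)))

      RN' : S1Rel p' RN
      RN' = ∃' (⊏-≤T ≤T-⊞ʳ v0 & S1-≤T ≤T-⊞ˡ (ren (j⁻ Q₂ Q₂') (v0 ∷ prT v1 (prT v2 v3) ∷ [])))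

      link : Link 𝒱N p' R RN
      link .Link.force σ e w n Z v =
        let (s , l , _ , x) = 𝒱N-class Q₂ Q₂' (pr σ (pr e w)) (λ w' h → dne λ m → n (w' , h , m)) v (pref-⊏ u 0)
            (τ , z , ext , rel) = proj₁ (Q₂-iff s σ e w) x
        in τ , z , ExtS-Ext l ext , rel
      link .Link.thin σ e w (v , h , n) = X r v , X≤p' v , meets , none
        where
        -- The class of nonempty sets contains all of u, so any Z in `𝒱N` has a common element with
        -- `X r v`.
        Inhabited : ℕ → ℕ → Set
        Inhabited s _ = ∃ λ i → BT s i
        inhabited : ∀ w' → w' ⊏ u → X r w' ◂ (λ s → Inhabited s 0)
        inhabited w' h' = let (i , _ , x) = infinite (large h') 0 ; (s , l , t) = proj₂ (in-X w' i) x in s , l , i , t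
        meets : ∀ Z → 𝒱N Z → ∃ λ i → Z i ≡ true × X r v i ≡ true
        meets Z vz = let (s , l , l' , i , t) = 𝒱N-class Inhabited (∃' (BT' v1 v0)) 0 inhabited vz h in i , l i t , l' i t
        none : ∀ τ z → Ext (X r v) σ τ → ¬ R τ e (pr w z)
        none τ z ext rel = n (pref (X r v) (len τ) , pref-⊂ (X r v) (len τ) ,
          proj₂ (Q₂-iff _ σ e w) (τ , z , Ext-ExtS ext , rel))

-- Forcing over the top stratum

module Forcing (em : ExcludedMiddle 0ℓ) where
  open Strings em
  open Queries em
  open UniversalSet em
  open Degrees em
  open BasisTheorems em
  open Strata em
  open NextStratum em
  open _≤T_

  infixl 7 _∩_ _∖_
  _∩_ _∖_ : SubsetOfω → SubsetOfω → SubsetOfω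
  (Y ∩ Z) i = Y i ∧ Z i
  (Y ∖ Z) i = Y i ∧ not (Z i)

  ∩-iff : ∀ Y Z i → (Y ∩ Z) i ≡ true iff (Y i ≡ true × Z i ≡ true)
  ∩-iff Y Z i with Y i | Z i
  ... | true  | true  = (λ _ → refl , refl) , (λ _ → refl)
  ... | true  | false = (λ ()) , (λ ())
  ... | false | _     = (λ ()) , (λ ())

  ∖-iff : ∀ Y Z i → (Y ∖ Z) i ≡ true iff (Y i ≡ true × Z i ≡ false)
  ∖-iff Y Z i with Y i | Z i
  ... | true  | false = (λ _ → refl , refl) , (λ _ → refl)
  ... | true  | true  = (λ ()) , (λ ())
  ... | false | _     = (λ ()) , (λ ())

  ∩-false : ∀ Y Z i → (Y i ≡ false ⊎ Z i ≡ false) iff (Y ∩ Z) i ≡ false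
  ∩-false Y Z i with Y i | Z i
  ... | true  | true  = Sum.[ (λ ()) , (λ ()) ] , (λ ())
  ... | true  | false = (λ _ → refl) , (λ _ → inj₂ refl)
  ... | false | _     = (λ _ → refl) , (λ _ → inj₁ refl)

  ∖-false : ∀ Y Z i → (Y i ≡ false ⊎ Z i ≡ true) iff (Y ∖ Z) i ≡ false
  ∖-false Y Z i with Y i | Z i
  ... | true  | false = Sum.[ (λ ()) , (λ ()) ] , (λ ())
  ... | true  | true  = (λ _ → refl) , (λ _ → inj₂ refl)
  ... | false | _     = (λ _ → refl) , (λ _ → inj₁ refl)

  ∩-≤T : ∀ {Y Z c} → Y ≤T c → Z ≤T c → Y ∩ Z ≤T c
  ∩-≤T {Y} {Z} h h' .member = S1-iff (λ ρ → iff-sym (∩-iff Y Z (ρ #0))) (member h & member h')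
  ∩-≤T {Y} {Z} h h' .absent = S1-iff (λ ρ → ∩-false Y Z (ρ #0)) (absent h ∣∣ absent h')

  ∖-≤T : ∀ {Y Z c} → Y ≤T c → Z ≤T c → Y ∖ Z ≤T c
  ∖-≤T {Y} {Z} h h' .member = S1-iff (λ ρ → iff-sym (∖-iff Y Z (ρ #0))) (member h & absent h')
  ∖-≤T {Y} {Z} h h' .absent = S1-iff (λ ρ → ∖-false Y Z (ρ #0)) (absent h ∣∣ member h')

  data Chain (𝒱 : SubsetOfω → Set) (p : SubsetOfω) (R₀ : Rel) : ℕ → Rel → Set₁ where
    start : Chain 𝒱 p R₀ 0 R₀
    _▹_   : ∀ {k R R'} → Chain 𝒱 p R₀ k R → Link 𝒱 p R R' → Chain 𝒱 p R₀ (suc k) R'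

  -- Links found at lower strata are reused at the top: `force` and `thin` survive when 𝒱 shrinks
  -- and the oracle grows.
  Chain-map : ∀ {𝒱 𝒱' p p' R₀ k R} → (∀ {Z} → 𝒱' Z → 𝒱 Z) → p ≤T p' → Chain 𝒱 p R₀ k R → Chain 𝒱' p' R₀ k R
  Chain-map f h start = start
  Chain-map f h (ch ▹ l) = Chain-map f h ch ▹ record
    { force = λ σ e w n Z v → Link.force l σ e w n Z (f v)
    ; thin  = λ σ e w x → let (Y , y , m , n) = Link.thin l σ e w x in Y , ≤T-trans y h , (λ Z v → m Z (f v)) , n }

  -- Existential quantifiers alternating with negations over a matrix; `∃ z. sem R₀ n G e ⟨x, z⟩`
  -- will serve as a universal Σ⁰₍ₙ₊₁₎(G) predicate.
  sem : Rel → ℕ → SubsetOfω → ℕ → ℕ → Set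
  sem R₀ zero    G e w = ∃ λ s → s ⊏ G × R₀ s e w
  sem R₀ (suc k) G e w = ¬ (∃ λ z → sem R₀ k G e (pr w z))

  data Req : Set where
    above mismatch : ℕ → Req
    decision : ℕ → ℕ → ℕ → Req

  code : Req → ℕ
  code (above m)        = pr 0 m
  code (mismatch e)     = pr 1 e
  code (decision i e w) = pr 2 (pr i (pr e w))

  code-inj : ∀ x y → code x ≡ code y → x ≡ y
  code-inj (above m) (above m') q with pr-inj {0} {m} {0} {m'} q
  ... | _ , refl = refl
  code-inj (mismatch e) (mismatch e') q with pr-inj {1} {e} {1} {e'} q
  ... | _ , refl = refl
  code-inj (decision i e w) (decision i' e' w') q with pr-inj {2} {pr i (pr e w)} {2} {pr i' (pr e' w')} q
  ... | _ , q' with pr-inj {i} {pr e w} {i'} {pr e' w'} q'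
  ...   | refl , q'' with pr-inj {e} {w} {e'} {w'} q''
  ...     | refl , refl = refl
  code-inj (above m) (mismatch e) q = contradiction (proj₁ (pr-inj {0} {m} {1} {e} q)) λ ()
  code-inj (mismatch e) (above m) q = contradiction (proj₁ (pr-inj {1} {e} {0} {m} q)) λ ()
  code-inj (above m) (decision i e w) q = contradiction (proj₁ (pr-inj {0} {m} {2} {pr i (pr e w)} q)) λ ()
  code-inj (decision i e w) (above m) q = contradiction (proj₁ (pr-inj {2} {pr i (pr e w)} {0} {m} q)) λ ()
  code-inj (mismatch e') (decision i e w) q = contradiction (proj₁ (pr-inj {1} {e'} {2} {pr i (pr e w)} q)) λ ()
  code-inj (decision i e w) (mismatch e') q = contradiction (proj₁ (pr-inj {2} {pr i (pr e w)} {1} {e'} q)) λ ()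

  -- The padding makes each requirement recur: pad = t₀ places it at a stage not before t₀.
  Scheduled : ℕ → Set
  Scheduled t = ∃ λ x → ∃ λ pad → t ≡ pr (code x) pad

  module Final (B : SubsetOfω) {p : SubsetOfω} (S : Stratum p) (R₀ : Rel)
    (R₀-mono : ∀ {s t e w} → s ⊑ t → R₀ s e w → R₀ t e w)
    {n : ℕ} {R : Rel} (R' : S1Rel p R) (ch : Chain (Stratum.𝒱 S) p R₀ n R) (ns : ¬ Avoid.Σ₁B B p) where

    open Avoid B
    open Basis B
    open Stratum S

    Unsplittable Splittable : SubsetOfω → (ℕ → ℕ → Set) → (ℕ → ℕ → Set) → Set
    Unsplittable X O₀ O₁ = ∃ λ x → B x ≢ true × (∀ C → (X ∩ C ◂ O₀ x) ⊎ (X ∖ C ◂ O₁ x))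
    Splittable X O₀ O₁ = ∃ λ x → B x ≡ true × ∃ λ C → ¬ (X ∩ C ◂ O₀ x) × ¬ (X ∖ C ◂ O₁ x) ×
      ¬ Σ₁B (p ⊞ X ∩ C) × ¬ Σ₁B (p ⊞ X ∖ C)

    module _ {X : SubsetOfω} (nsX : ¬ Σ₁B (p ⊞ X)) (O₀ O₁ : ℕ → ℕ → Set)
      (O₀' : S1 p {2} (λ ρ → O₀ (ρ #0) (ρ #1))) (O₁' : S1 p {2} (λ ρ → O₁ (ρ #0) (ρ #1))) where

      private
        Bad : ℕ → ℕ → Set
        Bad x c = (∃ λ s → O₀ x s × (∀ i → BT s i → X i ≡ true × BT c i))
                ⊎ (∃ λ s → O₁ x s × (∀ i → BT s i → X i ≡ true × BF c i))

        Bad' : S1 (p ⊞ X) {2} (λ ρ → Bad (ρ #1) (ρ #0))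
        Bad' = ∃' (S1-≤T ≤T-⊞ˡ (ren O₀' (v2 ∷ v0 ∷ [])) & allT v0 (ren (member ≤T-⊞ʳ) (v0 ∷ []) & BT' v2 v0))
            ∣∣ ∃' (S1-≤T ≤T-⊞ˡ (ren O₁' (v2 ∷ v0 ∷ [])) & allT v0 (ren (member ≤T-⊞ʳ) (v0 ∷ []) & BF' v2 v0))

        Bad-at : ∀ x → S1 (p ⊞ X) {1} (λ ρ → Bad x (ρ #0))
        Bad-at x = S1-iff (λ ρ → subst (λ z → Bad z (ρ #0)) (eval-num ρ x) , subst (λ z → Bad z (ρ #0)) (sym (eval-num ρ x)))
          (ren Bad' (v0 ∷ num x ∷ []))

        covered : ∀ x → Cov (Bad x) → ∀ C → (X ∩ C ◂ O₀ x) ⊎ (X ∖ C ◂ O₁ x)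
        covered x cov C with Cov-Meets cov C
        ... | t , (T , F) , inj₁ (s , o , h) = inj₁ (s , (λ i b → proj₂ (∩-iff X C i) (proj₁ (h i b) , T i (proj₂ (h i b)))) , o)
        ... | t , (T , F) , inj₂ (s , o , h) = inj₂ (s , (λ i b → proj₂ (∖-iff X C i) (proj₁ (h i b) , F i (proj₂ (h i b)))) , o)

        meet₀ : ∀ x C → X ∩ C ◂ O₀ x → Meets (Bad x) C
        meet₀ x C (s , l , o) = pref C (len s) , pref-⊏ C (len s) , inj₁ (s , o , λ i b →
          proj₁ (proj₁ (∩-iff X C i) (l i b)) , pref-BT C (len s) i (BT-< b) (proj₂ (proj₁ (∩-iff X C i) (l i b))))

        meet₁ : ∀ x C → X ∖ C ◂ O₁ x → Meets (Bad x) C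
        meet₁ x C (s , l , o) = pref C (len s) , pref-⊏ C (len s) , inj₂ (s , o , λ i b →
          proj₁ (proj₁ (∖-iff X C i) (l i b)) , pref-BF C (len s) i (BT-< b) (proj₂ (proj₁ (∖-iff X C i) (l i b))))

      -- Otherwise the Σ₁(p ⊞ X) question whether X is unsplittable at x would enumerate B.
      split-reservoir : Unsplittable X O₀ O₁ ⊎ Splittable X O₀ O₁
      split-reservoir with em {∃ λ x → B x ≡ true × ¬ Cov (Bad x)}
      -- The basis theorem is applied over `p ⊞ X`, so B stays non-enumerable from C as well, hence
      -- from both halves of X.
      ... | yes (x , b , nc) = let (C , free , ns') = basis 0 (p ⊞ X) {Bad x} (Bad-at x) nc nsX in
        inj₂ (x , b , C , (λ o → free (meet₀ x C o)) , (λ o → free (meet₁ x C o)) ,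
          NS-≤T 0 (⊞-lub (≤T-trans ≤T-⊞ˡ ≤T-⊞ˡ) (∩-≤T (≤T-trans ≤T-⊞ʳ ≤T-⊞ˡ) ≤T-⊞ʳ)) ns' ,
          NS-≤T 0 (⊞-lub (≤T-trans ≤T-⊞ˡ ≤T-⊞ˡ) (∖-≤T (≤T-trans ≤T-⊞ʳ ≤T-⊞ˡ) ≤T-⊞ʳ)) ns')
      ... | no ne = inj₁ (dne λ m → nsX (S1-iff (λ ρ → to m (ρ #0) , from (ρ #0)) (Cov' Bad')))
        where
        to : ¬ Unsplittable X O₀ O₁ → ∀ x → Cov (Bad x) → B x ≡ true
        to m x cov = dne λ nb → m (x , nb , covered x cov)
        from : ∀ x → B x ≡ true → Cov (Bad x)
        from x b = dne λ nc → ne (x , b , nc)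

    Ask : ℕ → ℕ → ℕ → ℕ → Set
    Ask σ e x s = ∃ λ τ → ∃ λ z → ExtS s σ τ × R τ e (pr x z)

    Ask' : ∀ σ e → S1 p {2} (λ ρ → Ask σ e (ρ #0) (ρ #1))
    Ask' σ e = S1-iff (λ ρ → subst₂ (A ρ) (eval-num ρ σ) (eval-num ρ e)
                           , subst₂ (A ρ) (sym (eval-num ρ σ)) (sym (eval-num ρ e)))
      (ren all-Ask (num σ ∷ num e ∷ v0 ∷ v1 ∷ []))
      where
      A : Env 2 → ℕ → ℕ → Set
      A ρ σ e = Ask σ e (ρ #0) (ρ #1)
      all-Ask : S1 p {4} (λ ρ → Ask (ρ #0) (ρ #1) (ρ #2) (ρ #3))
      all-Ask = ∃' (∃' (ExtS' v5 v2 v1 & ren R' (v1 ∷ v3 ∷ prT v4 v0 ∷ [])))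

    Ask-◂ : ∀ {Z} σ e x → Z ◂ Ask σ e x → ∃ λ τ → ∃ λ z → Ext Z σ τ × R τ e (pr x z)
    Ask-◂ σ e x (s , l , τ , z , ext , rel) = τ , z , ExtS-Ext l ext , rel

    ◂-Ask : ∀ {Z} σ e x τ z → Ext Z σ τ → R τ e (pr x z) → Z ◂ Ask σ e x
    ◂-Ask {Z} σ e x τ z ext rel = pref Z (len τ) , pref-⊂ Z (len τ) , τ , z , Ext-ExtS ext , rel

    module Side (A : SubsetOfω) where

      -- The reservoir is not cut down to A, since that could make B enumerable. Non-enumerability
      -- is kept for `res` itself, and A is only asked to leave `res ∩ A` in 𝒱.
      record Cond : Set where
        constructor cond
        field
          stem      : ℕ
          res       : SubsetOfω
          stem-in   : stem ⊂ A
          res-large : 𝒱 (res ∩ A)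
          res-ns    : ¬ Σ₁B (p ⊞ res)
      open Cond public

      infix 4 _≼_
      _≼_ : Cond → Cond → Set
      d ≼ c = Ext (res c) (stem c) (stem d) × res d ⊆ res c

      ≼-refl : ∀ {c} → c ≼ c
      ≼-refl = (⊑-refl , λ i t → inj₁ t) , λ i x → x

      ≼-trans : ∀ {c d e} → e ≼ d → d ≼ c → e ≼ c
      ≼-trans ((a , b) , l) ((a' , b') , l') =
        (⊑-trans a' a , λ i t → Sum.[ b' i , (λ x → inj₂ (l' i x)) ] (b i t)) , λ i x → l' i (l i x)

      -- A negation is forced in a strong sense: no extension within the whole reservoir, even one
      -- leaving A, satisfies the relation below it. This keeps A out of the question.
      forces : ∀ {k Q} → Chain 𝒱 p R₀ k Q → Cond → ℕ → ℕ → Set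
      refutes : Rel → Cond → ℕ → ℕ → Set
      refutes Q c e w = ∀ τ z → Ext (res c) (stem c) τ → ¬ Q τ e (pr w z)
      forces start c e w = R₀ (stem c) e w
      forces (_▹_ {R = Q} ch l) c e w = refutes Q c e w

      grow : ∀ c {τ} → Ext (res c ∩ A) (stem c) τ → ∃ λ d → d ≼ c × stem d ≡ τ
      grow c {τ} (a , b) = cond τ (res c)
          (λ i t → Sum.[ stem-in c i , (λ x → proj₂ (proj₁ (∩-iff (res c) A i) x)) ] (b i t))
          (res-large c) (res-ns c) ,
        ((a , λ i t → Sum.map₂ (λ x → proj₁ (proj₁ (∩-iff (res c) A i) x)) (b i t)) , λ i x → x) , refl

      -- The set Y of the link meets every member of 𝒱, so `(res ∩ A) ∖ Y` is not in 𝒱 and partition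
      -- regularity leaves `res ∩ Y ∩ A`. As Y is computable from p, the smaller reservoir still
      -- does not enumerate B.
      thinning : ∀ {k Q} (ch : Chain 𝒱 p R₀ k Q) c e w → Q (stem c) e w → ∃ λ d → d ≼ c × forces ch d e w
      thinning start c e w x = c , ≼-refl {c} , x
      thinning (ch ▹ l) c e w x with Link.thin l (stem c) e w x
      ... | Y , y , meets , none = cond (stem c) (res c ∩ Y) (stem-in c) large'
            (NS-≤T 0 (⊞-lub ≤T-⊞ˡ (∩-≤T ≤T-⊞ʳ (≤T-trans y ≤T-⊞ˡ))) (res-ns c)) ,
          ((⊑-refl , λ i t → inj₁ t) , λ i z → proj₁ (proj₁ (∩-iff (res c) Y i) z)) ,
          λ τ z (a , b) → none τ z (a , λ i t → Sum.map₂ (λ z → proj₂ (proj₁ (∩-iff (res c) Y i) z)) (b i t))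
        where
        cover : ∀ i → (res c ∩ A) i ≡ true → ((res c ∩ Y) ∩ A) i ≡ true ⊎ ((res c ∩ A) ∖ Y) i ≡ true
        cover i z = go (Y i) refl
          where
          go : ∀ b → Y i ≡ b → ((res c ∩ Y) ∩ A) i ≡ true ⊎ ((res c ∩ A) ∖ Y) i ≡ true
          go true  eq = let (z₁ , z₂) = proj₁ (∩-iff (res c) A i) z in
            inj₁ (proj₂ (∩-iff (res c ∩ Y) A i) (proj₂ (∩-iff (res c) Y i) (z₁ , eq) , z₂))
          go false eq = inj₂ (proj₂ (∖-iff (res c ∩ A) Y i) (z , eq))
        large' : 𝒱 ((res c ∩ Y) ∩ A)
        large' with regular (res-large c) cover
        ... | inj₁ v = v
        ... | inj₂ v = let (i , z , z') = meets _ v in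
          contradiction (trans (sym z') (proj₂ (proj₁ (∖-iff (res c ∩ A) Y i) z))) λ ()

      -- The index i counts links from the outermost one inwards. Past the start there is nothing to
      -- decide, hence a trivially true equation.
      DecAt : ∀ {k Q} → Chain 𝒱 p R₀ k Q → ℕ → Cond → ℕ → ℕ → Set
      DecAt start i c e w = c ≡ c
      DecAt (_▹_ {R' = Q'} ch l) zero c e w = Q' (stem c) e w ⊎ ∃ λ z → forces ch c e (pr w z)
      DecAt (ch ▹ l) (suc i) c e w = DecAt ch i c e w

      decide : ∀ {k Q} (ch : Chain 𝒱 p R₀ k Q) i c e w → ∃ λ d → d ≼ c × DecAt ch i d e w
      decide start i c e w = c , ≼-refl {c} , refl
      decide (ch ▹ l) (suc i) c e w = decide ch i c e w
      decide (_▹_ {R = Q} {Q'} ch l) zero c e w with em {Q' (stem c) e w}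
      ... | yes x = c , ≼-refl {c} , inj₁ x
      ... | no nx = let (τ , z , ext , x) = Link.force l (stem c) e w nx (res c ∩ A) (res-large c)
                        (d , le , eq) = grow c ext
                        (d' , le' , f) = thinning ch d e (pr w z) (subst (λ s → Q s e (pr w z)) (sym eq) x)
                    in d' , ≼-trans {c} {d} {d'} le' le , inj₂ (z , f)

      Mismatch : Cond → ℕ → Set
      Mismatch c e = ∃ λ x → (B x ≢ true × ∃ λ z → forces ch c e (pr x z)) ⊎ (B x ≡ true × refutes R c e x)

      Above : ℕ → Cond → Set
      Above m c = ∃ λ i → m < i × BT (stem c) i

      add : ∀ m c → ∃ λ d → d ≼ c × Above m d
      add m c = d , le , subst (λ s → ∃ λ i → m < i × BT s i) (sym eq) (i , ≤-<-trans (m≤m⊔n m (len (stem c))) l , new)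
        where
        inf = infinite (res-large c) (m ⊔ len (stem c))
        i : ℕ
        i = proj₁ inf
        l : m ⊔ len (stem c) < i
        l = proj₁ (proj₂ inf)
        -- The stem, followed by zeros and a one at i, which lies beyond both m and the stem.
        f : SubsetOfω
        f k = bitFun (stem c) k ∨ does (k ≟ i)
        τ : ℕ
        τ = pref f (suc i)
        new : BT τ i
        new = pref-BT f (suc i) i ≤-refl last
          where
          last : f i ≡ true
          last rewrite dec-true (i ≟ i) refl with bitFun (stem c) i
          ... | true = refl
          ... | false = refl
        short : len (stem c) < suc i
        short = <-trans (≤-<-trans (m≤n⊔m m (len (stem c))) l) (n<1+n i)
        old : ∀ k → k < len (stem c) → f k ≡ bitFun (stem c) k
        old k l' rewrite dec-false (k ≟ i) (<⇒≢ (<-trans l' (≤-<-trans (m≤n⊔m m (len (stem c))) l))) with bitFun (stem c) k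
        ... | true = refl
        ... | false = refl
        bits : ∀ k → BT τ k → BT (stem c) k ⊎ (res c ∩ A) k ≡ true
        bits k t with k <? len (stem c) | k ≟ i
        ... | yes l' | _ = inj₁ (⊏-BT (⊏-bitFun (stem c)) l' (trans (sym (old k l')) (proj₁ (pref-⊏ f (suc i)) k t)))
        ... | no _ | yes refl = inj₂ (proj₂ (proj₂ inf))
        ... | no nl | no ne = inj₁ (from-bitFun (trans (sym f-k) (proj₁ (pref-⊏ f (suc i)) k t)))
          where
          f-k : f k ≡ bitFun (stem c) k
          f-k rewrite dec-false (k ≟ i) ne with bitFun (stem c) k
          ... | true = refl
          ... | false = refl
          from-bitFun : bitFun (stem c) k ≡ true → BT (stem c) k
          from-bitFun e with bit (stem c) k
          ... | Data.Maybe.just true = refl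
        ext : Ext (res c ∩ A) (stem c) τ
        ext = ( (λ k t → pref-BT f (suc i) k (<-trans (BT-< t) short) (trans (old k (BT-< t)) (proj₁ (⊏-bitFun (stem c)) k t)))
              , (λ k t → pref-BF f (suc i) k (<-trans (BF-< t) short) (trans (old k (BF-< t)) (proj₂ (⊏-bitFun (stem c)) k t))))
            , bits
        grown = grow c ext
        d : Cond
        d = proj₁ grown
        le : d ≼ c
        le = proj₁ (proj₂ grown)
        eq : stem d ≡ τ
        eq = proj₂ (proj₂ grown)

      module Generic (c₀ : Cond) (dense : ∀ c → c ≼ c₀ → ∀ e → ∃ λ d → d ≼ c × Mismatch d e) where

        Met : Req → Cond → Set
        Met (above m)        c = Above m c
        Met (mismatch e)     c = Mismatch c e
        Met (decision i e w) c = DecAt ch i c e w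

        meet : ∀ x c → c ≼ c₀ → ∃ λ d → d ≼ c × Met x d
        meet (above m)        c _  = add m c
        meet (mismatch e)     c le = dense c le e
        meet (decision i e w) c _  = decide ch i c e w

        advance : ∀ t c → c ≼ c₀ → ∃ λ d → d ≼ c × (∀ x pad → t ≡ pr (code x) pad → Met x d)
        advance t c le with em {Scheduled t}
        ... | no n = c , ≼-refl {c} , λ x pad e → ⊥-elim (n (x , pad , e))
        ... | yes (y , pad' , e') = let (d , le' , met) = meet y c le in d , le' , λ x pad e →
          subst (λ z → Met z d) (code-inj y x (proj₁ (pr-inj {code y} {pad'} {code x} {pad} (trans (sym e') e)))) met

        seq : ℕ → Σ Cond (_≼ c₀)
        seq zero    = c₀ , ≼-refl {c₀}
        seq (suc t) = let (c , le) = seq t ; (d , le' , _) = advance t c le in d , ≼-trans {c₀} {c} {d} le' le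

        C : ℕ → Cond
        C t = proj₁ (seq t)

        C-step : ∀ t → C (suc t) ≼ C t
        C-step t = let (c , le) = seq t in proj₁ (proj₂ (advance t c le))

        C-mono : ∀ {s t} → s ≤ t → C t ≼ C s
        C-mono {s} {zero} z≤n = ≼-refl {c₀}
        C-mono {s} {suc t} l with m≤n⇒m<n∨m≡n l
        ... | inj₂ refl = ≼-refl {C (suc t)}
        ... | inj₁ l' = ≼-trans {C s} {C t} {C (suc t)} (C-step t) (C-mono (≤-pred l'))

        cofinal : ∀ x t₀ → ∃ λ t → t₀ ≤ t × Met x (C t)
        cofinal x t₀ = suc T , ≤-trans (pr-≥₂ (code x) t₀) (n≤1+n T) ,
            (let (c , le) = seq T in proj₂ (proj₂ (advance T c le)) x t₀ refl)
          where
          T : ℕ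
          T = pr (code x) t₀

        compatible : ∀ t t' i → i < len (stem (C t')) →
          (BT (stem (C t)) i → BT (stem (C t')) i) × (BF (stem (C t)) i → BF (stem (C t')) i)
        compatible t t' i l with ≤-total t t'
        ... | inj₁ le = let (T , F) = proj₁ (proj₁ (C-mono le)) in T i , F i
        ... | inj₂ le = let (T , F) = proj₁ (proj₁ (C-mono le)) in
            (λ b → Sum.[ (λ b' → b') , (λ f → BT-BF b (F i f)) ] (BT⊎BF _ i l))
          , (λ b → Sum.[ (λ t → BT-BF (T i t) b) , (λ b' → b') ] (BT⊎BF _ i l))

        when : ℕ → ℕ
        when i = proj₁ (cofinal (above i) 0)

        long-stem : ∀ i → i < len (stem (C (when i)))
        long-stem i = let (_ , _ , k , l , b) = cofinal (above i) 0 in <-trans l (BT-< b)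

        G : SubsetOfω
        G i = bitFun (stem (C (when i))) i

        stem⊏G : ∀ t → stem (C t) ⊏ G
        stem⊏G t = (λ i b → proj₁ (⊏-bitFun _) i (proj₁ (compatible t (when i) i (long-stem i)) b))
                 , (λ i b → proj₂ (⊏-bitFun _) i (proj₂ (compatible t (when i) i (long-stem i)) b))

        G-infinite : Infinite G
        G-infinite m = let (t , _ , i , l , b) = cofinal (above m) 0 in i , l , proj₁ (stem⊏G t) i b

        G⊆A : G ⊆ A
        G⊆A i e = stem-in (C (when i)) i (⊏-BT (⊏-bitFun _) (long-stem i) e)

        Decides : ∀ {k Q} → Chain 𝒱 p R₀ k Q → Set
        Decides ch = ∀ i e w t₀ → ∃ λ t → t₀ ≤ t × DecAt ch i (C t) e w

        later : ∀ {s t} → s ≤ t → Ext (res (C s)) (stem (C s)) (stem (C t))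
        later l = proj₁ (C-mono l)

        -- Truth lemma. If a refuted formula held of G, take a later condition that has decided it:
        -- either its stem satisfies the refuted relation, or it forces a witness that makes the
        -- formula false by the inner induction.
        forces-true : ∀ {k Q} (ch : Chain 𝒱 p R₀ k Q) → Decides ch → ∀ t e w → forces ch (C t) e w → sem R₀ k G e w
        refutes-true : ∀ {k Q} (ch : Chain 𝒱 p R₀ k Q) → Decides ch → ∀ t e w →
          refutes Q (C t) e w → ¬ (∃ λ z → sem R₀ k G e (pr w z))
        forces-true start D t e w x = stem (C t) , stem⊏G t , x
        forces-true (ch ▹ l) D t e w x = refutes-true ch (λ i → D (suc i)) t e w x
        refutes-true start D t e w ref (z , s , h , x) = let (t' , le , i , l , b) = cofinal (above (len s)) t in
          ref (stem (C t')) z (later le) (R₀-mono (⊏-⊑ h (stem⊏G t') (<⇒≤ (<-trans l (BT-< b)))) x)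
        refutes-true (ch ▹ l) D t e w ref (z , x) with D 0 e (pr w z) t
        ... | t' , le , inj₁ q = ref (stem (C t')) z (later le) q
        ... | t' , le , inj₂ (z' , f) = x (z' , forces-true ch (λ i → D (suc i)) t' e (pr (pr w z) z') f)

        decides : Decides ch
        decides i e w = cofinal (decision i e w)

        G-avoids : ∀ e → ¬ (∀ x → B x ≡ true iff ∃ λ z → sem R₀ n G e (pr x z))
        G-avoids e spec = clash (cofinal (mismatch e) 0)
          where
          clash : (∃ λ t → 0 ≤ t × Mismatch (C t) e) → ⊥
          clash (t , _ , x , inj₁ (nb , z , f)) = nb (proj₂ (spec x) (z , forces-true ch decides t e (pr x z) f))
          clash (t , _ , x , inj₂ (b , ref)) = refutes-true ch decides t e x ref (proj₁ (spec x) b)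

      Solution : Set
      Solution = ∃ λ G → Infinite G × G ⊆ A × (∀ e → ¬ (∀ x → B x ≡ true iff ∃ λ z → sem R₀ n G e (pr x z)))

      generic : (c₀ : Cond) → (∀ c → c ≼ c₀ → ∀ e → ∃ λ d → d ≼ c × Mismatch d e) → Solution
      generic c₀ dense = G , G-infinite , G⊆A , G-avoids
        where open Generic c₀ dense

      positive-mismatch : ∀ c e x → B x ≢ true → res c ∩ A ◂ Ask (stem c) e x → ∃ λ d → d ≼ c × Mismatch d e
      positive-mismatch c e x nb o =
        let (τ , z , ext , rel) = Ask-◂ (stem c) e x o
            (d , le , eq) = grow c ext
            (d' , le' , f) = thinning ch d e (pr x z) (subst (λ s → R s e (pr x z)) (sym eq) rel)
        in d' , ≼-trans {c} {d} {d'} le' le , x , inj₁ (nb , z , f)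

      negative-mismatch : ∀ c e x Z → B x ≡ true → Z ⊆ res c → 𝒱 (Z ∩ A) → ¬ Σ₁B (p ⊞ Z) →
        ¬ (Z ◂ Ask (stem c) e x) → ∃ λ d → d ≼ c × Mismatch d e
      negative-mismatch c e x Z b l v nz out = cond (stem c) Z (stem-in c) v nz , ((⊑-refl , λ i t → inj₁ t) , l) ,
        x , inj₂ (b , λ τ z ext rel → out (◂-Ask (stem c) e x τ z ext rel))

    ∩-⊆ : ∀ Y Z → (Y ∩ Z) ⊆ Y
    ∩-⊆ Y Z i e = proj₁ (proj₁ (∩-iff Y Z i) e)

    ∖-⊆ : ∀ Y Z → (Y ∖ Z) ⊆ Y
    ∖-⊆ Y Z i e = proj₁ (proj₁ (∖-iff Y Z i) e)

    ∩-mono : ∀ {Y Y'} Z → Y ⊆ Y' → (Y ∩ Z) ⊆ (Y' ∩ Z)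
    ∩-mono {Y} {Y'} Z l i e = let (a , b) = proj₁ (∩-iff Y Z i) e in proj₂ (∩-iff Y' Z i) (l i a , b)

    split-𝒱 : ∀ {X} C A → 𝒱 (X ∩ A) → 𝒱 ((X ∩ C) ∩ A) ⊎ 𝒱 ((X ∖ C) ∩ A)
    split-𝒱 {X} C A v = regular v λ i e → go i (proj₁ (∩-iff X A i) e) (C i) refl
      where
      go : ∀ i → X i ≡ true × A i ≡ true → ∀ b → C i ≡ b → ((X ∩ C) ∩ A) i ≡ true ⊎ ((X ∖ C) ∩ A) i ≡ true
      go i (x , a) true  eq = inj₁ (proj₂ (∩-iff (X ∩ C) A i) (proj₂ (∩-iff X C i) (x , eq) , a))
      go i (x , a) false eq = inj₂ (proj₂ (∩-iff (X ∖ C) A i) (proj₂ (∖-iff X C i) (x , eq) , a))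

    module Density (A A' : SubsetOfω) (compl : ∀ i → A' i ≡ false → A i ≡ true) where
      private
        module L = Side A
        module M = Side A'
      open L using (_≼_; Mismatch; stem; res; res-large; res-ns; cond; stem-in)

      ∖-∩ : ∀ X → (X ∖ A') ⊆ (X ∩ A)
      ∖-∩ X i e = let (x , a) = proj₁ (∖-iff X A' i) e in proj₂ (∩-iff X A i) (x , compl i a)

      -- Some class of the stratum is missed by `res c ∩ A'`; it takes the place of the other side's
      -- formula. In the unsplittable case the partition by A' can only succeed on the side of A. In
      -- the splittable case the first half avoids that class, so the second half carries the
      -- largeness.
      one-sided : ∀ c e → ¬ 𝒱 (res c ∩ A') → ∃ λ d → d ≼ c × Mismatch d e
      one-sided c e nv = dne λ none → nv λ a ℓ on → dne λ out → none (found a ℓ on out)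
        where
        Z : SubsetOfω
        Z = res c
        found : ∀ a ℓ → On a → ¬ (Z ∩ A' ◂ Cls a ℓ) → ∃ λ d → d ≼ c × Mismatch d e
        found a ℓ on out = go (split-reservoir (res-ns c) (λ _ → Cls a ℓ) (Ask (stem c) e) Cls-at (Ask' (stem c) e))
          where
          Cls-at : S1 p {2} (λ ρ → Cls a ℓ (ρ #1))
          Cls-at = S1-iff (λ ρ → subst₂ (λ a ℓ → Cls a ℓ (ρ #1)) (eval-num ρ a) (eval-num ρ ℓ)
                               , subst₂ (λ a ℓ → Cls a ℓ (ρ #1)) (sym (eval-num ρ a)) (sym (eval-num ρ ℓ)))
            (ren Cls' (num a ∷ num ℓ ∷ v1 ∷ []))
          go : Unsplittable Z (λ _ → Cls a ℓ) (Ask (stem c) e) ⊎ Splittable Z (λ _ → Cls a ℓ) (Ask (stem c) e) →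
            ∃ λ d → d ≼ c × Mismatch d e
          go (inj₁ (x , nb , uns)) = Sum.[ (λ o → ⊥-elim (out o))
                                         , (λ o → L.positive-mismatch c e x nb (◂-⊆ (∖-∩ Z) o)) ] (uns A')
          go (inj₂ (x , b , C , out₀ , out₁ , _ , n₁)) =
            Sum.[ (λ v → ⊥-elim (out₀ (𝒱-⊆ (∩-⊆ (Z ∩ C) A) v a ℓ on)))
                , (λ v → L.negative-mismatch c e x (Z ∖ C) b (∖-⊆ Z C) v n₁ out₁) ]′ (split-𝒱 {Z} C A (res-large c))

      -- A success on the other side would free the stuck condition c₀, so every case must yield one
      -- here. If only the first half of a split remains large for A, it cannot be large for A', as
      -- that would give c₀ a negative mismatch; then `one-sided` applies.
      two-sided : ∀ c₀ e₀ → ¬ (∃ λ d → d M.≼ c₀ × M.Mismatch d e₀) → ∀ c e → res c ⊆ M.res c₀ →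
        ∃ λ d → d ≼ c × Mismatch d e
      two-sided c₀ e₀ stuck c e l with em {𝒱 (res c ∩ A')}
      ... | no nv = one-sided c e nv
      ... | yes v' = found
          (split-reservoir (res-ns c) (Ask (M.stem c₀) e₀) (Ask (stem c) e) (Ask' (M.stem c₀) e₀) (Ask' (stem c) e))
        where
        Z : SubsetOfω
        Z = res c
        c₁ : M.Cond
        c₁ = M.cond (M.stem c₀) Z (M.stem-in c₀) v' (res-ns c)
        c₁≼ : c₁ M.≼ c₀
        c₁≼ = (⊑-refl , λ i t → inj₁ t) , l
        stuck₁ : ¬ (∃ λ d → d M.≼ c₁ × M.Mismatch d e₀)
        stuck₁ (d , le , m) = stuck (d , M.≼-trans {c₀} {c₁} {d} le c₁≼ , m)
        found : Unsplittable Z (Ask (M.stem c₀) e₀) (Ask (stem c) e) ⊎ Splittable Z (Ask (M.stem c₀) e₀) (Ask (stem c) e) →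
          ∃ λ d → d ≼ c × Mismatch d e
        found (inj₁ (x , nb , uns)) = Sum.[ (λ o → ⊥-elim (stuck₁ (M.positive-mismatch c₁ e₀ x nb o)))
                                          , (λ o → L.positive-mismatch c e x nb (◂-⊆ (∖-∩ Z) o)) ] (uns A')
        found (inj₂ (x , b , C , out₀ , out₁ , n₀ , n₁)) with split-𝒱 {Z} C A (res-large c)
        ... | inj₂ v = L.negative-mismatch c e x (Z ∖ C) b (∖-⊆ Z C) v n₁ out₁
        ... | inj₁ v =
          let d = cond (stem c) (Z ∩ C) (stem-in c) v n₀
              le : d ≼ c
              le = (⊑-refl , λ i t → inj₁ t) , ∩-⊆ Z C
              (d' , le' , m) = one-sided d e λ v₀ → stuck₁
                (M.negative-mismatch c₁ e₀ x (Z ∩ C) b (∩-⊆ Z C) v₀ n₀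
                  (λ o → out₀ o))
          in d' , L.≼-trans {c} {d} {d'} le' le , m

    not-true : ∀ (b : Bool) → not b ≡ false → b ≡ true
    not-true true _ = refl

    module Solve (A : SubsetOfω) where

      A' : SubsetOfω
      A' i = not (A i)

      private
        module P = Side A
        module N = Side A'
        module DP = Density A A' (λ i e → not-true (A i) e)
        module DN = Density A' A (λ i e → cong not e)

      no-loss : ¬ Σ₁B (p ⊞ full)
      no-loss = NS-≤T 0 (⊞-lub ≤T-refl full≤) ns
        where
        full≤ : full ≤T p
        full≤ .member = S1-iff (λ ρ → (λ _ → refl) , (λ _ → refl)) (at (zer ≐ zer))
        full≤ .absent = S1-iff (λ ρ → (λ n → ⊥-elim (n refl)) , (λ ())) (at (neg (zer ≐ zer)))

      -- If no condition for A is ever stuck, A has a solution provided it is large. A stuck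
      -- condition for A makes mismatches dense on the other side, but only below its own reservoir;
      -- this is why `generic` asks for density below a given condition.
      solve : P.Solution ⊎ N.Solution
      solve with em {∃ λ c → ∃ λ e → ¬ (∃ λ d → d P.≼ c × P.Mismatch d e)}
      ... | yes (c , e , stuck) with em {𝒱 (P.res c ∩ A')}
      ...   | no nv  = ⊥-elim (stuck (DP.one-sided c e nv))
      ...   | yes v' = inj₂ (N.generic (N.cond ε (P.res c) ε-⊂ v' (P.res-ns c))
                         λ d le e' → DN.two-sided c e stuck d e' (proj₂ le))
      solve | no never with em {𝒱 (full ∩ A)}
      ...   | yes v = inj₁ (P.generic (P.cond ε full ε-⊂ v no-loss) λ c _ e → dne λ stuck → never (c , e , stuck))
      ...   | no nv = inj₂ (N.generic (N.cond ε full ε-⊂ v' no-loss) λ c le e →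
                        DN.one-sided c e λ v → nv (𝒱-⊆ (∩-mono A (proj₂ le)) v))
        where
        cover : ∀ b → b ≡ true ⊎ not b ≡ true
        cover true  = inj₁ refl
        cover false = inj₂ refl
        v' : 𝒱 (full ∩ A')
        v' = Sum.[ (λ v → ⊥-elim (nv v)) , (λ v → v) ]′ (regular {full} {full ∩ A} {full ∩ A'} whole λ i _ → cover (A i))

-- Normal forms of arithmetical formulas and assembly of the proof

module Definability (em : ExcludedMiddle 0ℓ) where
  open Strings em
  open Queries em
  open UniversalSet em
  open Degrees em
  open BasisTheorems em
  open Strata em
  open NextStratum em
  open Forcing em
  open _≤T_

  -- `U` is not monotone in its string argument; allowing any t ⊑ s makes it so.
  R₀ : Rel
  R₀ s e w = ∃ λ t → t ⊑ s × U (pr e w) t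

  R₀' : ∀ {q} → S1Rel q R₀
  R₀' = ∃' (⊑' v0 v1 & U' (prT v2 v3) v0)

  R₀-mono : ∀ {s t e w} → s ⊑ t → R₀ s e w → R₀ t e w
  R₀-mono l (u , l' , x) = u , ⊑-trans l' l , x

  sem₀ : ∀ G e w → sem R₀ 0 G e w iff JP G (pr e w)
  sem₀ G e w = (λ (s , h , t , l , u) → t , ⊑-⊏ l h , u) , (λ (s , h , u) → s , h , s , ⊑-refl , u)

  Functional : (ℕ → ℕ → Set) → Set
  Functional F = ∀ {w a b} → F w a → F w b → a ≡ b

  -- A Σ⁰₁ substitution for the argument w is absorbed into the index. Under a quantifier over z the
  -- graph has to act on pairs and fix z, hence the induction over all F.
  reindex : ∀ k (F : ℕ → ℕ → Set) → S1 ∅ {2} (λ ρ → F (ρ #0) (ρ #1)) → Functional F →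
    ∀ e → ∃ λ e' → ∀ G w w' → F w w' → sem R₀ k G e' w iff sem R₀ k G e w'
  reindex zero F F' fun e = proj₁ en , λ G w w' f → iff-trans (sem₀ G (proj₁ en) w)
      (iff-trans (to G w w' f , from G w w' f) (iff-sym (sem₀ G e w')))
    where
    P : ℕ → ℕ → Set
    P n w = ∃ λ w' → F w w' × U (pr e w') n
    P' : S1 ∅ {2} (λ ρ → P (ρ #0) (ρ #1))
    P' = S1-iff (λ ρ → (λ (w' , f , u) → w' , f , subst (λ z → U (pr z w') (ρ #0)) (eval-num (extend w' ρ) e) u)
                     , (λ (w' , f , u) → w' , f , subst (λ z → U (pr z w') (ρ #0)) (sym (eval-num (extend w' ρ) e)) u))
      (∃' (ren F' (v2 ∷ v0 ∷ []) & U' (prT (num e) v0) v1))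
    en : ∃ λ c → ∀ n w → P n w iff U (pr c w) n
    en = universal {P} P'
    to : ∀ G w w' → F w w' → JP G (pr (proj₁ en) w) → JP G (pr e w')
    to G w w' f (s , h , u) = let (w'' , f' , u') = proj₂ (proj₂ en s w) u in
      s , h , subst (λ z → U (pr e z) s) (fun f' f) u'
    from : ∀ G w w' → F w w' → JP G (pr e w') → JP G (pr (proj₁ en) w)
    from G w w' f (s , h , u) = s , h , proj₁ (proj₂ en s w) (w' , f , u)
  reindex (suc k) F F' fun e = let (e' , h) = reindex k F⁺ F⁺' fun⁺ e in e' , λ G w w' f →
      (λ n (z , x) → n (z , proj₂ (h G (pr w z) (pr w' z) (w , w' , z , refl , refl , f)) x))
    , (λ n (z , x) → n (z , proj₁ (h G (pr w z) (pr w' z) (w , w' , z , refl , refl , f)) x))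
    where
    F⁺ : ℕ → ℕ → Set
    F⁺ v v' = ∃ λ w → ∃ λ w' → ∃ λ z → v ≡ pr w z × v' ≡ pr w' z × F w w'
    F⁺' : S1 ∅ {2} (λ ρ → F⁺ (ρ #0) (ρ #1))
    F⁺' = ∃' (∃' (∃' (pr≡ v3 v2 v0 & pr≡ v4 v1 v0 & ren F' (v2 ∷ v1 ∷ []))))
    fun⁺ : Functional F⁺
    fun⁺ (w , a , z , e₁ , refl , f) (w' , b , z' , e₂ , refl , f')
      with pr-inj {w} {z} {w'} {z'} (trans (sym e₁) e₂)
    ... | refl , refl = cong (λ x → pr x z) (fun f f')

  -- Total decoding of pairs; numbers that are not of the form ⟨y, z⟩ decode to (0, 0).
  Pair : ℕ → ℕ → ℕ → Set
  Pair v y z = v ≡ pr y z ⊎ (y ≡ 0 × z ≡ 0 × ∀ a → a < suc v → ∀ b → b < suc v → v ≢ pr a b)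

  Pair' : S1 ∅ {3} (λ ρ → Pair (ρ #0) (ρ #1) (ρ #2))
  Pair' = pr≡ v0 v1 v2 ∣∣ at (v1 ≐ zer) & at (v2 ≐ zer) & ∀' (succ v0) (∀' (succ v1) (at (neg (v2 ≐ prT v1 v0))))

  Pair-total : ∀ v → ∃ λ y → ∃ λ z → Pair v y z
  Pair-total v with em {∃ λ y → ∃ λ z → v ≡ pr y z}
  ... | yes (y , z , e) = y , z , inj₁ e
  ... | no n = 0 , 0 , inj₂ (refl , refl , λ a _ b _ e → n (a , b , e))

  Pair-fun : ∀ {v y z y' z'} → Pair v y z → Pair v y' z' → y ≡ y' × z ≡ z'
  Pair-fun {v} {y} {z} {y'} {z'} (inj₁ e) (inj₁ e') = pr-inj {y} {z} {y'} {z'} (trans (sym e) e')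
  Pair-fun {v} {y} {z} (inj₁ e) (inj₂ (_ , _ , n)) = ⊥-elim (n y (s≤s (subst (y ≤_) (sym e) (pr-≥₁ y z))) z (s≤s (subst (z ≤_) (sym e) (pr-≥₂ y z))) e)
  Pair-fun {v} {y} {z} {y'} {z'} (inj₂ (_ , _ , n)) (inj₁ e) = ⊥-elim (n y' (s≤s (subst (y' ≤_) (sym e) (pr-≥₁ y' z'))) z' (s≤s (subst (z' ≤_) (sym e) (pr-≥₂ y' z'))) e)
  Pair-fun (inj₂ (refl , refl , _)) (inj₂ (refl , refl , _)) = refl , refl

  envCode : ∀ {k} → Env (suc k) → ℕ
  envCode {zero}  ρ = ρ #0
  envCode {suc k} ρ = pr (envCode (λ i → ρ (suc i))) (ρ #0)

  Packed : ∀ k → (ℕ → Env (suc k) → Set) → Set₁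
  Packed k Q = Σ (ℕ → ℕ → Set) λ Q₂ →
    S1 ∅ {2} (λ ρ → Q₂ (ρ #0) (ρ #1)) × (∀ n ρ → Q₂ n (envCode ρ) iff Q n ρ)

  module _ {k : ℕ} {Q : ℕ → Env (suc (suc k)) → Set}
    (Q' : S1 ∅ {suc (suc (suc k))} (λ ρ → Q (ρ #0) (λ i → ρ (suc i)))) where
    private
      inn : Fin (suc (suc (suc k))) → Term (suc (suc (suc (suc k))))
      inn zero          = v1
      inn (suc zero)    = v0
      inn (suc (suc i)) = var (suc (suc (suc i)))

      eq : ∀ (ρ : Env (suc (suc k))) n x i →
        evalT (extend x (extend n ρ)) (inn i) ≡ extend n (extend x (λ i → ρ (suc i))) i
      eq ρ n x zero          = refl
      eq ρ n x (suc zero)    = refl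
      eq ρ n x (suc (suc i)) = refl

      η : ∀ n (ρ : Env (suc (suc k))) i → extend n (extend (ρ #0) (λ i → ρ (suc i))) i ≡ extend n ρ i
      η n ρ #0          = refl
      η n ρ #1    = refl
      η n ρ (suc (suc i)) = refl

    -- Moves a variable into the slot of the string, which shortens the environment for the
    -- recursion in `pack`.
    Merged : ℕ → Env (suc k) → Set
    Merged m ρ = ∃ λ n → ∃ λ x → m ≡ pr n x × Q n (extend x ρ)

    Merged' : S1 ∅ {suc (suc k)} (λ ρ → Merged (ρ #0) (λ i → ρ (suc i)))
    Merged' = S1-iff (λ ρ → (λ (n , x , e , q) → n , x , e , S1-ext Q' (eq ρ n x) q)
                          , (λ (n , x , e , q) → n , x , e , S1-ext Q' (λ i → sym (eq ρ n x i)) q))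
      (∃' (∃' (pr≡ v2 v1 v0 & renf Q' inn)))

    unmerge : Packed k Merged → Packed (suc k) Q
    unmerge (P , P' , h) = Q₂ , ∃' (∃' (pr≡ v3 v1 v0 & ren P' (prT v2 v0 ∷ v1 ∷ []))) , λ n ρ → to n ρ , from n ρ
      where
      Q₂ : ℕ → ℕ → Set
      Q₂ n v = ∃ λ w → ∃ λ x → v ≡ pr w x × P (pr n x) w
      merged : ∀ n ρ → Merged (pr n (ρ #0)) (λ i → ρ (suc i)) → Q n ρ
      merged n ρ (n' , x' , e , q) with pr-inj {n} {ρ #0} {n'} {x'} e
      ... | refl , refl = S1-ext Q' (η n ρ) q
      to : ∀ n ρ → Q₂ n (envCode ρ) → Q n ρ
      to n ρ (w , x , e , q) = merged n ρ (proj₁ (h (pr n (ρ #0)) (λ i → ρ (suc i)))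
        (subst₂ (λ x w → P (pr n x) w) (sym (proj₂ eqs)) (sym (proj₁ eqs)) q))
        where
        eqs : envCode (λ i → ρ (suc i)) ≡ w × ρ #0 ≡ x
        eqs = pr-inj {envCode (λ i → ρ (suc i))} {ρ #0} {w} {x} e
      from : ∀ n ρ → Q n ρ → Q₂ n (envCode ρ)
      from n ρ q = envCode (λ i → ρ (suc i)) , ρ #0 , refl ,
        proj₂ (h (pr n (ρ #0)) (λ i → ρ (suc i))) (n , ρ #0 , refl , S1-ext Q' (λ i → sym (η n ρ i)) q)

  pack : ∀ k {Q : ℕ → Env (suc k) → Set} → S1 ∅ {suc (suc k)} (λ ρ → Q (ρ #0) (λ i → ρ (suc i))) → Packed k Q
  pack zero {Q} Q' = (λ n w → Q n (single w)) ,
      S1-iff (λ ρ → S1-ext Q' (eq ρ) , S1-ext Q' (λ i → sym (eq ρ i))) Q' ,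
      (λ n ρ → S1-ext Q' (eq' n ρ) , S1-ext Q' (λ i → sym (eq' n ρ i)))
    where
    eq : ∀ (ρ : Env 2) i → ρ i ≡ extend (ρ #0) (single (ρ #1)) i
    eq ρ #0       = refl
    eq ρ #1 = refl
    eq' : ∀ n (ρ : Env 1) i → extend n (single (ρ #0)) i ≡ extend n ρ i
    eq' n ρ #0       = refl
    eq' n ρ #1 = refl
  pack (suc k) {Q} Q' = unmerge {k} {Q} Q' (pack k {Merged {k} {Q} Q'} (Merged' {k} {Q} Q'))

  indexΔ : ∀ {k} (δ : Δ₀ (suc k)) → ∃ λ e → ∀ G ρ → satΔ G ρ δ iff sem R₀ 0 G e (envCode ρ)
  indexΔ {k} δ = let (Q₂ , Q₂' , h) = pack k {λ s ρ → Tr s true ρ δ} (Tr' true δ) ; (c , u) = universal {Q₂} Q₂' in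
    c , λ G ρ → iff-trans
      ( (λ x → let (ℓ , y) = Complete.complete G true ρ δ x in
           pref G ℓ , pref-⊏ G ℓ , proj₁ (u _ _) (proj₂ (h _ ρ) y))
      , (λ (s , l , y) → Tr-sound l true ρ δ (proj₁ (h s ρ) (proj₂ (u _ _) y))) )
      (iff-sym (sem₀ G c (envCode ρ)))

  iff-¬ : ∀ {A B : Set} → A iff B → (¬ A) iff (¬ B)
  iff-¬ (f , g) = (λ n b → n (g b)) , (λ n a → n (f a))

  indexΠ : ∀ m {k} (φ : PiF m (suc k)) → ∃ λ e → ∀ G ρ → satΠ G ρ φ iff sem R₀ m G e (envCode ρ)
  indexΣ : ∀ m {k} (φ : SigmaF (suc m) (suc k)) → ∃ λ e → ∀ G ρ →
    satΣ G ρ φ iff ∃ λ z → sem R₀ m G e (pr (envCode ρ) z)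
  indexΠ zero    (bnd δ) = indexΔ δ
  indexΠ (suc m) φ = let (e , h) = indexΣ m (negΠ φ) in e , λ G ρ →
    iff-trans ((λ x n → n x) , dne) (iff-¬ (iff-trans (iff-sym (sat-negΠ φ ρ)) (h G ρ)))
  -- The outer quantifier is a dummy: 0 is a witness, and reindexing discards whatever witness is
  -- given.
  indexΣ m (base φ) = let (e , h) = indexΠ m φ
                          (e' , h') = reindex m (λ v w → ∃ λ z → v ≡ pr w z) (∃' (pr≡ v1 v2 v0)) drop-fun e in
    e' , λ G ρ → iff-trans (h G ρ)
      ( (λ x → 0 , proj₂ (h' G _ _ (0 , refl)) x)
      , (λ (z , x) → proj₁ (h' G _ _ (z , refl)) x) )
    where
    drop-fun : Functional (λ v w → ∃ λ z → v ≡ pr w z)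
    drop-fun {v} {a} {b} (z , e) (z' , e') = proj₁ (pr-inj {a} {z} {b} {z'} (trans (sym e) e'))
  -- Two adjacent quantifiers become one over v. Decoding must be total: where it were undefined, a
  -- negated `sem` could hold vacuously. The default (0, 0) is harmless, being a genuine pair of
  -- witnesses whenever v succeeds.
  indexΣ m {k} (ex φ) = let (e , h) = indexΣ m φ ; (e' , h') = reindex m F F' F-fun e in
    e' , λ G ρ →
      ( (λ (y , x) → let (z , x') = proj₁ (h G (extend y ρ)) x in
          pr y z , proj₂ (h' G _ _ (envCode ρ , pr y z , y , z , refl , inj₁ refl , refl)) x')
      , (λ (v , x) → let (y , z , d) = Pair-total v in
          y , proj₂ (h G (extend y ρ)) (z , proj₁ (h' G _ _ (envCode ρ , v , y , z , refl , d , refl)) x)) )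
    where
    F : ℕ → ℕ → Set
    F u u' = ∃ λ w → ∃ λ v → ∃ λ y → ∃ λ z → u ≡ pr w v × Pair v y z × u' ≡ pr (pr w y) z
    F' : S1 ∅ {2} (λ ρ → F (ρ #0) (ρ #1))
    F' = ∃' (∃' (∃' (∃' (pr≡ v4 v3 v2 & ren Pair' (v2 ∷ v1 ∷ v0 ∷ []) & pr≡ v5 (prT v3 v1) v0))))
    F-fun : Functional F
    F-fun (w , v , y , z , e , d , refl) (w' , v' , y' , z' , e' , d' , refl)
      with pr-inj {w} {v} {w'} {v'} (trans (sym e) e')
    ... | refl , refl with Pair-fun d d'
    ...   | refl , refl = refl

  ground : Stratum ∅
  ground = record
    { Cls = λ a ℓ s → ∃ λ i → ℓ < i × BT s i
    ; Cls' = ∃' (at (v2 ≺ v0) & BT' v3 v0)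
    ; On = λ _ → ⊤
    ; Off' = S1-iff (λ ρ → (λ n _ → n refl) , (λ n → ⊥-elim (n tt))) (at (neg (zer ≐ zer)))
    ; regular = regular
    ; infinite = λ v m → let (s , l , i , b , t) = v 0 m tt in i , b , l i t
    ; whole = λ a ℓ _ → member-◂ full ℓ (suc ℓ) ≤-refl refl }
    where
    Inf : SubsetOfω → Set
    Inf Z = ∀ (a ℓ : ℕ) → ⊤ → Z ◂ (λ s → ∃ λ i → ℓ < i × BT s i)
    member-◂ : ∀ Z ℓ i → ℓ < i → Z i ≡ true → Z ◂ (λ s → ∃ λ i → ℓ < i × BT s i)
    member-◂ Z ℓ i l e = pref Z (suc i) , pref-⊂ Z (suc i) , i , l , pref-BT Z (suc i) i ≤-refl e
    regular : ∀ {Z Z₀ Z₁} → Inf Z → (∀ i → Z i ≡ true → Z₀ i ≡ true ⊎ Z₁ i ≡ true) → Inf Z₀ ⊎ Inf Z₁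
    regular {Z} {Z₀} {Z₁} v cover with em {Inf Z₀}
    ... | yes v₀ = inj₁ v₀
    ... | no n₀ = inj₂ λ a ℓ _ → dne λ n → n₀ λ a' ℓ' _ → dne λ n' → clash ℓ ℓ' n n'
      where
      clash : ∀ ℓ ℓ' → ¬ (Z₁ ◂ (λ s → ∃ λ i → ℓ < i × BT s i)) → ¬ (Z₀ ◂ (λ s → ∃ λ i → ℓ' < i × BT s i)) → ⊥
      clash ℓ ℓ' n n' with v 0 (ℓ ⊔ ℓ') tt
      ... | s , l , i , lt , t with cover i (l i t)
      ...   | inj₁ e = n' (member-◂ Z₀ ℓ' i (≤-<-trans (m≤n⊔m ℓ ℓ') lt) e)
      ...   | inj₂ e = n (member-◂ Z₁ ℓ i (≤-<-trans (m≤m⊔n ℓ ℓ') lt) e)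

  module Main (B : SubsetOfω) where
    open Avoid B

    record Tower (n : ℕ) : Set₁ where
      field
        {p}     : SubsetOfω
        stratum : Stratum p
        {R}     : Rel
        R'      : S1Rel p R
        chain   : Chain (Stratum.𝒱 stratum) p R₀ n R
        ns      : ¬ Σ₁B p

    -- Each step exchanges one level of the hypothesis on B for one link, so m + k stays equal to
    -- the length of the final chain.
    climb : ∀ m k {p} (S : Stratum p) (R : Rel) → S1Rel p R → Chain (Stratum.𝒱 S) p R₀ k R → NS m p → Tower (m + k)
    climb zero    k S R R' ch ns = record { stratum = S ; R' = R' ; chain = ch ; ns = ns }
    climb (suc m) k {p} S R R' ch ns = subst Tower (+-suc m k)
      (climb m (suc k) next (RN R R') (RN' R R') (Chain-map 𝒱N-⊆𝒱 p≤p' ch ▹ link R R') ns')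
      where open Build B m S ns

    tower : ∀ n → NS n ∅ → Tower n
    tower n ns = subst Tower (+-identityʳ n) (climb n 0 ground R₀ R₀' start ns)

    module _ (n : ℕ) (T : Tower n) (A : SubsetOfω) where
      open Tower T
      open Final B stratum R₀ (λ {s} {t} {e} {w} → R₀-mono {s} {t} {e} {w}) R' chain ns

      not-Σ : ∀ G → (∀ e → ¬ (∀ x → B x ≡ true iff ∃ λ z → sem R₀ n G e (pr x z))) → ¬ IsSigma⁰ (suc n) G B
      not-Σ G avoid (φ , h) = let (e , s) = indexΣ n φ in avoid e λ x → iff-trans (h x) (s G (single x))

      ∁-true : ∀ i → not (A i) ≡ true → ∁ A i ≡ true
      ∁-true i e with A i
      ... | false = refl

      conclusion : Σ SubsetOfω (λ G → Infinite G × ((G ⊆ A) ⊎ (G ⊆ ∁ A)) × ¬ IsSigma⁰ (suc n) G B)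
      conclusion with Solve.solve A
      ... | inj₁ (G , inf , sub , avoid) = G , inf , inj₁ sub , not-Σ G avoid
      ... | inj₂ (G , inf , sub , avoid) = G , inf , inj₂ (λ i x → ∁-true i (sub i x)) , not-Σ G avoid

theorem4p11 : ExcludedMiddle 0ℓ → (n : ℕ) → (B : SubsetOfω) → ¬ IsSigma⁰-plain (suc n) B →
    (A : SubsetOfω) → Σ SubsetOfω (λ G →
    Infinite G × ((G ⊆ A) ⊎ (G ⊆ ∁ A)) × ¬ IsSigma⁰ (suc n) G B)
theorem4p11 em n B ns A = conclusion n (tower n (NS-∅ n ns)) A
  where
  open Degrees.Avoid em B using (NS-∅)
  open Definability.Main em B using (tower; conclusion)
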